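{- Let $\sigma\ge 0$. $\sigma$-Slack Interval-Constrained Scheduling, with $n$ jobs and $m$ machines, is solvable in time $$O\Bigl((\sigma+1)^{(2\sigma+1)m}\cdot n\cdot \sigma m\cdot\log \sigma m + n\log n\Bigr).$$
   Context: Convention: $0\in\mathbb N$. Interval-Constrained Scheduling is the following decision problem. Input: a set $J=\{1,\dots,n\}$ of jobs, a number $m\in\mathbb N$ of machines, and for each job $j$ a release time $t_j\in\mathbb N$, a deadline $d_j\in\mathbb N$, and a processing time $p_j\in\mathbb N$. Question: is there a (feasible) schedule that schedules all jobs onto $m$ parallel identical machines such that (1) each job $j$ is executed non-preemptively for $p_j$ time units, (2) each machine executes at most one job at a time, and (3) each job $j$ starts no earlier than $t_j$ and is finished by $d_j$? An instance has slack $\sigma$ if $|d_j-t_j|\le p_j+\sigma$ for all jobs $j\in J$. $\sigma$-Slack Interval-Constrained Scheduling is Interval-Constrained Scheduling restricted to instances of slack $\sigma$. -}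

module Defs where

open import Data.Bool using (if_then_else_)
open import Data.Fin using (Fin)
open import Data.List using (List; []; _∷_; concat; tabulate)
open import Data.Nat using (ℕ; zero; suc; _+_; _*_; _∸_; _≤_; _<_; _≡ᵇ_; ∣_-_∣)
open import Data.Product using (Σ; ∃-syntax; _×_; proj₁)
open import Function using (_∘_; _⇔_)
open import Relation.Binary.PropositionalEquality using (_≡_; _≢_)
open import Relation.Nullary using (¬_)

------------------------------------------------------------------------
-- Model of computation: a uniform-cost random access machine over ℕ with
-- addition, truncated subtraction and indirect addressing (no
-- multiplication), programmed with structured control flow instead of
-- jumps.  A program mentions only finitely many registers; the memory is
-- unbounded.

record State : Set where
  constructor mkState
  field
    reg : ℕ → ℕ
    mem : ℕ → ℕ
open State public

data Expr : Set where
  lit     : ℕ → Expr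
  reg[_]  : ℕ → Expr
  mem[_]  : Expr → Expr
  _⊕_ _⊖_ : Expr → Expr → Expr

data Program : Set where
  skip         : Program
  reg[_]≔_     : ℕ → Expr → Program
  mem[_]≔_     : Expr → Expr → Program
  _⨾_          : Program → Program → Program
  ifNonzero    : Expr → Program → Program → Program
  whileNonzero : Expr → Program → Program

infixl 6 _⊕_ _⊖_
infix  5 reg[_]≔_ mem[_]≔_
infixr 4 _⨾_

⟦_⟧ : Expr → State → ℕ
⟦ lit k ⟧    s = k
⟦ reg[ r ] ⟧ s = reg s r
⟦ mem[ e ] ⟧ s = mem s (⟦ e ⟧ s)
⟦ e ⊕ f ⟧    s = ⟦ e ⟧ s + ⟦ f ⟧ s
⟦ e ⊖ f ⟧    s = ⟦ e ⟧ s ∸ ⟦ f ⟧ s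

cost : Expr → ℕ
cost (lit _)  = 1
cost reg[ _ ] = 1
cost mem[ e ] = suc (cost e)
cost (e ⊕ f)  = suc (cost e + cost f)
cost (e ⊖ f)  = suc (cost e + cost f)

update : (ℕ → ℕ) → ℕ → ℕ → (ℕ → ℕ)
update f a v x = if x ≡ᵇ a then v else f x

-- ⟨ P , s ⟩⇓[ k ] s′ : started in s, program P halts in s′ after k steps.
infix 3 ⟨_,_⟩⇓[_]_

data ⟨_,_⟩⇓[_]_ : Program → State → ℕ → State → Set where

  ⇓-skip : ∀ {s} → ⟨ skip , s ⟩⇓[ 1 ] s

  ⇓-reg : ∀ {r e s} →
    ⟨ reg[ r ]≔ e , s ⟩⇓[ suc (cost e) ]
      mkState (update (reg s) r (⟦ e ⟧ s)) (mem s)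

  ⇓-mem : ∀ {a e s} →
    ⟨ mem[ a ]≔ e , s ⟩⇓[ suc (cost a + cost e) ]
      mkState (reg s) (update (mem s) (⟦ a ⟧ s) (⟦ e ⟧ s))

  ⇓-seq : ∀ {P Q s s′ s″ k l} →
    ⟨ P , s ⟩⇓[ k ] s′ → ⟨ Q , s′ ⟩⇓[ l ] s″ → ⟨ P ⨾ Q , s ⟩⇓[ k + l ] s″

  ⇓-then : ∀ {e P Q s s′ k} → ⟦ e ⟧ s ≢ 0 →
    ⟨ P , s ⟩⇓[ k ] s′ → ⟨ ifNonzero e P Q , s ⟩⇓[ suc (cost e + k) ] s′

  ⇓-else : ∀ {e P Q s s′ k} → ⟦ e ⟧ s ≡ 0 →
    ⟨ Q , s ⟩⇓[ k ] s′ → ⟨ ifNonzero e P Q , s ⟩⇓[ suc (cost e + k) ] s′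

  ⇓-stop : ∀ {e P s} → ⟦ e ⟧ s ≡ 0 →
    ⟨ whileNonzero e P , s ⟩⇓[ suc (cost e) ] s

  ⇓-loop : ∀ {e P s s′ s″ k l} → ⟦ e ⟧ s ≢ 0 →
    ⟨ P , s ⟩⇓[ k ] s′ → ⟨ whileNonzero e P , s′ ⟩⇓[ l ] s″ →
    ⟨ whileNonzero e P , s ⟩⇓[ suc (cost e + k + l) ] s″

------------------------------------------------------------------------

record DecisionProblem : Set₁ where
  field
    Instance : Set
    encode   : Instance → State
    Yes      : Instance → Set
open DecisionProblem public

_restrictedTo_ : (D : DecisionProblem) → (Instance D → Set) → DecisionProblem
D restrictedTo R = record
  { Instance = Σ (Instance D) R
  ; encode   = encode D ∘ proj₁
  ; Yes      = Yes D ∘ proj₁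
  }

-- The answer is read off register 0: nonzero means yes.
_Solves_InTime_ : Program → (D : DecisionProblem) → (Instance D → ℕ) → Set
P Solves D InTime T = (I : Instance D) →
  ∃[ k ] ∃[ s ] ⟨ P , encode D I ⟩⇓[ k ] s × k ≤ T I × (reg s 0 ≢ 0 ⇔ Yes D I)

------------------------------------------------------------------------

record Job : Set where
  field
    release deadline processing : ℕ
open Job public

record JobInstance : Set where
  field
    #jobs     : ℕ
    #machines : ℕ
    job       : Fin #jobs → Job
open JobInstance public

module _ (I : JobInstance) where

  record Schedule : Set where
    field
      machine : Fin (#jobs I) → Fin (#machines I)
      start   : Fin (#jobs I) → ℕ

    completion : Fin (#jobs I) → ℕ
    completion j = start j + processing (job I j)

    -- Job j occupies its machine during the time slot [τ , τ + 1).  In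
    -- particular, a job of processing time 0 never occupies its machine.
    _RunsAt_ : Fin (#jobs I) → ℕ → Set
    j RunsAt τ = start j ≤ τ × τ < completion j

  record Feasible (S : Schedule) : Set where
    open Schedule S
    field
      oneAtATime : ∀ i j τ → i ≢ j → machine i ≡ machine j →
                   ¬ (i RunsAt τ × j RunsAt τ)
      released   : ∀ j → release (job I j) ≤ start j
      inTime     : ∀ j → completion j ≤ deadline (job I j)

  HasSlack : ℕ → Set
  HasSlack σ = ∀ j →
    ∣ deadline (job I j) - release (job I j) ∣ ≤ processing (job I j) + σ

contents : List ℕ → ℕ → ℕ
contents []       _       = 0
contents (x ∷ _)  zero    = x
contents (_ ∷ xs) (suc a) = contents xs a

-- Register 0 holds the number of jobs, register 1 the number of machines,
-- and cells 3j, 3j+1, 3j+2 hold the release time, deadline and processing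
-- time of job j (counting from 0); everything else is 0.
input : JobInstance → State
input I = mkState
  (contents (#jobs I ∷ #machines I ∷ []))
  (contents (concat (tabulate λ j →
    release (job I j) ∷ deadline (job I j) ∷ processing (job I j) ∷ [])))

IntervalConstrainedScheduling : DecisionProblem
IntervalConstrainedScheduling = record
  { Instance = JobInstance
  ; encode   = input
  ; Yes      = λ I → Σ (Schedule I) (Feasible I)
  }

-- The slack σ is not part of the machine's input.
_-SlackIntervalConstrainedScheduling : ℕ → DecisionProblem
σ -SlackIntervalConstrainedScheduling =
  IntervalConstrainedScheduling restrictedTo λ I → HasSlack I σ

-- Asymptotic upper bounds with a constant uniform in the parameter p and in
-- the instance.  Since running times are positive while bounds containing
-- logarithms may vanish, g is read as 1 + g, as usual.
_SolvesAll_InTimeO_ : {A : Set} → Program → (D : A → DecisionProblem) →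
                      (∀ p → Instance (D p) → ℕ) → Set
P SolvesAll D InTimeO g =
  ∃[ c ] ∀ p → P Solves D p InTime (λ I → c * (1 + g p I))

{-# OPTIONS --safe #-}

-- A choice of start times extends to a schedule iff at no time more than m
-- jobs run, so only the offsets of the jobs from their release times matter.
-- Sweep over the events "job j starts (ends) if its offset is o" by time,
-- ends first, keeping for every choice of offsets of the active jobs the
-- largest number of free machines over the offsets of all finished jobs.  In
-- a feasible instance, a job that is active at time τ occupies one of the 2σ+1
-- time slots around τ, so at most (2σ+1)m jobs are active and the table has at
-- most (σ+1)^((2σ+1)m) entries, indexed in base σ+1; the digit owned by a job
-- is reused once the job has finished.
--
-- As σ is not part of the input, the largest slack of a job replaces it.  Only
-- the events of offset 0 are sorted from scratch; the events of offset o are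
-- these shifted by o, so merging σ+1 sorted blocks avoids a second log n.

module Submission where

open import Data.Bool using (Bool; true; false; if_then_else_; _∨_)
open import Data.Bool.Properties using (∨-conicalˡ; ∨-conicalʳ)
open import Data.Empty using (⊥; ⊥-elim)
open import Data.Fin using (Fin; zero; suc; toℕ; fromℕ<)
open import Data.Fin.Patterns
open import Data.Fin.Properties using (toℕ<n; toℕ-injective; toℕ-fromℕ<; ¬Fin0)
open import Data.List using ([]; _∷_; concat; tabulate)
open import Data.Nat
open import Data.Nat.DivMod
open import Data.Nat.Divisibility using (m∣m*n)
open import Data.Nat.Logarithm
open import Data.Nat.Properties hiding (_≟_)
open import Data.Nat.Tactic.RingSolver using (solve-∀)
open import Data.Product using (Σ; ∃-syntax; _×_; _,_; proj₁; proj₂)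
open import Data.Sum using (_⊎_; inj₁; inj₂; [_,_]′)
open import Function using (_∘_; _⇔_; mk⇔; case_of_; module Equivalence)
open import Function.Construct.Composition using (_⇔-∘_)
open import Relation.Binary.PropositionalEquality
open import Relation.Binary.Definitions using (tri<; tri≈; tri>)
open import Relation.Nullary using (¬_; Dec; yes; no; contradiction; _×-dec_; _⊎-dec_; ¬?)
open import Defs

-- A loop language with arrays, compiled to the random access machine

-- Two features of the claim shape the program. First, the factor `σ * m * log (σ * m)` vanishes
-- when `σ * m < 2`, so it cannot pay for the table. With `s` the largest slack, the program spends
-- order `n * suc s * suc s ^ (suc (s + s) * m)` plus `n * log n`; for `σ * m < 2` and `m > 0` the
-- first term is at most `16 * n`, which `1 + n * log n` pays for. Second, the time bound must also
-- hold on infeasible instances, where too many jobs may be active at once. Hence the table never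
-- grows beyond the bound on active jobs: a request for one more digit is itself a proof that the
-- answer is no. Keeping only a maximum over finished jobs loses nothing because each event acts on
-- the number of free machines by a monotone map that depends only on the offset of its job. The
-- machine neither multiplies nor divides, so the digits of a table index come from counters that
-- run along with the scan, and sizes and powers from repeated addition. Programs are written in a
-- loop language whose meaning and cost are total functions; the step relation of the machine occurs
-- only in one simulation.

infixl 6 _⊕_ _⊖_
infixl 8 _!_
infix  5 _≔_ _[_]≔_ _≔input_
infixr 4 _⨾_

data Exp : Set where
  lit     : ℕ → Exp
  var     : ℕ → Exp
  _!_     : Fin 16 → Exp → Exp
  _⊕_ _⊖_ : Exp → Exp → Exp

data Cmd : Set where
  skip      : Cmd
  _≔_       : ℕ → Exp → Cmd
  _[_]≔_     : Fin 16 → Exp → Exp → Cmd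
  _≔input_  : ℕ → Exp → Cmd
  _⨾_       : Cmd → Cmd → Cmd
  ifNonzero : Exp → Cmd → Cmd → Cmd
  repeat    : Exp → Cmd → Cmd

record Store : Set where
  constructor store
  field
    val : ℕ → ℕ
    arr : Fin 16 → ℕ → ℕ
    inp : ℕ → ℕ
open Store public

eval : Exp → Store → ℕ
eval (lit k) h = k
eval (var v) h = val h v
eval (a ! e) h = arr h a (eval e h)
eval (e ⊕ f) h = eval e h + eval f h
eval (e ⊖ f) h = eval e h ∸ eval f h

ifZero : {A : Set} → ℕ → A → A → A
ifZero zero    x y = x
ifZero (suc _) x y = y

iterate : {A : Set} → ℕ → (A → A) → A → A
iterate zero    f x = x
iterate (suc k) f x = iterate k f (f x)

total : {A : Set} → ℕ → (A → A) → (A → ℕ) → A → ℕ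
total zero    f c x = 0
total (suc k) f c x = suc (c x + total k f c (f x))

exec : Cmd → Store → Store
exec skip              h = h
exec (v ≔ e)           h = store (update (val h) v (eval e h)) (arr h) (inp h)
exec (a [ i ]≔ e)       h = store (val h)
  (λ b → if toℕ b ≡ᵇ toℕ a then update (arr h b) (eval i h) (eval e h) else arr h b) (inp h)
exec (v ≔input e)      h = store (update (val h) v (inp h (eval e h))) (arr h) (inp h)
exec (P ⨾ Q)           h = exec Q (exec P h)
exec (ifNonzero e P Q) h = ifZero (eval e h) (exec Q h) (exec P h)
exec (repeat e P)      h = iterate (eval e h) (exec P) h

-- Only commands are counted. The cost of an expression is fixed by the program text and is absorbed
-- into the factor of `simulate`.
time : Cmd → Store → ℕ
time skip              h = 1
time (v ≔ e)           h = 1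
time (a [ i ]≔ e)       h = 1
time (v ≔input e)      h = 1
time (P ⨾ Q)           h = time P h + time Q (exec P h)
time (ifNonzero e P Q) h = suc (ifZero (eval e h) (time Q h) (time P h))
time (repeat e P)      h = suc (total (eval e h) (exec P) (time P) h)

≡ᵇ-refl : ∀ a → (a ≡ᵇ a) ≡ true
≡ᵇ-refl zero    = refl
≡ᵇ-refl (suc a) = ≡ᵇ-refl a

≢⇒≡ᵇ-false : ∀ {a b} → a ≢ b → (a ≡ᵇ b) ≡ false
≢⇒≡ᵇ-false {zero}  {zero}  ne = contradiction refl ne
≢⇒≡ᵇ-false {zero}  {suc b} ne = refl
≢⇒≡ᵇ-false {suc a} {zero}  ne = refl
≢⇒≡ᵇ-false {suc a} {suc b} ne = ≢⇒≡ᵇ-false (ne ∘ cong suc)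

update-same : ∀ (f : ℕ → ℕ) a v {x} → x ≡ a → update f a v x ≡ v
update-same f a v refl rewrite ≡ᵇ-refl a = refl

update-other : ∀ (f : ℕ → ℕ) a v {x} → x ≢ a → update f a v x ≡ f x
update-other f a v ne rewrite ≢⇒≡ᵇ-false ne = refl

-- The machine cannot multiply, so the stride 16 of `cell` is made of four doublings.
double : ℕ → ℕ
double x = x + x

-- Low register 1 holds the size of the input, above which the arrays are
-- interleaved; even registers hold the variables, the remaining odd ones the
-- loop counters, indexed by nesting depth.
cell : ℕ → Fin 16 → ℕ → ℕ
cell base a x = base + toℕ a + double (double (double (double x)))

counter : ℕ → ℕ
counter d = suc (suc (suc (d + d)))

dbl : Expr → Expr
dbl e = e ⊕ e

cellᵉ : Fin 16 → Expr → Expr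
cellᵉ a e = reg[ 1 ] ⊕ lit (toℕ a) ⊕ dbl (dbl (dbl (dbl e)))

compileᵉ : Exp → Expr
compileᵉ (lit k) = lit k
compileᵉ (var v) = reg[ v + v ]
compileᵉ (a ! e) = mem[ cellᵉ a (compileᵉ e) ]
compileᵉ (e ⊕ f) = compileᵉ e ⊕ compileᵉ f
compileᵉ (e ⊖ f) = compileᵉ e ⊖ compileᵉ f

compile : ℕ → Cmd → Program
compile d skip              = skip
compile d (v ≔ e)           = reg[ v + v ]≔ compileᵉ e
compile d (a [ i ]≔ e)       = mem[ cellᵉ a (compileᵉ i) ]≔ compileᵉ e
-- Memory from `reg[ 1 ]` on belongs to the arrays, whereas `inp` is 0 there, so the address is
-- tested before reading.
compile d (v ≔input e)      = ifNonzero (reg[ 1 ] ⊖ compileᵉ e) (reg[ v + v ]≔ mem[ compileᵉ e ])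
                                        (reg[ v + v ]≔ lit 0)
compile d (P ⨾ Q)           = compile d P ⨾ compile d Q
compile d (ifNonzero e P Q) = ifNonzero (compileᵉ e) (compile d P) (compile d Q)
compile d (repeat e P)      =
  reg[ counter d ]≔ compileᵉ e ⨾
  whileNonzero reg[ counter d ] (compile (suc d) P ⨾ reg[ counter d ]≔ reg[ counter d ] ⊖ lit 1)

double≢1+double : ∀ x y → x + x ≢ suc (y + y)
double≢1+double zero    y       ()
double≢1+double (suc x) zero    eq = case trans (sym (+-suc x x)) (suc-injective eq) of λ ()
double≢1+double (suc x) (suc y) eq = double≢1+double x y (suc-injective
  (trans (sym (+-suc x x)) (trans (suc-injective eq) (cong suc (+-suc y y)))))

var≢counter : ∀ v d → v + v ≢ counter d
var≢counter v d eq = double≢1+double v (suc d) (trans eq (cong (2 +_) (sym (+-suc d d))))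

double-injective : ∀ x y → x + x ≡ y + y → x ≡ y
double-injective zero    zero    eq = refl
double-injective (suc x) (suc y) eq = cong suc (double-injective x y (suc-injective
  (trans (sym (+-suc x x)) (trans (suc-injective eq) (+-suc y y)))))

cell-*16 : ∀ base a x → cell base a x ≡ base + (toℕ a + x * 16)
cell-*16 base a x = trans (+-assoc base (toℕ a) _) (cong (λ y → base + (toℕ a + y)) (begin
  double (double (double (double x))) ≡⟨ double≡*2 (double (double (double x))) ⟩
  double (double (double x)) * 2      ≡⟨ cong (_* 2) (double≡*2 (double (double x))) ⟩
  double (double x) * 2 * 2           ≡⟨ cong (λ y → y * 2 * 2) (double≡*2 (double x)) ⟩
  double x * 2 * 2 * 2                ≡⟨ cong (λ y → y * 2 * 2 * 2) (double≡*2 x) ⟩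
  x * 2 * 2 * 2 * 2                   ≡⟨ *16 x ⟩
  x * 16                              ∎))
  where
  open ≡-Reasoning
  double≡*2 : ∀ y → y + y ≡ y * 2
  double≡*2 = solve-∀
  *16 : ∀ y → y * 2 * 2 * 2 * 2 ≡ y * 16
  *16 = solve-∀

cell-injective : ∀ base a x b y → cell base a x ≡ cell base b y → a ≡ b × x ≡ y
cell-injective base a x b y eq = toℕ-injective a≡b , x≡y
  where
  eq′ : toℕ a + x * 16 ≡ toℕ b + y * 16
  eq′ = +-cancelˡ-≡ base _ _ (trans (sym (cell-*16 base a x)) (trans eq (cell-*16 base b y)))
  remainder : ∀ (c : Fin 16) z → (toℕ c + z * 16) % 16 ≡ toℕ c
  remainder c z = trans ([m+kn]%n≡m%n (toℕ c) z 16) (m<n⇒m%n≡m (toℕ<n c))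
  a≡b : toℕ a ≡ toℕ b
  a≡b = trans (sym (remainder a x)) (trans (cong (_% 16) eq′) (remainder b y))
  x≡y : x ≡ y
  x≡y = *-cancelʳ-≡ x y 16 (+-cancelˡ-≡ (toℕ a) _ _ (trans eq′ (cong (_+ y * 16) (sym a≡b))))

record Represents (base : ℕ) (h : Store) (s : State) : Set where
  field
    base≡    : reg s 1 ≡ base
    vars≡    : ∀ v → reg s (v + v) ≡ val h v
    input≡   : ∀ y → y < base → mem s y ≡ inp h y
    input≡0  : ∀ y → base ≤ y → inp h y ≡ 0
    arrays≡  : ∀ a x → mem s (cell base a x) ≡ arr h a x
open Represents public

eval-compileᵉ : ∀ {base h s} → Represents base h s → ∀ e → ⟦ compileᵉ e ⟧ s ≡ eval e h
eval-cellᵉ : ∀ {base h s} → Represents base h s → ∀ a e → ⟦ cellᵉ a (compileᵉ e) ⟧ s ≡ cell base a (eval e h)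
eval-cellᵉ ρ a e rewrite base≡ ρ | eval-compileᵉ ρ e = refl
eval-compileᵉ ρ (lit k) = refl
eval-compileᵉ ρ (var v) = vars≡ ρ v
eval-compileᵉ {s = s} ρ (a ! e) = trans (cong (mem s) (eval-cellᵉ ρ a e)) (arrays≡ ρ a _)
eval-compileᵉ ρ (e ⊕ f) = cong₂ _+_ (eval-compileᵉ ρ e) (eval-compileᵉ ρ f)
eval-compileᵉ ρ (e ⊖ f) = cong₂ _∸_ (eval-compileᵉ ρ e) (eval-compileᵉ ρ f)

represents-assign : ∀ {base h s} → Represents base h s → ∀ v x y → x ≡ y →
  Represents base (store (update (val h) v y) (arr h) (inp h)) (mkState (update (reg s) (v + v) x) (mem s))
represents-assign {base} {h} {s} ρ v x .x refl = record
  { base≡   = trans (update-other (reg s) (v + v) x (λ e → double≢1+double v 0 (sym e))) (base≡ ρ)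
  ; vars≡   = vars
  ; input≡  = input≡ ρ
  ; input≡0 = input≡0 ρ
  ; arrays≡ = arrays≡ ρ }
  where
  vars : ∀ u → update (reg s) (v + v) x (u + u) ≡ update (val h) v x u
  vars u with u ≟ v
  ... | yes refl = trans (update-same (reg s) (v + v) x refl) (sym (update-same (val h) v x refl))
  ... | no u≢v = trans (update-other (reg s) (v + v) x (u≢v ∘ double-injective u v))
                       (trans (vars≡ ρ u) (sym (update-other (val h) v x u≢v)))

represents-store : ∀ {base h s} → Represents base h s → ∀ a i e →
  Represents base (exec (a [ i ]≔ e) h)
    (mkState (reg s) (update (mem s) (⟦ cellᵉ a (compileᵉ i) ⟧ s) (⟦ compileᵉ e ⟧ s)))
represents-store {base} {h} {s} ρ a i e rewrite eval-cellᵉ ρ a i | eval-compileᵉ ρ e = record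
  { base≡   = base≡ ρ
  ; vars≡   = vars≡ ρ
  ; input≡  = λ y y<b → trans (update-other (mem s) c _ (λ eq → <⇒≱ y<b (subst (base ≤_) (sym eq) b≤c))) (input≡ ρ y y<b)
  ; input≡0 = input≡0 ρ
  ; arrays≡ = arrays }
  where
  c = cell base a (eval i h)
  b≤c : base ≤ c
  b≤c = ≤-trans (m≤m+n base (toℕ a)) (m≤m+n (base + toℕ a) _)
  arrays : ∀ b x → update (mem s) c (eval e h) (cell base b x) ≡ arr (exec (a [ i ]≔ e) h) b x
  arrays b x with toℕ b ≟ toℕ a
  ... | no b≢a rewrite ≢⇒≡ᵇ-false b≢a =
        trans (update-other (mem s) c _ (b≢a ∘ cong toℕ ∘ proj₁ ∘ cell-injective base b x a (eval i h))) (arrays≡ ρ b x)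
  ... | yes b≡a rewrite toℕ-injective {i = b} {j = a} b≡a | ≡ᵇ-refl (toℕ a) with x ≟ eval i h
  ...   | yes refl = trans (update-same (mem s) c _ refl) (sym (update-same (arr h a) x _ refl))
  ...   | no x≢i = trans (update-other (mem s) c _ (x≢i ∘ proj₂ ∘ cell-injective base a x a (eval i h)))
                         (trans (arrays≡ ρ a x) (sym (update-other (arr h a) _ _ x≢i)))

counter-injective : ∀ c d → counter c ≡ counter d → c ≡ d
counter-injective c d eq = double-injective c d (suc-injective (suc-injective (suc-injective eq)))

represents-counter : ∀ {base h s} → Represents base h s → ∀ d x →
  Represents base h (mkState (update (reg s) (counter d) x) (mem s))
represents-counter {s = s} ρ d x = record
  { base≡   = base≡ ρ
  ; vars≡   = λ v → trans (update-other (reg s) (counter d) x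
                (var≢counter v d)) (vars≡ ρ v)
  ; input≡  = input≡ ρ
  ; input≡0 = input≡0 ρ
  ; arrays≡ = arrays≡ ρ }

-- The field `counters` protects the counters of the enclosing loops: a body compiled at depth
-- `suc d` leaves `counter d` intact, so the loop can decrement it afterwards.
record Simulates (κ : ℕ) (base d : ℕ) (P : Program) (t : ℕ) (h : Store) (s : State) : Set where
  constructor simulated
  field
    {steps}  : ℕ
    {final}  : State
    run      : ⟨ P , s ⟩⇓[ steps ] final
    steps≤   : steps ≤ κ * t
    repr     : Represents base h final
    counters : ∀ c → c < d → reg final (counter c) ≡ reg s (counter c)

κ+ : ∀ a b t → a * t ≤ (a + b) * t
κ+ a b t = *-monoˡ-≤ t (m≤m+n a b)

κ+′ : ∀ a b t → b * t ≤ (a + b) * t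
κ+′ a b t = *-monoˡ-≤ t (m≤n+m b a)

-- The factor is chosen before the store and the depth: one unit of `time` pays for the expressions
-- of one construct, and these are finitely many and fixed by `P`.
simulate : ∀ P → ∃[ κ ] ∀ base d h s → Represents base h s →
  Simulates κ base d (compile d P) (time P h) (exec P h) s
simulate skip = 1 , λ base d h s ρ → simulated ⇓-skip ≤-refl ρ λ _ _ → refl
simulate (v ≔ e) = suc (cost (compileᵉ e)) , λ base d h s ρ →
  simulated ⇓-reg (≤-reflexive (sym (*-identityʳ _))) (represents-assign ρ v _ _ (eval-compileᵉ ρ e))
    λ c _ → update-other (reg s) (v + v) _ (var≢counter v c ∘ sym)
simulate (a [ i ]≔ e) = suc (cost (cellᵉ a (compileᵉ i)) + cost (compileᵉ e)) , λ base d h s ρ →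
  simulated ⇓-mem (≤-reflexive (sym (*-identityʳ _))) (represents-store ρ a i e) λ _ _ → refl
simulate (v ≔input e) = κ , λ base d h s ρ → go base d h s ρ
  where
  κ₁ κ₂ κ : ℕ
  κ₁ = suc (cost (reg[ 1 ] ⊖ compileᵉ e) + suc (cost (mem[ compileᵉ e ])))
  κ₂ = suc (cost (reg[ 1 ] ⊖ compileᵉ e) + 2)
  κ = κ₁ + κ₂
  go : ∀ base d h s → Represents base h s → Simulates κ base d (compile d (v ≔input e)) 1 (exec (v ≔input e) h) s
  go base d h s ρ with eval e h <? base
  ... | yes e<b = simulated (⇓-then cond ⇓-reg) (≤-trans (≤-reflexive (sym (*-identityʳ _))) (κ+ κ₁ κ₂ 1))
          (represents-assign ρ v _ _ (trans (cong (mem s) (eval-compileᵉ ρ e)) (input≡ ρ _ e<b)))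
          λ c _ → update-other (reg s) (v + v) _ (var≢counter v c ∘ sym)
    where
    cond : reg s 1 ∸ ⟦ compileᵉ e ⟧ s ≢ 0
    cond eq rewrite base≡ ρ | eval-compileᵉ ρ e = <⇒≱ e<b (m∸n≡0⇒m≤n eq)
  ... | no e≮b = simulated (⇓-else cond ⇓-reg) (≤-trans (≤-reflexive (sym (*-identityʳ _))) (κ+′ κ₁ κ₂ 1))
          (represents-assign ρ v _ _ (sym (input≡0 ρ _ (≮⇒≥ e≮b))))
          λ c _ → update-other (reg s) (v + v) _ (var≢counter v c ∘ sym)
    where
    cond : reg s 1 ∸ ⟦ compileᵉ e ⟧ s ≡ 0
    cond rewrite base≡ ρ | eval-compileᵉ ρ e = m≤n⇒m∸n≡0 (≮⇒≥ e≮b)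
simulate (P ⨾ Q) with simulate P | simulate Q
... | κ₁ , simP | κ₂ , simQ = κ₁ + κ₂ , λ base d h s ρ →
  let simulated run₁ le₁ ρ₁ cs₁ = simP base d h s ρ
      simulated run₂ le₂ ρ₂ cs₂ = simQ base d _ _ ρ₁
  in simulated (⇓-seq run₁ run₂)
       (≤-trans (+-mono-≤ (≤-trans le₁ (κ+ κ₁ κ₂ _)) (≤-trans le₂ (κ+′ κ₁ κ₂ _)))
                (≤-reflexive (sym (*-distribˡ-+ (κ₁ + κ₂) (time P h) _))))
       ρ₂ λ c c<d → trans (cs₂ c c<d) (cs₁ c c<d)
simulate (ifNonzero e P Q) with simulate P | simulate Q
... | κ₁ , simP | κ₂ , simQ = κ , go
  where
  κ : ℕ
  κ = suc (cost (compileᵉ e)) + (κ₁ + κ₂)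
  bound : ∀ {k} t → k ≤ (κ₁ + κ₂) * t → suc (cost (compileᵉ e) + k) ≤ κ * suc t
  bound {k} t k≤ = begin
    suc (cost (compileᵉ e)) + k                    ≤⟨ +-mono-≤ (m≤m+n _ (κ₁ + κ₂)) (≤-trans k≤ (κ+′ (suc (cost (compileᵉ e))) _ t)) ⟩
    κ + κ * t                                      ≡⟨ *-suc κ t ⟨
    κ * suc t                                      ∎
    where open ≤-Reasoning
  go : ∀ base d h s → Represents base h s →
    Simulates κ base d (compile d (ifNonzero e P Q)) (time (ifNonzero e P Q) h) (exec (ifNonzero e P Q) h) s
  go base d h s ρ with eval e h in eq
  ... | zero = let simulated r le ρ′ cs = simQ base d h s ρ in
        simulated (⇓-else (trans (eval-compileᵉ ρ e) eq) r) (bound _ (≤-trans le (κ+′ κ₁ κ₂ _))) ρ′ cs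
  ... | suc _ = let simulated r le ρ′ cs = simP base d h s ρ in
        simulated (⇓-then (λ z → case trans (sym eq) (trans (sym (eval-compileᵉ ρ e)) z) of λ ()) r)
          (bound _ (≤-trans le (κ+ κ₁ κ₂ _))) ρ′ cs
simulate (repeat e P) with simulate P
... | κ₁ , simP = κ , go
  where
  κ : ℕ
  -- The 6 is the overhead of one round: 2 for the test and 4 for decrementing the counter.
  κ = suc (cost (compileᵉ e) + 2) + (κ₁ + 6)
  loop : ∀ k base d h s → Represents base h s → reg s (counter d) ≡ k →
    Simulates (κ₁ + 6) base d
      (whileNonzero reg[ counter d ] (compile (suc d) P ⨾ reg[ counter d ]≔ reg[ counter d ] ⊖ lit 1))
      (suc (total k (exec P) (time P) h)) (iterate k (exec P) h) s
  loop zero base d h s ρ eq = simulated (⇓-stop eq)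
    (≤-trans (≤-trans (s≤s (s≤s z≤n)) (m≤n+m 6 κ₁)) (≤-reflexive (sym (*-identityʳ _)))) ρ λ _ _ → refl
  loop (suc k) base d h s ρ eq =
    let simulated {k₁} {s₁} r le ρ₁ cs₁ = simP base (suc d) h s ρ
        s₂ = mkState (update (reg s₁) (counter d) (reg s₁ (counter d) ∸ 1)) (mem s₁)
        simulated {k₂} r′ le′ ρ′ cs′ = loop k base d (exec P h) s₂ (represents-counter ρ₁ d _)
          (trans (update-same (reg s₁) (counter d) _ refl) (cong (_∸ 1) (trans (cs₁ d ≤-refl) eq)))
    in simulated (⇓-loop (λ z → case trans (sym eq) z of λ ()) (⇓-seq r ⇓-reg) r′)
         (bound k₁ k₂ (time P h) _ le le′) ρ′
         λ c c<d → trans (cs′ c c<d) (trans (update-other (reg s₁) (counter d) _ (<⇒≢ c<d ∘ counter-injective c d))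
                                            (cs₁ c (m<n⇒m<1+n c<d)))
    where
    bound : ∀ k₁ k₂ t u → k₁ ≤ κ₁ * t → k₂ ≤ (κ₁ + 6) * suc u →
      suc (1 + (k₁ + 4) + k₂) ≤ (κ₁ + 6) * suc (suc (t + u))
    bound k₁ k₂ t u le le′ = begin
      suc (1 + (k₁ + 4) + k₂)                       ≤⟨ s≤s (+-mono-≤ (s≤s (+-monoˡ-≤ 4 (≤-trans le (κ+ κ₁ 6 t)))) le′) ⟩
      suc (1 + (κ₂ * t + 4) + κ₂ * suc u)           ≡⟨ lemma κ₂ t u ⟩
      6 + κ₂ * (suc (t + u))                        ≤⟨ +-monoˡ-≤ (κ₂ * suc (t + u)) (m≤n+m 6 κ₁) ⟩
      κ₂ + κ₂ * suc (t + u)                         ≡⟨ *-suc κ₂ (suc (t + u)) ⟨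
      κ₂ * suc (suc (t + u))                        ∎
      where
      open ≤-Reasoning
      κ₂ = κ₁ + 6
      lemma : ∀ a t u → suc (1 + (a * t + 4) + a * suc u) ≡ 6 + a * suc (t + u)
      lemma = solve-∀
  go : ∀ base d h s → Represents base h s →
    Simulates κ base d (compile d (repeat e P)) (time (repeat e P) h) (exec (repeat e P) h) s
  go base d h s ρ =
    let x = ⟦ compileᵉ e ⟧ s
        s₁ = mkState (update (reg s) (counter d) x) (mem s)
        simulated r le ρ′ cs = loop (eval e h) base d h s₁ (represents-counter ρ d x)
          (trans (update-same (reg s) (counter d) x refl) (eval-compileᵉ ρ e))
    in simulated (⇓-seq ⇓-reg r) (bound _ _ le) ρ′
         λ c c<d → trans (cs c c<d) (update-other (reg s) (counter d) x (<⇒≢ c<d ∘ counter-injective c d))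
    where
    bound : ∀ k u → k ≤ (κ₁ + 6) * suc u → suc (cost (compileᵉ e)) + k ≤ κ * suc u
    bound k u k≤ = begin
      suc (cost (compileᵉ e)) + k                     ≤⟨ +-mono-≤ (s≤s (m≤m+n _ 2)) k≤ ⟩
      c + (κ₁ + 6) * suc u                            ≤⟨ +-monoˡ-≤ _ (m≤m*n c (suc u)) ⟩
      c * suc u + (κ₁ + 6) * suc u                    ≡⟨ *-distribʳ-+ (suc u) c (κ₁ + 6) ⟨
      κ * suc u                                       ∎
      where
      open ≤-Reasoning
      c = suc (cost (compileᵉ e) + 2)

-- Effects and running times of commands

-- Boolean, so that for a concrete command the frame condition `assigned P v ≡ false` holds by
-- `refl`.
assigned : Cmd → ℕ → Bool
assigned (v ≔ e)           u = u ≡ᵇ v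
assigned (v ≔input e)      u = u ≡ᵇ v
assigned (P ⨾ Q)           u = assigned P u ∨ assigned Q u
assigned (ifNonzero e P Q) u = assigned P u ∨ assigned Q u
assigned (repeat e P)      u = assigned P u
assigned skip              u = false
assigned (a [ i ]≔ e)      u = false

written : Cmd → Fin 16 → Bool
written (a [ i ]≔ e)      b = toℕ b ≡ᵇ toℕ a
written (P ⨾ Q)           b = written P b ∨ written Q b
written (ifNonzero e P Q) b = written P b ∨ written Q b
written (repeat e P)      b = written P b
written skip              b = false
written (v ≔ e)           b = false
written (v ≔input e)      b = false

record Agree (P : Cmd) (h h′ : Store) : Set where
  constructor agreement
  field
    val≡ : ∀ v → assigned P v ≡ false → val h′ v ≡ val h v
    arr≡ : ∀ a → written P a ≡ false → ∀ x → arr h′ a x ≡ arr h a x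
    inp≡ : inp h′ ≡ inp h
open Agree public

agree-trans : ∀ {P h h′ h″} → Agree P h h′ → Agree P h′ h″ → Agree P h h″
agree-trans (agreement v a i) (agreement v′ a′ i′) = agreement
  (λ u f → trans (v′ u f) (v u f)) (λ b f x → trans (a′ b f x) (a b f x)) (trans i′ i)

agree : ∀ P h → Agree P h (exec P h)
agree skip h = agreement (λ _ _ → refl) (λ _ _ _ → refl) refl
agree (v ≔ e) h = agreement (λ u f → cong (λ b → if b then eval e h else val h u) f) (λ _ _ _ → refl) refl
agree (v ≔input e) h = agreement (λ u f → cong (λ b → if b then inp h (eval e h) else val h u) f) (λ _ _ _ → refl) refl
agree (a [ i ]≔ e) h = agreement (λ _ _ → refl)
  (λ b f x → cong (λ c → (if c then update (arr h b) (eval i h) (eval e h) else arr h b) x) f) refl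
agree (P ⨾ Q) h with agree P h | agree Q (exec P h)
... | agreement v a i | agreement v′ a′ i′ = agreement
  (λ u f → trans (v′ u (∨-conicalʳ _ _ f)) (v u (∨-conicalˡ _ _ f)))
  (λ b f x → trans (a′ b (∨-conicalʳ (written P b) _ f) x) (a b (∨-conicalˡ _ _ f) x)) (trans i′ i)
agree (ifNonzero e P Q) h with eval e h
... | zero  = let agreement v a i = agree Q h in
  agreement (λ u f → v u (∨-conicalʳ (assigned P u) _ f)) (λ b f → a b (∨-conicalʳ (written P b) _ f)) i
... | suc _ = let agreement v a i = agree P h in
  agreement (λ u f → v u (∨-conicalˡ _ _ f)) (λ b f → a b (∨-conicalˡ _ _ f)) i
agree (repeat e P) h = go (eval e h) h
  where
  go : ∀ k h → Agree (repeat e P) h (iterate k (exec P) h)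
  go zero    h = agreement (λ _ _ → refl) (λ _ _ _ → refl) refl
  go (suc k) h = let agreement v a i = agree P h in agree-trans (agreement v a i) (go k (exec P h))

record Runs (P : Cmd) (k : ℕ) (Q : Store → Set) (h : Store) : Set where
  constructor _▹_
  field
    time≤ : time P h ≤ k
    post  : Q (exec P h)
open Runs public

infix 2 _▹_

-- The continuation also receives `Agree P h h′`, so `Mid` need only mention what `P` changes.
runs-⨾ : ∀ {P Q k l h Mid Post} → Runs P k Mid h → (∀ h′ → Agree P h h′ → Mid h′ → Runs Q l Post h′) →
  Runs (P ⨾ Q) (k + l) Post h
runs-⨾ {P} {h = h} (t ▹ mid) next = let t′ ▹ post = next (exec P h) (agree P h) mid in +-mono-≤ t t′ ▹ post

-- For straight-line code the store after `P` is known by computation, and no intermediate condition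
-- is required.
runs-exec : ∀ {P Q k l h Post} → time P h ≤ k → Runs Q l Post (exec P h) → Runs (P ⨾ Q) (k + l) Post h
runs-exec t (t′ ▹ post) = +-mono-≤ t t′ ▹ post

runs-if : ∀ {e P Q k h Post} → (eval e h ≢ 0 → Runs P k Post h) → (eval e h ≡ 0 → Runs Q k Post h) →
  Runs (ifNonzero e P Q) (suc k) Post h
runs-if {e} {P} {Q} {k} {h} {Post} then′ else′ = go (eval e h) refl
  where
  go : ∀ v → eval e h ≡ v → Runs (ifNonzero e P Q) (suc k) Post h
  go zero    eq = let t ▹ post = else′ eq in
    subst (λ v → suc (ifZero v (time Q h) (time P h)) ≤ suc k) (sym eq) (s≤s t) ▹
    subst (λ v → Post (ifZero v (exec Q h) (exec P h))) (sym eq) post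
  go (suc v) eq = let t ▹ post = then′ (λ z → case trans (sym eq) z of λ ()) in
    subst (λ v → suc (ifZero v (time Q h) (time P h)) ≤ suc k) (sym eq) (s≤s t) ▹
    subst (λ v → Post (ifZero v (exec Q h) (exec P h))) (sym eq) post

runs-map : ∀ {P k l h} {Q Q′ : Store → Set} → k ≤ l → (∀ h′ → Agree P h h′ → Q h′ → Q′ h′) → Runs P k Q h → Runs P l Q′ h
runs-map {P} {h = h} k≤l f (t ▹ q) = ≤-trans t k≤l ▹ f (exec P h) (agree P h) q

-- Each round knows that its store agrees with the one at loop entry, which keeps unchanged
-- variables out of `Inv`.
runs-repeat : ∀ (Inv : ℕ → Store → Set) {e P h n k} → eval e h ≡ n → Inv 0 h →
  (∀ i h′ → i < n → Agree P h h′ → Inv i h′ → Runs P k (Inv (suc i)) h′) →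
  Runs (repeat e P) (suc (n * suc k)) (Inv n) h
runs-repeat Inv {P = P} {h} {n} {k} refl inv₀ step =
  let t , inv = go n 0 h (+-identityʳ n) (agreement (λ _ _ → refl) (λ _ _ _ → refl) refl) inv₀ in s≤s t ▹ inv
  where
  go : ∀ r i h′ → r + i ≡ n → Agree P h h′ → Inv i h′ →
    total r (exec P) (time P) h′ ≤ r * suc k × Inv n (iterate r (exec P) h′)
  go zero    i h′ refl ag inv = z≤n , inv
  go (suc r) i h′ eq   ag inv =
    let t ▹ inv′ = step i h′ (subst (i <_) eq (s≤s (m≤n+m i r))) ag inv
        t′ , post = go r (suc i) (exec P h′) (trans (+-suc r i) eq) (agree-trans ag (agree P h′)) inv′
    in s≤s (+-mono-≤ t t′) , post

-- Finite sums and indicators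

∑ : ℕ → (ℕ → ℕ) → ℕ
∑ zero    f = 0
∑ (suc n) f = ∑ n f + f n

∑-cong : ∀ n {f g} → (∀ i → i < n → f i ≡ g i) → ∑ n f ≡ ∑ n g
∑-cong zero    eq = refl
∑-cong (suc n) eq = cong₂ _+_ (∑-cong n λ i i<n → eq i (m<n⇒m<1+n i<n)) (eq n ≤-refl)

∑-mono : ∀ n {f g} → (∀ i → i < n → f i ≤ g i) → ∑ n f ≤ ∑ n g
∑-mono zero    le = z≤n
∑-mono (suc n) le = +-mono-≤ (∑-mono n λ i i<n → le i (m<n⇒m<1+n i<n)) (le n ≤-refl)

∑-zero : ∀ n → ∑ n (λ _ → 0) ≡ 0
∑-zero zero    = refl
∑-zero (suc n) = trans (+-identityʳ _) (∑-zero n)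

∑-const : ∀ n c → ∑ n (λ _ → c) ≡ n * c
∑-const zero    c = refl
∑-const (suc n) c = trans (cong (_+ c) (∑-const n c)) (+-comm (n * c) c)

+-right-comm : ∀ a b c → a + b + c ≡ a + c + b
+-right-comm = solve-∀

+-interchange : ∀ a b c d → a + b + (c + d) ≡ a + c + (b + d)
+-interchange = solve-∀

∑-+ : ∀ n f g → ∑ n (λ i → f i + g i) ≡ ∑ n f + ∑ n g
∑-+ zero    f g = refl
∑-+ (suc n) f g = trans (cong (_+ (f n + g n)) (∑-+ n f g)) (+-interchange (∑ n f) (∑ n g) (f n) (g n))

∑-swap : ∀ m n (f : ℕ → ℕ → ℕ) → ∑ m (λ i → ∑ n (f i)) ≡ ∑ n (λ j → ∑ m (λ i → f i j))
∑-swap zero    n f = sym (∑-zero n)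
∑-swap (suc m) n f = trans (cong (_+ ∑ n (f m)) (∑-swap m n f)) (sym (∑-+ n _ _))

∑-* : ∀ n c f → ∑ n (λ i → c * f i) ≡ c * ∑ n f
∑-* zero    c f = sym (*-zeroʳ c)
∑-* (suc n) c f = trans (cong (_+ c * f n) (∑-* n c f)) (sym (*-distribˡ-+ c (∑ n f) (f n)))

∑-append : ∀ m n f → ∑ (m + n) f ≡ ∑ m f + ∑ n (λ i → f (m + i))
∑-append m zero    f rewrite +-identityʳ m | +-identityʳ (∑ m f) = refl
∑-append m (suc n) f rewrite +-suc m n = trans (cong (_+ f (m + n)) (∑-append m n f)) (+-assoc (∑ m f) _ _)

∑-prefix : ∀ {m n} → m ≤ n → ∀ f → ∑ m f ≤ ∑ n f
∑-prefix {m} {n} m≤n f = subst (λ k → ∑ m f ≤ ∑ k f) (m+[n∸m]≡n m≤n)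
  (≤-trans (m≤m+n (∑ m f) _) (≤-reflexive (sym (∑-append m (n ∸ m) f))))

∑-truncate : ∀ {m n} → m ≤ n → ∀ f → (∀ i → m ≤ i → i < n → f i ≡ 0) → ∑ n f ≡ ∑ m f
∑-truncate {m} {n} m≤n f z = begin
  ∑ n f                                        ≡⟨ cong (λ k → ∑ k f) (m+[n∸m]≡n m≤n) ⟨
  ∑ (m + (n ∸ m)) f                            ≡⟨ ∑-append m (n ∸ m) f ⟩
  ∑ m f + ∑ (n ∸ m) (λ i → f (m + i))          ≡⟨ cong (∑ m f +_) (∑-cong (n ∸ m) λ i i< → z (m + i) (m≤m+n m i)
                                                    (subst (m + i <_) (m+[n∸m]≡n m≤n) (+-monoʳ-< m i<))) ⟩
  ∑ m f + ∑ (n ∸ m) (λ _ → 0)                  ≡⟨ cong (∑ m f +_) (∑-zero (n ∸ m)) ⟩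
  ∑ m f + 0                                    ≡⟨ +-identityʳ _ ⟩
  ∑ m f                                        ∎
  where open ≡-Reasoning

∑-term : ∀ {n i} f → i < n → f i ≤ ∑ n f
∑-term {i = i} f i<n = ≤-trans (m≤n+m (f i) (∑ i f)) (∑-prefix i<n f)

∑-two-terms : ∀ {n i j} f → i < j → j < n → f i + f j ≤ ∑ n f
∑-two-terms {j = j} f i<j j<n = ≤-trans (+-monoˡ-≤ (f j) (∑-term f i<j)) (∑-prefix j<n f)

∑≡0 : ∀ {n i} f → ∑ n f ≡ 0 → i < n → f i ≡ 0
∑≡0 f eq i<n = n≤0⇒n≡0 (≤-trans (∑-term f i<n) (≤-reflexive eq))

∑-change : ∀ {n i} f g → i < n → (∀ j → j ≢ i → f j ≡ g j) → ∑ n f + g i ≡ ∑ n g + f i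
∑-change {suc n} {i} f g i<n same with i ≟ n
... | yes refl = begin
  ∑ n f + f n + g n   ≡⟨ cong (λ s → s + f n + g n) (∑-cong n λ j j<n → same j (<⇒≢ j<n)) ⟩
  ∑ n g + f n + g n   ≡⟨ +-assoc (∑ n g) _ _ ⟩
  ∑ n g + (f n + g n) ≡⟨ cong (∑ n g +_) (+-comm (f n) (g n)) ⟩
  ∑ n g + (g n + f n) ≡⟨ +-assoc (∑ n g) _ _ ⟨
  ∑ n g + g n + f n   ∎
  where open ≡-Reasoning
... | no i≢n = begin
  ∑ n f + f n + g i   ≡⟨ +-right-comm (∑ n f) (f n) (g i) ⟩
  ∑ n f + g i + f n   ≡⟨ cong₂ _+_ (∑-change f g (≤∧≢⇒< (≤-pred i<n) i≢n) same) (same n (i≢n ∘ sym)) ⟩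
  ∑ n g + f i + g n   ≡⟨ +-right-comm (∑ n g) (f i) (g n) ⟩
  ∑ n g + g n + f i   ∎
  where
  open ≡-Reasoning

ind : {P : Set} → Dec P → ℕ
ind (yes _) = 1
ind (no _)  = 0

ind-yes : {P : Set} (d : Dec P) → P → ind d ≡ 1
ind-yes (yes _) p = refl
ind-yes (no ¬p) p = contradiction p ¬p

ind-no : {P : Set} (d : Dec P) → ¬ P → ind d ≡ 0
ind-no (yes p) ¬p = contradiction p ¬p
ind-no (no _)  ¬p = refl

ind≤1 : {P : Set} (d : Dec P) → ind d ≤ 1
ind≤1 (yes _) = ≤-refl
ind≤1 (no _)  = z≤n

ind⁻¹ : {P : Set} (d : Dec P) → ind d ≢ 0 → P
ind⁻¹ (yes p) ne = p
ind⁻¹ (no _)  ne = contradiction refl ne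

ind≡0 : {P : Set} (d : Dec P) → ind d ≡ 0 → ¬ P
ind≡0 (no ¬p) _ = ¬p

ind-mono : {P Q : Set} (d : Dec P) (e : Dec Q) → (P → Q) → ind d ≤ ind e
ind-mono (yes p) e f = ≤-reflexive (sym (ind-yes e (f p)))
ind-mono (no _)  e f = z≤n

ind-cong : {P Q : Set} (d : Dec P) (e : Dec Q) → (P → Q) → (Q → P) → ind d ≡ ind e
ind-cong d e f g = ≤-antisym (ind-mono d e f) (ind-mono e d g)

ind-× : {P Q : Set} (d : Dec P) (e : Dec Q) → ind (d ×-dec e) ≡ ind d * ind e
ind-× (yes p) (yes q) = refl
ind-× (yes p) (no ¬q) = refl
ind-× (no ¬p) e = refl

ind-*-no : {P Q : Set} (d : Dec P) (e : Dec Q) → ¬ (P × Q) → ind d * ind e ≡ 0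
ind-*-no d e ¬pq = trans (sym (ind-× d e)) (ind-no (d ×-dec e) ¬pq)

ind-*-yes : {P Q : Set} (d : Dec P) (e : Dec Q) → P → Q → ind d * ind e ≡ 1
ind-*-yes d e p q = trans (sym (ind-× d e)) (ind-yes (d ×-dec e) (p , q))

ind-*-zero : {P : Set} (d : Dec P) {x : ℕ} → (P → x ≡ 0) → ind d * x ≡ 0
ind-*-zero (yes p) f = trans (+-identityʳ _) (f p)
ind-*-zero (no _)  f = refl

∑-pick : ∀ {n k} (f : ℕ → ℕ) → k < n → ∑ n (λ i → ind (k ≟ i) * f i) ≡ f k
∑-pick {n} {k} f k<n = begin
  ∑ n (λ i → ind (k ≟ i) * f i)         ≡⟨ ∑-truncate k<n _ (λ i k<i _ → cong (_* f i) (ind-no (k ≟ i) (<⇒≢ k<i))) ⟩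
  ∑ k (λ i → ind (k ≟ i) * f i) + ind (k ≟ k) * f k
                                        ≡⟨ cong₂ _+_ (∑-cong k λ i i<k → cong (_* f i) (ind-no (k ≟ i) (<⇒≢ i<k ∘ sym)))
                                                     (trans (cong (_* f k) (ind-yes (k ≟ k) refl)) (*-identityˡ (f k))) ⟩
  ∑ k (λ _ → 0) + f k                   ≡⟨ cong (_+ f k) (∑-zero k) ⟩
  f k                                   ∎
  where open ≡-Reasoning

∑-ind≤1 : ∀ n {P : ℕ → Set} (d : ∀ i → Dec (P i)) → (∀ i j → i < n → j < n → P i → P j → i ≡ j) → ∑ n (ind ∘ d) ≤ 1
∑-ind≤1 zero d unique = z≤n
∑-ind≤1 (suc n) d unique with d n
... | no _ = ≤-trans (≤-reflexive (+-identityʳ _)) (∑-ind≤1 n d λ i j i<n j<n → unique i j (m<n⇒m<1+n i<n) (m<n⇒m<1+n j<n))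
... | yes p = ≤-reflexive (cong (_+ 1) (trans (∑-cong n λ i i<n → ind-no (d i) λ q →
                <⇒≢ i<n (unique i n (m<n⇒m<1+n i<n) ≤-refl q p)) (∑-zero n)))

search : ∀ n {P : ℕ → Set} (d : ∀ i → Dec (P i)) → (∃[ i ] i < n × P i) ⊎ (∀ i → i < n → ¬ P i)
search zero d = inj₂ λ _ ()
search (suc n) d with d n | search n d
... | yes p | _ = inj₁ (n , ≤-refl , p)
... | no _  | inj₁ (i , i<n , p) = inj₁ (i , m<n⇒m<1+n i<n , p)
... | no ¬p | inj₂ none = inj₂ λ i i<1+n → case m≤n⇒m<n∨m≡n (≤-pred i<1+n) of λ
  { (inj₁ i<n) → none i i<n ; (inj₂ refl) → ¬p }

-- Interval colouring and placements

record Intervals : Set where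
  field
    count : ℕ
    opening closing : ℕ → ℕ
open Intervals public

module _ (V : Intervals) where

  Covers : ℕ → ℕ → Set
  Covers j τ = opening V j ≤ τ × τ < closing V j

  covers? : ∀ j τ → Dec (Covers j τ)
  covers? j τ = (opening V j ≤? τ) ×-dec (τ <? closing V j)

  load : ℕ → ℕ
  load τ = ∑ (count V) λ j → ind (covers? j τ)

  record Coloring (m : ℕ) : Set where
    field
      color    : ℕ → ℕ
      color<   : ∀ j → j < count V → color j < m
      disjoint : ∀ i j τ → i < count V → j < count V → i ≢ j → color i ≡ color j → ¬ (Covers i τ × Covers j τ)

  -- Double counting by colour: at time `τ` each of the `m` colours occurs on at most one covering
  -- interval.
  coloring⇒load≤ : ∀ {m} → Coloring m → ∀ τ → load τ ≤ m
  coloring⇒load≤ {m} C τ = begin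
    load τ                                                              ≡⟨ ∑-cong (count V) (λ j j<n → sym (∑-pick (λ _ → ind (covers? j τ)) (color< j j<n))) ⟩
    ∑ (count V) (λ j → ∑ m λ k → ind (color j ≟ k) * ind (covers? j τ)) ≡⟨ ∑-swap (count V) m _ ⟩
    ∑ m (λ k → ∑ (count V) λ j → ind (color j ≟ k) * ind (covers? j τ)) ≡⟨ ∑-cong m (λ k _ → ∑-cong (count V) λ j _ → sym (ind-× (color j ≟ k) (covers? j τ))) ⟩
    ∑ m (λ k → ∑ (count V) λ j → ind ((color j ≟ k) ×-dec covers? j τ)) ≤⟨ ∑-mono m (λ k _ → ∑-ind≤1 (count V) (λ j → (color j ≟ k) ×-dec covers? j τ) (unique k)) ⟩
    ∑ m (λ _ → 1)                                                       ≡⟨ trans (∑-const m 1) (*-identityʳ m) ⟩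
    m                                                                   ∎
    where
    open Coloring C
    open ≤-Reasoning
    unique : ∀ k i j → i < count V → j < count V → color i ≡ k × Covers i τ → color j ≡ k × Covers j τ → i ≡ j
    unique k i j i<n j<n (ci , ri) (cj , rj) with i ≟ j
    ... | yes i≡j = i≡j
    ... | no i≢j = contradiction (ri , rj) (disjoint i j τ i<n j<n i≢j (trans ci (sym cj)))

  -- Intervals are coloured in the order of (opening , index).
  Earlier : ℕ → ℕ → ℕ → Set
  Earlier T i j = opening V j < T ⊎ (opening V j ≡ T × j < i)

  earlier? : ∀ T i j → Dec (Earlier T i j)
  earlier? T i j = (opening V j <? T) ⊎-dec ((opening V j ≟ T) ×-dec (j <? i))

  record Partial (m T i : ℕ) : Set where
    field
      color    : ℕ → ℕ
      color<   : ∀ j → j < count V → color j < m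
      disjoint : ∀ a b τ → a < count V → b < count V → Earlier T i a → Earlier T i b → a ≢ b → color a ≡ color b →
                 ¬ (Covers a τ × Covers b τ)

  module _ {m} (m>0 : 0 < m) (bounded : ∀ τ → load τ ≤ m) where

    -- Greedy colouring. An empty interval conflicts with nothing and keeps its colour. Otherwise
    -- the earlier intervals that cover `T`, together with `i` itself, number at most `load T ≤ m`,
    -- so a colour is left for `i`.
    extend-partial : ∀ {T i} → i < count V → Partial m T i → Partial m T (suc i)
    extend-partial {T} {i} i<n S with opening V i ≟ T
    ... | no b≢T = record { color = color ; color< = color< ; disjoint = λ a b τ a<n b<n ea eb → disjoint a b τ a<n b<n (shrink a ea) (shrink b eb) }
      where
      open Partial S
      shrink : ∀ a → Earlier T (suc i) a → Earlier T i a
      shrink a (inj₁ l) = inj₁ l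
      shrink a (inj₂ (e , l)) with m≤n⇒m<n∨m≡n (≤-pred l)
      ... | inj₁ l′ = inj₂ (e , l′)
      ... | inj₂ refl = contradiction e b≢T
    ... | yes refl with T <? closing V i
    ...   | no empty = record { color = color ; color< = color< ; disjoint = dis }
      where
      open Partial S
      shrink : ∀ a τ → Covers a τ → Earlier T (suc i) a → Earlier T i a
      shrink a τ ra (inj₁ l) = inj₁ l
      shrink a τ ra (inj₂ (e , l)) with m≤n⇒m<n∨m≡n (≤-pred l)
      ... | inj₁ l′ = inj₂ (e , l′)
      ... | inj₂ refl = contradiction (≤-<-trans (proj₁ ra) (proj₂ ra)) empty
      dis : ∀ a b τ → a < count V → b < count V → Earlier T (suc i) a → Earlier T (suc i) b → a ≢ b → color a ≡ color b →
            ¬ (Covers a τ × Covers b τ)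
      dis a b τ a<n b<n ea eb a≢b c (ra , rb) = disjoint a b τ a<n b<n (shrink a τ ra ea) (shrink b τ rb eb) a≢b c (ra , rb)
    ...   | yes T<end = record { color = color′ ; color< = color′< ; disjoint = dis }
      where
      open Partial S
      busy? : ∀ a → Dec (Earlier T i a × Covers a T)
      busy? a = earlier? T i a ×-dec covers? a T
      uses? : ∀ k → ∀ a → Dec (color a ≡ k × (Earlier T i a × Covers a T))
      uses? k a = (color a ≟ k) ×-dec busy? a
      users : ℕ → ℕ
      users k = ∑ (count V) λ a → ind (uses? k a)
      i-free : ¬ Earlier T i i
      i-free (inj₁ l) = <-irrefl refl l
      i-free (inj₂ (_ , l)) = <-irrefl refl l
      total< : ∑ m users < m
      total< = begin-strict
        ∑ m users                                                         ≡⟨ ∑-swap m (count V) _ ⟩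
        ∑ (count V) (λ a → ∑ m λ k → ind (uses? k a))                     ≡⟨ ∑-cong (count V) (λ a a<n → trans (∑-cong m λ k _ → ind-× (color a ≟ k) (busy? a))
                                                                                (∑-pick (λ _ → ind (busy? a)) (color< a a<n))) ⟩
        ∑ (count V) (λ a → ind (busy? a))                                 <⟨ m<m+n _ (s≤s z≤n) ⟩
        ∑ (count V) (λ a → ind (busy? a)) + 1                             ≡⟨ cong (∑ (count V) (ind ∘ busy?) +_) (∑-pick {count V} (λ _ → 1) i<n) ⟨
        ∑ (count V) (λ a → ind (busy? a)) + ∑ (count V) (λ a → ind (i ≟ a) * 1) ≡⟨ ∑-+ (count V) _ _ ⟨
        ∑ (count V) (λ a → ind (busy? a) + ind (i ≟ a) * 1)               ≤⟨ ∑-mono (count V) (λ a _ → both a) ⟩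
        load T                                                            ≤⟨ bounded T ⟩
        m                                                                 ∎
        where
        open ≤-Reasoning
        both : ∀ a → ind (busy? a) + ind (i ≟ a) * 1 ≤ ind (covers? a T)
        both a with i ≟ a
        ... | no _ = ≤-trans (≤-reflexive (+-identityʳ _)) (ind-mono (busy? a) (covers? a T) proj₂)
        ... | yes refl = ≤-trans (+-monoˡ-≤ 1 (≤-reflexive (ind-no (busy? i) (i-free ∘ proj₁))))
                                 (≤-reflexive (sym (ind-yes (covers? i T) (≤-refl , T<end))))
      -- Pigeonhole: if every colour had a user, the users would number at least `m`.
      free : ∃[ k ] k < m × users k ≡ 0
      free with search m (λ k → users k ≟ 0)
      ... | inj₁ found = found
      ... | inj₂ none = contradiction total< (≤⇒≯ (subst (_≤ ∑ m users) (trans (∑-const m 1) (*-identityʳ m))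
                          (∑-mono m λ k k<m → n≢0⇒n>0 (none k k<m))))
      κ = proj₁ free
      color′ : ℕ → ℕ
      color′ = update color i κ
      color′< : ∀ j → j < count V → color′ j < m
      color′< j j<n with j ≟ i
      ... | yes j≡i = subst (_< m) (sym (update-same color i κ j≡i)) (proj₁ (proj₂ free))
      ... | no j≢i = subst (_< m) (sym (update-other color i κ j≢i)) (color< j j<n)
      shrink : ∀ a → a ≢ i → Earlier T (suc i) a → Earlier T i a
      shrink a a≢i (inj₁ l) = inj₁ l
      shrink a a≢i (inj₂ (e , l)) = inj₂ (e , ≤∧≢⇒< (≤-pred l) a≢i)
      old≤ : ∀ a → Earlier T i a → opening V a ≤ T
      old≤ a (inj₁ l) = <⇒≤ l
      old≤ a (inj₂ (e , _)) = ≤-reflexive e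
      -- An earlier interval that meets `i` at some `τ ≥ T` already covers `T`, so its colour had a
      -- user and cannot be `κ`.
      new : ∀ a τ → a < count V → Earlier T i a → color a ≡ κ → ¬ (Covers a τ × Covers i τ)
      new a τ a<n ea c ((_ , τ<) , (T≤ , _)) = ind≡0 (uses? κ a) (∑≡0 (ind ∘ uses? κ) (proj₂ (proj₂ free)) a<n)
        (c , ea , old≤ a ea , ≤-<-trans T≤ τ<)
      dis : ∀ a b τ → a < count V → b < count V → Earlier T (suc i) a → Earlier T (suc i) b → a ≢ b → color′ a ≡ color′ b →
            ¬ (Covers a τ × Covers b τ)
      dis a b τ a<n b<n ea eb a≢b c (ra , rb) with a ≟ i | b ≟ i
      ... | yes refl | yes refl = a≢b refl
      ... | yes refl | no b≢i = new b τ b<n (shrink b b≢i eb)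
              (trans (sym (update-other color i κ b≢i)) (trans (sym c) (update-same color i κ refl))) (rb , ra)
      ... | no a≢i | yes refl = new a τ a<n (shrink a a≢i ea)
              (trans (sym (update-other color i κ a≢i)) (trans c (update-same color i κ refl))) (ra , rb)
      ... | no a≢i | no b≢i = disjoint a b τ a<n b<n (shrink a a≢i ea) (shrink b b≢i eb) a≢b
              (trans (sym (update-other color i κ a≢i)) (trans c (update-other color i κ b≢i))) (ra , rb)

    partial : ∀ T i → i ≤ count V → Partial m T i
    partial T (suc i) i<n = extend-partial i<n (partial T i (<⇒≤ i<n))
    partial zero zero _ = record { color = λ _ → 0 ; color< = λ _ _ → m>0 ; disjoint = λ { a b τ _ _ (inj₁ ()) ; a b τ _ _ (inj₂ (_ , ())) } }
    partial (suc T) zero _ = record { color = color ; color< = color< ; disjoint = λ a b τ a<n b<n ea eb →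
        disjoint a b τ a<n b<n (shrink a a<n ea) (shrink b b<n eb) }
      where
      open Partial (partial T (count V) ≤-refl)
      shrink : ∀ a → a < count V → Earlier (suc T) 0 a → Earlier T (count V) a
      shrink a a<n (inj₁ l) with m≤n⇒m<n∨m≡n (≤-pred l)
      ... | inj₁ l′ = inj₁ l′
      ... | inj₂ e = inj₂ (e , a<n)

    load≤⇒coloring : Coloring m
    load≤⇒coloring = record { color = color ; color< = color< ; disjoint = λ i j τ i<n j<n →
        disjoint i j τ i<n j<n (inj₁ (s≤s (∑-term (opening V) i<n))) (inj₁ (s≤s (∑-term (opening V) j<n))) }
      -- The sum of all openings bounds each of them, so every interval is earlier than this `T`.
      where open Partial (partial (suc (∑ (count V) (opening V))) 0 z≤n)

  -- The intervals begun by `τ` are those still running and those already closed; the sum form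
  -- avoids truncated subtraction. The weight drops empty intervals, as the event list has no events
  -- for jobs of processing time 0.
  load-starts : ∀ τ →
    load τ + ∑ (count V) (λ j → ind (opening V j <? closing V j) * ind (closing V j ≤? τ)) ≡
    ∑ (count V) (λ j → ind (opening V j <? closing V j) * ind (opening V j ≤? τ))
  load-starts τ = trans (sym (∑-+ (count V) _ _)) (∑-cong (count V) λ j _ → point j)
    where
    point : ∀ j → ind (covers? j τ) + ind (opening V j <? closing V j) * ind (closing V j ≤? τ) ≡
                  ind (opening V j <? closing V j) * ind (opening V j ≤? τ)
    point j with opening V j <? closing V j
    ... | no b≮e = trans (+-identityʳ _) (ind-no (covers? j τ) λ r → b≮e (≤-<-trans (proj₁ r) (proj₂ r)))
    ... | yes b<e rewrite +-identityʳ (ind (closing V j ≤? τ)) | +-identityʳ (ind (opening V j ≤? τ)) with closing V j ≤? τ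
    ...   | yes e≤τ = trans (cong (_+ 1) (ind-no (covers? j τ) (λ r → <⇒≱ (proj₂ r) e≤τ)))
                            (sym (ind-yes (opening V j ≤? τ) (≤-trans (<⇒≤ b<e) e≤τ)))
    ...   | no e≰τ = trans (+-identityʳ _) (ind-cong (covers? j τ) (opening V j ≤? τ) proj₁ (λ b≤τ → b≤τ , ≰⇒> e≰τ))

-- Schedules as placements of bounded load

record Jobs : Set where
  field
    number      : ℕ
    rel dead proc : ℕ → ℕ

  slack : ℕ → ℕ
  slack j = dead j ∸ (rel j + proc j)

  placed : (ℕ → ℕ) → Intervals
  placed α = record { count = number ; opening = λ j → rel j + α j ; closing = λ j → rel j + α j + proc j }

  Placement : ℕ → (ℕ → ℕ) → Set
  Placement m α = (∀ j → j < number → α j ≤ slack j) × (∀ τ → load (placed α) τ ≤ m)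

  -- `slack` is truncated at 0, so a job longer than its window would pass for a job of slack 0;
  -- this excludes it.
  Roomy : Set
  Roomy = ∀ j → j < number → rel j + proc j ≤ dead j
open Jobs public

module _ (I : JobInstance) (X : Jobs) (n≡ : number X ≡ #jobs I)
         (rel≡ : ∀ j → rel X (toℕ j) ≡ release (job I j)) (dead≡ : ∀ j → dead X (toℕ j) ≡ deadline (job I j))
         (proc≡ : ∀ j → proc X (toℕ j) ≡ processing (job I j)) where

  private
    onFin : ∀ {P : ℕ → Set} → (∀ (j : Fin (#jobs I)) → P (toℕ j)) → ∀ j → j < number X → P j
    onFin {P} f j j<n = subst P (toℕ-fromℕ< (subst (j <_) n≡ j<n)) (f (fromℕ< (subst (j <_) n≡ j<n)))

    bound : ∀ (j : Fin (#jobs I)) → toℕ j < number X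
    bound j = subst (toℕ j <_) (sym n≡) (toℕ<n j)

    extendℕ : (Fin (#jobs I) → ℕ) → ℕ → ℕ
    extendℕ f j with j <? #jobs I
    ... | yes j<n = f (fromℕ< j<n)
    ... | no _    = 0

    extendℕ-toℕ : ∀ f j → extendℕ f (toℕ j) ≡ f j
    extendℕ-toℕ f j with toℕ j <? #jobs I
    ... | yes j<n = cong f (toℕ-injective (toℕ-fromℕ< j<n))
    ... | no j≮n  = contradiction (toℕ<n j) j≮n

  schedule⇒placement : (S : Schedule I) → Feasible I S → Roomy X × ∃[ α ] Placement X (#machines I) α
  schedule⇒placement S F = onFin roomy , α , onFin fits , coloring⇒load≤ (placed X α) coloring
    where
    open Schedule S
    open Feasible F
    α : ℕ → ℕ
    α = extendℕ λ j → start j ∸ release (job I j)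
    start≡ : ∀ j → rel X (toℕ j) + α (toℕ j) ≡ start j
    start≡ j rewrite rel≡ j | extendℕ-toℕ (λ j → start j ∸ release (job I j)) j = m+[n∸m]≡n (released j)
    roomy : ∀ j → rel X (toℕ j) + proc X (toℕ j) ≤ dead X (toℕ j)
    roomy j rewrite rel≡ j | dead≡ j | proc≡ j = ≤-trans (+-monoˡ-≤ _ (released j)) (inTime j)
    fits : ∀ j → α (toℕ j) ≤ slack X (toℕ j)
    fits j = m+n≤o⇒m≤o∸n (α (toℕ j)) (≤-trans (≤-reflexive (trans (lemma (α (toℕ j)) (rel X (toℕ j)) _)
      (cong₂ _+_ (start≡ j) (proc≡ j)))) (≤-trans (inTime j) (≤-reflexive (sym (dead≡ j)))))
      where
      lemma : ∀ a r p → a + (r + p) ≡ r + a + p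
      lemma = solve-∀
    coloring : Coloring (placed X α) (#machines I)
    coloring = record
      { color    = extendℕ (toℕ ∘ machine)
      ; color<   = onFin λ j → subst (_< #machines I) (sym (extendℕ-toℕ (toℕ ∘ machine) j)) (toℕ<n (machine j))
      ; disjoint = λ i j τ i<n j<n → onFin {λ i → ∀ j → j < number X → i ≢ j → _ → ¬ (Covers (placed X α) i τ × Covers (placed X α) j τ)}
          (λ i → onFin (dis i τ)) i i<n j j<n }
      where
      runs : ∀ j τ → Covers (placed X α) (toℕ j) τ → Schedule._RunsAt_ S j τ
      runs j τ c rewrite start≡ j | proc≡ j = c
      dis : ∀ i τ j → toℕ i ≢ toℕ j → extendℕ (toℕ ∘ machine) (toℕ i) ≡ extendℕ (toℕ ∘ machine) (toℕ j) →
            ¬ (Covers (placed X α) (toℕ i) τ × Covers (placed X α) (toℕ j) τ)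
      dis i τ j i≢j c (ri , rj) = oneAtATime i j τ (i≢j ∘ cong toℕ)
        (toℕ-injective (trans (sym (extendℕ-toℕ (toℕ ∘ machine) i)) (trans c (extendℕ-toℕ (toℕ ∘ machine) j))))
        (runs i τ ri , runs j τ rj)

  placement⇒schedule : 0 < #machines I → Roomy X → ∀ {α} → Placement X (#machines I) α → Σ (Schedule I) (Feasible I)
  placement⇒schedule m>0 roomy {α} (fits , bounded) = S , record
      { oneAtATime = λ i j τ i≢j c (ri , rj) → disjoint (toℕ i) (toℕ j) τ (bound i) (bound j) (i≢j ∘ toℕ-injective)
          (trans (sym (toℕ-fromℕ< _)) (trans (cong toℕ c) (toℕ-fromℕ< _))) (covers i τ ri , covers j τ rj)
      ; released   = λ j → ≤-trans (≤-reflexive (sym (rel≡ j))) (m≤m+n _ _)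
      ; inTime     = inTime }
    where
    open Coloring (load≤⇒coloring (placed X α) m>0 bounded)
    S : Schedule I
    S = record { machine = λ j → fromℕ< (color< (toℕ j) (bound j)) ; start = λ j → rel X (toℕ j) + α (toℕ j) }
    covers : ∀ j τ → Schedule._RunsAt_ S j τ → Covers (placed X α) (toℕ j) τ
    covers j τ r rewrite proc≡ j = r
    inTime : ∀ j → rel X (toℕ j) + α (toℕ j) + processing (job I j) ≤ deadline (job I j)
    inTime j rewrite sym (proc≡ j) | sym (dead≡ j) = begin
      r + a + p           ≡⟨ lemma r a p ⟩
      a + (r + p)         ≤⟨ +-monoˡ-≤ (r + p) (fits (toℕ j) (bound j)) ⟩
      slack X (toℕ j) + (r + p) ≡⟨ m∸n+n≡m (roomy (toℕ j) (bound j)) ⟩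
      dead X (toℕ j)      ∎
      where
      open ≤-Reasoning
      r = rel X (toℕ j)
      a = α (toℕ j)
      p = proc X (toℕ j)
      lemma : ∀ r a p → r + a + p ≡ a + (r + p)
      lemma = solve-∀

-- Sweeping over the events

record Event : Set where
  constructor event
  field
    key jobOf off kind : ℕ
open Event public

-- Keys are doubled times, with starts odd, so that at equal times ends precede starts.
startOf endOf : Jobs → ℕ → ℕ → Event
startOf X j o = event (suc (rel X j + o + (rel X j + o))) j o 1
endOf   X j o = event (rel X j + proc X j + o + (rel X j + proc X j + o)) j o 0

-- `complete` says that `ev` rearranges the set of all events: equal sums for every test function
-- `g` mean equal multisets. In this form the property passes through merging and copying without
-- any permutation, and each choice of `g` extracts one fact.
record EventList (X : Jobs) (σ N : ℕ) (ev : ℕ → Event) : Set where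
  field
    complete : ∀ g → ∑ N (g ∘ ev) ≡
      ∑ (suc σ) λ o → ∑ (number X) λ j → ind (0 <? proc X j) * (g (startOf X j o) + g (endOf X j o))
    sorted   : ∀ i → suc i < N → key (ev i) ≤ key (ev (suc i))

when : {P A : Set} → Dec P → A → A → A
when (yes _) x y = x
when (no _)  x y = y

hit? : ∀ (α : ℕ → ℕ) e → Dec (α (jobOf e) ≡ off e)
hit? α e = α (jobOf e) ≟ off e

startHit endHit : (ℕ → ℕ) → Event → ℕ
startHit α e = ind (kind e ≟ 1) * ind (hit? α e)
endHit   α e = ind (kind e ≟ 0) * ind (hit? α e)

-- Values are shifted by one, so a start with no free machine takes 1 to the failure value 0.
-- Failure is absorbing: an end keeps 0 and `0 ∸ 1` is 0.
react : Jobs → Event → ℕ → ℕ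
react X e c = ifZero (kind e) (ifZero c c (suc c)) (ifZero (off e ∸ slack X (jobOf e)) (c ∸ 1) 0)

-- One plus the number of free machines after the first i events under the
-- offsets α, or 0 once the machines were overloaded or a deadline was missed.
free : Jobs → ℕ → (ℕ → Event) → (ℕ → ℕ) → ℕ → ℕ
free X m ev α zero    = suc m
free X m ev α (suc i) = when (hit? α (ev i)) (react X (ev i) (free X m ev α i)) (free X m ev α i)

+-cancel-double-≤ : ∀ a b → a + a ≤ suc (b + b) → a ≤ b
+-cancel-double-≤ a b le with a ≤? b
... | yes a≤b = a≤b
... | no a≰b = contradiction (≤-trans (≤-trans (s≤s (≤-reflexive (sym (+-suc b b)))) (+-mono-≤ (≰⇒> a≰b) (≰⇒> a≰b))) le) (<⇒≱ ≤-refl)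

module _ {X : Jobs} {σ N : ℕ} {ev : ℕ → Event} (L : EventList X σ N ev) where
  open EventList L

  private
    n : ℕ
    n = number X
    w : ℕ → ℕ
    w j = ind (0 <? proc X j)

  key-mono : ∀ {i l} → i ≤ l → l < N → key (ev i) ≤ key (ev l)
  key-mono {i} {l} i≤l l<N with m≤n⇒m<n∨m≡n i≤l
  ... | inj₂ refl = ≤-refl
  key-mono {i} {suc l} i≤l l<N | inj₁ i<l = ≤-trans (key-mono (≤-pred i<l) (<-trans ≤-refl l<N)) (sorted l l<N)

  key-reflects : ∀ {i l} → l < N → key (ev l) < key (ev i) → l < i
  key-reflects {i} {l} l<N k< with l <? i
  ... | yes l<i = l<i
  ... | no l≮i = contradiction (key-mono (≮⇒≥ l≮i) l<N) (<⇒≱ k<)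

  record Valid (e : Event) : Set where
    constructor valid
    field
      job<    : jobOf e < n
      off<    : off e < suc σ
      long    : 0 < proc X (jobOf e)
      origin  : (kind e ≡ 1 × key e ≡ key (startOf X (jobOf e) (off e))) ⊎
                (kind e ≡ 0 × key e ≡ key (endOf X (jobOf e) (off e)))

  valid? : ∀ e → Dec (Valid e)
  valid? e with (jobOf e <? n) ×-dec ((off e <? suc σ) ×-dec ((0 <? proc X (jobOf e)) ×-dec
    (((kind e ≟ 1) ×-dec (key e ≟ key (startOf X (jobOf e) (off e)))) ⊎-dec
     ((kind e ≟ 0) ×-dec (key e ≟ key (endOf X (jobOf e) (off e)))))))
  ... | yes (a , b , c , d) = yes (valid a b c d)
  ... | no ¬v = no λ (valid a b c d) → ¬v (a , b , c , d)

  -- Apply `complete` to the indicator of invalid events. The generated side vanishes term by term,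
  -- so the sum over the list is 0 and every term of it too.
  all-valid : ∀ i → i < N → Valid (ev i)
  all-valid i i<N with valid? (ev i)
  ... | yes v = v
  ... | no ¬v = contradiction ¬v (ind≡0 (¬? (valid? (ev i))) (∑≡0 (λ l → ind (¬? (valid? (ev l)))) none i<N))
    where
    start-valid : ∀ {j o} → j < n → o < suc σ → 0 < proc X j → ind (¬? (valid? (startOf X j o))) ≡ 0
    start-valid {j} {o} j<n o≤ p = ind-no (¬? (valid? (startOf X j o))) λ ¬v → ¬v (valid j<n o≤ p (inj₁ (refl , refl)))
    end-valid : ∀ {j o} → j < n → o < suc σ → 0 < proc X j → ind (¬? (valid? (endOf X j o))) ≡ 0
    end-valid {j} {o} j<n o≤ p = ind-no (¬? (valid? (endOf X j o))) λ ¬v → ¬v (valid j<n o≤ p (inj₂ (refl , refl)))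
    term : ∀ j o → j < n → o < suc σ → w j * (ind (¬? (valid? (startOf X j o))) + ind (¬? (valid? (endOf X j o)))) ≡ 0
    term j o j<n o≤ = ind-*-zero (0 <? proc X j) λ p → cong₂ _+_ (start-valid j<n o≤ p) (end-valid j<n o≤ p)
    none : ∑ N (λ l → ind (¬? (valid? (ev l)))) ≡ 0
    none = trans (complete (λ e → ind (¬? (valid? e))))
      (trans (∑-cong (suc σ) λ o o≤ → trans (∑-cong n λ j j<n → term j o j<n o≤) (∑-zero n)) (∑-zero (suc σ)))

  mark : ℕ → ℕ → ℕ → Event → ℕ
  mark j o k e = ind (o ≟ off e) * (ind (j ≟ jobOf e) * ind (k ≟ kind e))

  mark-hit : ∀ {j o k e} → jobOf e ≡ j → off e ≡ o → kind e ≡ k → mark j o k e ≡ 1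
  mark-hit {e = e} refl refl refl rewrite ind-yes (off e ≟ off e) refl | ind-yes (jobOf e ≟ jobOf e) refl
    | ind-yes (kind e ≟ kind e) refl = refl

  -- `complete` at the indicator of a single event, where the double sum collapses to one term. That
  -- the sum is not 0 gives `occurs`; that it is below 2 gives `occurs-once`.
  ∑-mark : ∀ {j o} k → k < 2 → j < n → o < suc σ → 0 < proc X j → ∑ N (mark j o k ∘ ev) ≡ 1
  ∑-mark {j} {o} k k<2 j<n o≤ p = begin
    ∑ N (mark j o k ∘ ev)   ≡⟨ complete (mark j o k) ⟩
    _                       ≡⟨ ∑-cong (suc σ) (λ o′ _ → ∑-cong n λ j′ _ → lemma (w j′) (ind (o ≟ o′)) (ind (j ≟ j′)) (ind (k ≟ 1)) (ind (k ≟ 0))) ⟩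
    ∑ (suc σ) (λ o′ → ∑ n λ j′ → ind (o ≟ o′) * (ind (j ≟ j′) * (w j′ * (ind (k ≟ 1) + ind (k ≟ 0)))))
                            ≡⟨ ∑-cong (suc σ) (λ o′ _ → trans (∑-* n (ind (o ≟ o′)) _) (cong (ind (o ≟ o′) *_) (∑-pick _ j<n))) ⟩
    ∑ (suc σ) (λ o′ → ind (o ≟ o′) * (w j * (ind (k ≟ 1) + ind (k ≟ 0))))
                            ≡⟨ ∑-pick (λ _ → w j * (ind (k ≟ 1) + ind (k ≟ 0))) o≤ ⟩
    w j * (ind (k ≟ 1) + ind (k ≟ 0)) ≡⟨ cong₂ _*_ (ind-yes (0 <? proc X j) p) (two k k<2) ⟩
    1                       ∎
    where
    open ≡-Reasoning
    two : ∀ k → k < 2 → ind (k ≟ 1) + ind (k ≟ 0) ≡ 1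
    two 0 _ = refl
    two 1 _ = refl
    two (suc (suc k)) (s≤s (s≤s ()))
    lemma : ∀ w a b c d → w * (a * (b * c) + a * (b * d)) ≡ a * (b * (w * (c + d)))
    lemma = solve-∀

  occurs : ∀ {j o} k → k < 2 → j < n → o < suc σ → 0 < proc X j →
    ∃[ i ] i < N × jobOf (ev i) ≡ j × off (ev i) ≡ o × kind (ev i) ≡ k
  occurs {j} {o} k k<2 j<n o≤ p with search N (λ i → (jobOf (ev i) ≟ j) ×-dec ((off (ev i) ≟ o) ×-dec (kind (ev i) ≟ k)))
  ... | inj₁ found = found
  ... | inj₂ none = contradiction (trans (sym (∑-mark k k<2 j<n o≤ p)) (trans (∑-cong N unmarked) (∑-zero N))) λ ()
    where
    unmarked : ∀ i → i < N → mark j o k (ev i) ≡ 0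
    unmarked i i<N with o ≟ off (ev i) | j ≟ jobOf (ev i) | k ≟ kind (ev i)
    ... | no _  | _ | _ = refl
    ... | yes _ | no _ | _ = refl
    ... | yes _ | yes _ | no _ = refl
    ... | yes a | yes b | yes c = contradiction (sym b , sym a , sym c) (none i i<N)

  private
    twice : ∀ {i l} → i < l → l < N → jobOf (ev i) ≡ jobOf (ev l) → off (ev i) ≡ off (ev l) → kind (ev i) ≡ kind (ev l) → ⊥
    twice {i} {l} i<l l<N a b c with all-valid l l<N
    ... | valid j< o< p origin = <⇒≱ (≤-trans
        (≤-reflexive (sym (cong₂ _+_ (mark-hit {e = ev i} a b c) (mark-hit {e = ev l} refl refl refl))))
        (∑-two-terms (mark (jobOf (ev l)) (off (ev l)) (kind (ev l)) ∘ ev) i<l l<N))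
        (≤-reflexive (∑-mark (kind (ev l)) k<2 j< o< p))
      where
      k<2 : kind (ev l) < 2
      k<2 = [ (λ (e , _) → subst (_< 2) (sym e) (s≤s (s≤s z≤n))) , (λ (e , _) → subst (_< 2) (sym e) (s≤s z≤n)) ]′ origin

  occurs-once : ∀ {i l} → i < N → l < N → jobOf (ev i) ≡ jobOf (ev l) → off (ev i) ≡ off (ev l) → kind (ev i) ≡ kind (ev l) → i ≡ l
  occurs-once {i} {l} i<N l<N a b c with <-cmp i l
  ... | tri≈ _ e _ = e
  ... | tri< i<l _ _ = ⊥-elim (twice i<l l<N a b c)
  ... | tri> _ _ l<i = ⊥-elim (twice l<i i<N (sym a) (sym b) (sym c))

  started ended : (ℕ → ℕ) → ℕ → ℕ
  started α i = ∑ i λ l → startHit α (ev l)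
  ended   α i = ∑ i λ l → endHit α (ev l)

  -- The counterparts by time of the counts `started` and `ended` by position in the list. A start
  -- at time `τ` has key `suc (τ + τ)` and an end at time `τ` has key `τ + τ`.
  started≤ ended≤ : (ℕ → ℕ) → ℕ → ℕ
  started≤ α τ = ∑ n λ j → w j * ind (rel X j + α j ≤? τ)
  ended≤   α τ = ∑ n λ j → w j * ind (rel X j + α j + proc X j ≤? τ)

  module _ {α : ℕ → ℕ} (α≤σ : ∀ j → j < n → α j ≤ σ) where

    private
      pick : ∀ (f : ℕ → ℕ → ℕ) → ∑ (suc σ) (λ o → ∑ n λ j → w j * (ind (α j ≟ o) * f j o)) ≡ ∑ n (λ j → w j * f j (α j))
      pick f = trans (∑-swap (suc σ) n _) (∑-cong n λ j j<n →
        trans (∑-* (suc σ) (w j) _) (cong (w j *_) (∑-pick (f j) (s≤s (α≤σ j j<n)))))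

    ∑-started : ∀ τ → ∑ N (λ l → startHit α (ev l) * ind (key (ev l) ≤? suc (τ + τ))) ≡ started≤ α τ
    ∑-started τ = trans (complete (λ e → startHit α e * ind (key e ≤? suc (τ + τ))))
      (trans (∑-cong (suc σ) λ o _ → ∑-cong n λ j _ → cong (w j *_)
        (trans (lemma (ind (α j ≟ o)) _) (cong (ind (α j ≟ o) *_) (ind-cong (key (startOf X j o) ≤? suc (τ + τ)) (rel X j + o ≤? τ)
           (λ le → +-cancel-double-≤ _ _ (m≤n⇒m≤1+n (≤-pred le))) (λ le → s≤s (+-mono-≤ le le))))))
       (pick λ j o → ind (rel X j + o ≤? τ)))
      where
      lemma : ∀ a b → 1 * a * b + 0 ≡ a * b
      lemma = solve-∀

    -- End keys are even, so both thresholds select the same ends. The lower one serves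
    -- `ended-lower`; the upper one, shared with `∑-started`, serves `free≢0⇒placement`.
    ∑-ended : ∀ τ κ → τ + τ ≤ κ → κ ≤ suc (τ + τ) →
      ∑ N (λ l → endHit α (ev l) * ind (key (ev l) ≤? κ)) ≡ ended≤ α τ
    ∑-ended τ κ lo hi = trans (complete (λ e → endHit α e * ind (key e ≤? κ)))
      (trans (∑-cong (suc σ) λ o _ → ∑-cong n λ j _ → cong (w j *_)
        (trans (lemma (ind (α j ≟ o)) _) (cong (ind (α j ≟ o) *_) (ind-cong (key (endOf X j o) ≤? κ) (rel X j + o + proc X j ≤? τ)
           (λ le → subst (_≤ τ) (+-right-comm (rel X j) (proc X j) o) (+-cancel-double-≤ _ _ (≤-trans le hi)))
           (λ le → ≤-trans (let le′ = subst (_≤ τ) (sym (+-right-comm (rel X j) (proc X j) o)) le in +-mono-≤ le′ le′) lo)))))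
       (pick λ j o → ind (rel X j + o + proc X j ≤? τ)))
      where
      lemma : ∀ a b → 1 * a * b ≡ a * b
      lemma = solve-∀

    started-upper : ∀ {i τ} → i < N → key (ev i) ≡ suc (τ + τ) → started α (suc i) ≤ started≤ α τ
    started-upper {i} {τ} i<N k = begin
      started α (suc i)  ≡⟨ ∑-cong (suc i) (λ l l≤i → trans (sym (*-identityʳ _)) (cong (startHit α (ev l) *_)
                              (sym (ind-yes (key (ev l) ≤? suc (τ + τ)) (≤-trans (key-mono (≤-pred l≤i) i<N) (≤-reflexive k)))))) ⟩
      ∑ (suc i) _        ≤⟨ ∑-prefix i<N _ ⟩
      ∑ N _              ≡⟨ ∑-started τ ⟩
      started≤ α τ       ∎
      where open ≤-Reasoning

    -- From position `i` on all keys are at least `suc (τ + τ)`, so an end at time at most `τ`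
    -- stands before `i`. This is where ends must precede starts at equal times.
    ended-lower : ∀ {i τ} → i < N → key (ev i) ≡ suc (τ + τ) → ended≤ α τ ≤ ended α i
    ended-lower {i} {τ} i<N k = begin
      ended≤ α τ         ≡⟨ ∑-ended τ (τ + τ) ≤-refl (n≤1+n _) ⟨
      ∑ N _              ≡⟨ ∑-truncate (<⇒≤ i<N) _ (λ l i≤l l<N → trans (cong (endHit α (ev l) *_)
                              (ind-no (key (ev l) ≤? τ + τ) (<⇒≱ (≤-trans (≤-reflexive (sym k)) (key-mono i≤l l<N))))) (*-zeroʳ (endHit α (ev l)))) ⟩
      ∑ i _              ≤⟨ ∑-mono i (λ l _ → ≤-trans (*-monoʳ-≤ (endHit α (ev l)) (ind≤1 (key (ev l) ≤? τ + τ))) (≤-reflexive (*-identityʳ _))) ⟩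
      ended α i          ∎
      where open ≤-Reasoning

  private
    kind-cases : ∀ {i} → i < N → kind (ev i) ≡ 1 ⊎ kind (ev i) ≡ 0
    kind-cases i<N with Valid.origin (all-valid _ i<N)
    ... | inj₁ (k , _) = inj₁ k
    ... | inj₂ (k , _) = inj₂ k

    react-start : ∀ e c → kind e ≡ 1 → react X e c ≢ 0 → off e ≤ slack X (jobOf e) × c ≡ suc (react X e c)
    react-start (event k j o .1) c refl ne with o ∸ slack X j in eq | c
    ... | zero  | zero  = contradiction refl ne
    ... | zero  | suc c = m∸n≡0⇒m≤n eq , refl
    ... | suc _ | _     = contradiction refl ne

    react-start⁻¹ : ∀ e c → kind e ≡ 1 → off e ≤ slack X (jobOf e) → react X e c ≡ c ∸ 1
    react-start⁻¹ (event k j o .1) c refl le rewrite m≤n⇒m∸n≡0 le = refl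

    react-end : ∀ e c → kind e ≡ 0 → react X e c ≢ 0 → c ≢ 0 × react X e c ≡ suc c
    react-end (event k j o .0) zero    refl ne = contradiction refl ne
    react-end (event k j o .0) (suc c) refl ne = (λ ()) , refl

    react-end⁻¹ : ∀ e c → kind e ≡ 0 → c ≢ 0 → react X e c ≢ 0
    react-end⁻¹ (event k j o .0) zero    refl ne = ne
    react-end⁻¹ (event k j o .0) (suc c) refl ne = λ ()

  load-balance : ∀ α τ → load (placed X α) τ + ended≤ α τ ≡ started≤ α τ
  load-balance α τ = trans (cong (load (placed X α) τ +_) (∑-cong n λ j _ → cong (_* ind (rel X j + α j + proc X j ≤? τ)) (weight j)))
    (trans (load-starts (placed X α) τ) (∑-cong n λ j _ → cong (_* ind (rel X j + α j ≤? τ)) (sym (weight j))))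
    where
    weight : ∀ j → w j ≡ ind (rel X j + α j <? rel X j + α j + proc X j)
    weight j = ind-cong (0 <? proc X j) (rel X j + α j <? rel X j + α j + proc X j)
      (λ p → m<m+n _ p) (λ lt → +-cancelˡ-< (rel X j + α j) 0 (proc X j) (subst (_< rel X j + α j + proc X j) (sym (+-identityʳ _)) lt))

  module _ (m : ℕ) where

    free-nonzero : ∀ {α i} → i < N → free X m ev α (suc i) ≢ 0 → free X m ev α i ≢ 0
    free-nonzero {α} {i} i<N ne z with hit? α (ev i)
    ... | no _ = ne z
    ... | yes _ with kind-cases i<N
    ...   | inj₁ k = case trans (sym z) (proj₂ (react-start (ev i) (free X m ev α i) k ne)) of λ ()
    ...   | inj₂ k = proj₁ (react-end (ev i) (free X m ev α i) k ne) z

    free-nonzero-prefix : ∀ {α i} → i ≤ N → free X m ev α N ≢ 0 → free X m ev α i ≢ 0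
    free-nonzero-prefix {α} {i} i≤N = subst (λ k → free X m ev α k ≢ 0 → free X m ev α i ≢ 0) (m+[n∸m]≡n i≤N)
      (go (N ∸ i) (≤-reflexive (m+[n∸m]≡n i≤N)))
      where
      go : ∀ d → i + d ≤ N → free X m ev α (i + d) ≢ 0 → free X m ev α i ≢ 0
      go zero le ne rewrite +-identityʳ i = ne
      go (suc d) le ne rewrite +-suc i d = go d (<⇒≤ le) (free-nonzero le ne)

    -- Conservation of machines: while nothing has failed, each start that is hit takes one and each
    -- end that is hit returns one.
    balance : ∀ {α} i → i ≤ N → free X m ev α i ≢ 0 → free X m ev α i + started α i ≡ suc m + ended α i
    balance zero _ _ = refl
    balance {α} (suc i) i<N ne with balance {α} i (<⇒≤ i<N) (free-nonzero i<N ne)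
    ... | ih with hit? α (ev i)
    ...   | no _ rewrite *-zeroʳ (ind (kind (ev i) ≟ 1)) | *-zeroʳ (ind (kind (ev i) ≟ 0))
                | +-identityʳ (started α i) | +-identityʳ (ended α i) = ih
    ...   | yes _ with kind-cases i<N
    ...     | inj₁ k with react-start (ev i) (free X m ev α i) k ne
    ...       | _ , c rewrite k | +-identityʳ (ended α i) = trans (lemma _ (started α i)) (trans (cong (_+ started α i) (sym c)) ih)
      where
      lemma : ∀ a b → a + (b + 1) ≡ suc a + b
      lemma = solve-∀
    balance {α} (suc i) i<N ne | ih | yes _ | inj₂ k with react-end (ev i) (free X m ev α i) k ne
    ...       | _ , c rewrite c | k | +-identityʳ (started α i) = trans (cong suc ih) (lemma m (ended α i))
      where
      lemma : ∀ a b → suc (suc a + b) ≡ suc a + (b + 1)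
      lemma = solve-∀

    started≤m+ended : ∀ {α i} → i ≤ N → free X m ev α i ≢ 0 → started α i ≤ m + ended α i
    started≤m+ended {α} {i} i≤N ne = ≤-pred (≤-trans (+-monoˡ-≤ (started α i) (n≢0⇒n>0 ne)) (≤-reflexive (balance i i≤N ne)))

    free≢0⇒placement : ∀ {α} → (∀ j → j < n → α j ≤ σ) → free X m ev α N ≢ 0 → ∃[ β ] Placement X m β
    free≢0⇒placement {α} α≤σ ne = β , fits , bounded
      where
      β : ℕ → ℕ
      -- A job of processing time 0 has no events, so nothing compares its `α j` with its slack;
      -- offset 0 always fits.
      β j = ifZero (proc X j) 0 (α j)
      placed-in-time : ∀ j → j < n → 0 < proc X j → α j ≤ slack X j
      placed-in-time j j<n p with occurs 1 ≤-refl j<n (s≤s (α≤σ j j<n)) p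
      ... | i , i<N , refl , o , k with free-nonzero-prefix {α} {suc i} i<N ne
      ...   | ne′ with hit? α (ev i)
      ...     | no miss = contradiction (sym o) miss
      ...     | yes _ = subst (_≤ slack X (jobOf (ev i))) o (proj₁ (react-start (ev i) (free X m ev α i) k ne′))
      ifZero-≤ : ∀ p {a b} → (0 < p → a ≤ b) → ifZero p 0 a ≤ b
      ifZero-≤ zero    _ = z≤n
      ifZero-≤ (suc _) f = f (s≤s z≤n)
      fits : ∀ j → j < n → β j ≤ slack X j
      fits j j<n = ifZero-≤ (proc X j) (placed-in-time j j<n)
      counted : (ℕ → ℕ) → ℕ → ℕ → ℕ
      counted f κ i = ∑ i λ l → f l * ind (key (ev l) ≤? κ)
      S E : ℕ → ℕ
      S l = startHit α (ev l)
      E l = endHit α (ev l)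
      -- By sortedness the events with key at most `κ` form an initial segment, and
      -- `started≤m+ended` applies at its end.
      prefix : ∀ κ i → i ≤ N → counted S κ i ≤ m + counted E κ i
      prefix κ zero _ = z≤n
      prefix κ (suc i) i<N with key (ev i) ≤? κ
      ... | no _ rewrite *-zeroʳ (S i) | *-zeroʳ (E i) | +-identityʳ (counted S κ i) | +-identityʳ (counted E κ i) = prefix κ i (<⇒≤ i<N)
      ... | yes k≤ = begin
        counted S κ i + S i * 1   ≡⟨ cong₂ _+_ (all S) (*-identityʳ (S i)) ⟩
        started α (suc i)         ≤⟨ started≤m+ended i<N (free-nonzero-prefix i<N ne) ⟩
        m + ended α (suc i)       ≡⟨ cong (m +_) (cong₂ _+_ (all E) (*-identityʳ (E i))) ⟨
        m + (counted E κ i + E i * 1) ∎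
        where
        open ≤-Reasoning
        all : ∀ f → counted f κ i ≡ ∑ i f
        all f = ∑-cong i λ l l<i → trans (cong (f l *_) (ind-yes (key (ev l) ≤? κ) (≤-trans (key-mono (<⇒≤ l<i) i<N) k≤))) (*-identityʳ (f l))
      same : ∀ τ → started≤ β τ ≡ started≤ α τ × ended≤ β τ ≡ ended≤ α τ
      same τ = ∑-cong n (λ j _ → weigh j (λ a → ind (rel X j + a ≤? τ))) , ∑-cong n (λ j _ → weigh j (λ a → ind (rel X j + a + proc X j ≤? τ)))
        where
        weigh : ∀ j (f : ℕ → ℕ) → w j * f (β j) ≡ w j * f (α j)
        weigh j f with proc X j
        ... | zero  = refl
        ... | suc _ = refl
      bounded : ∀ τ → load (placed X β) τ ≤ m
      bounded τ = +-cancelʳ-≤ (ended≤ β τ) _ _ (begin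
        load (placed X β) τ + ended≤ β τ ≡⟨ load-balance β τ ⟩
        started≤ β τ                     ≡⟨ proj₁ (same τ) ⟩
        started≤ α τ                     ≡⟨ ∑-started α≤σ τ ⟨
        counted S (suc (τ + τ)) N        ≤⟨ prefix (suc (τ + τ)) N ≤-refl ⟩
        m + counted E (suc (τ + τ)) N    ≡⟨ cong (m +_) (trans (∑-ended α≤σ τ _ (n≤1+n _) ≤-refl) (sym (proj₂ (same τ)))) ⟩
        m + ended≤ β τ                   ∎)
        where open ≤-Reasoning

    module _ (slack≤σ : ∀ j → j < n → slack X j ≤ σ) {α : ℕ → ℕ} (P : Placement X m α) where

      private
        α≤σ : ∀ j → j < n → α j ≤ σ
        α≤σ j j<n = ≤-trans (proj₁ P j j<n) (slack≤σ j j<n)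

      -- Only a start can cause failure. At a start at time `τ`, the starts up to and including it
      -- are at most `load τ ≤ m` plus the ends already passed, so by `balance` the counter was at
      -- least 2 before it.
      placement⇒free≢0 : ∀ i → i ≤ N → free X m ev α i ≢ 0
      placement⇒free≢0 zero _ = λ ()
      placement⇒free≢0 (suc i) i<N with placement⇒free≢0 i (<⇒≤ i<N) | all-valid i i<N
      ... | ih | valid j<n _ _ origin with hit? α (ev i) in eq
      ...   | no _ = ih
      ...   | yes h with origin
      ...     | inj₂ (k , _) = react-end⁻¹ (ev i) (free X m ev α i) k ih
      ...     | inj₁ (k , κ) = λ z → case ≤-trans two (≤-reflexive (trans (sym (react-start⁻¹ (ev i) (free X m ev α i) k (subst (_≤ slack X (jobOf (ev i))) h (proj₁ P _ j<n)))) z)) of λ ()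
        where
        τ = rel X (jobOf (ev i)) + off (ev i)
        c = free X m ev α i
        enough : suc (suc (started α i)) ≤ c + started α i
        enough = begin
          suc (suc (started α i))        ≡⟨ cong suc (+-comm 1 (started α i)) ⟩
          suc (started α i + 1)          ≡⟨ cong (λ x → suc (started α i + x)) (cong₂ _*_ (ind-yes (kind (ev i) ≟ 1) k) (cong ind eq)) ⟨
          suc (started α (suc i))        ≤⟨ s≤s (started-upper α≤σ i<N κ) ⟩
          suc (started≤ α τ)             ≡⟨ cong suc (load-balance α τ) ⟨
          suc (load (placed X α) τ + ended≤ α τ) ≤⟨ s≤s (+-mono-≤ (proj₂ P τ) (ended-lower α≤σ i<N κ)) ⟩
          suc m + ended α i              ≡⟨ balance i (<⇒≤ i<N) ih ⟨
          c + started α i                ∎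
          where open ≤-Reasoning
        two : 1 ≤ c ∸ 1
        two = ∸-monoˡ-≤ 1 (+-cancelʳ-≤ (started α i) 2 c enough)

      -- A job whose window contains τ covers one of the 2σ+1 slots around τ.
      window : ∀ τ → started≤ (λ _ → 0) τ ≤ suc (σ + σ) * m + ended≤ (λ _ → σ) τ
      window τ = begin
        started≤ (λ _ → 0) τ      ≤⟨ ∑-mono n pointwise ⟩
        -- `τ + q ∸ σ` runs from `τ - σ` to `τ + σ`. Truncation only repeats slot 0, which does no
        -- harm to an upper bound.
        ∑ n (λ j → ∑ (suc (σ + σ)) (λ q → cov j (τ + q ∸ σ)) + w j * ind (rel X j + σ + proc X j ≤? τ))
                                  ≡⟨ ∑-+ n _ _ ⟩
        ∑ n (λ j → ∑ (suc (σ + σ)) λ q → cov j (τ + q ∸ σ)) + ended≤ (λ _ → σ) τ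
                                  ≡⟨ cong (_+ ended≤ (λ _ → σ) τ) (∑-swap n (suc (σ + σ)) _) ⟩
        ∑ (suc (σ + σ)) (λ q → load (placed X α) (τ + q ∸ σ)) + ended≤ (λ _ → σ) τ
                                  ≤⟨ +-monoˡ-≤ _ (∑-mono (suc (σ + σ)) λ q _ → proj₂ P (τ + q ∸ σ)) ⟩
        ∑ (suc (σ + σ)) (λ _ → m) + ended≤ (λ _ → σ) τ
                                  ≡⟨ cong (_+ ended≤ (λ _ → σ) τ) (∑-const (suc (σ + σ)) m) ⟩
        suc (σ + σ) * m + ended≤ (λ _ → σ) τ ∎
        where
        open ≤-Reasoning
        cov : ℕ → ℕ → ℕ
        cov j u = ind (covers? (placed X α) j u)
        near : ∀ j u → Covers (placed X α) j u → u ≤ τ + σ → τ ≤ u + σ → 1 ≤ ∑ (suc (σ + σ)) (λ q → cov j (τ + q ∸ σ))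
        near j u c u≤ τ≤ = ≤-trans (≤-reflexive (sym (trans (cong (cov j) slot) (ind-yes (covers? (placed X α) j u) c))))
          (∑-term (λ q → cov j (τ + q ∸ σ)) q<)
          where
          q = u + σ ∸ τ
          q< : q < suc (σ + σ)
          q< = s≤s (m≤n+o⇒m∸n≤o (u + σ) τ (≤-trans (+-monoˡ-≤ σ u≤) (≤-reflexive (+-assoc τ σ σ))))
          slot : τ + q ∸ σ ≡ u
          slot = trans (cong (_∸ σ) (m+[n∸m]≡n τ≤)) (m+n∸n≡m u σ)
        pointwise : ∀ j → j < n → w j * ind (rel X j + 0 ≤? τ) ≤
          ∑ (suc (σ + σ)) (λ q → cov j (τ + q ∸ σ)) + w j * ind (rel X j + σ + proc X j ≤? τ)
        pointwise j j<n with 0 <? proc X j | rel X j + 0 ≤? τ | rel X j + σ + proc X j ≤? τ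
        ... | no _  | _     | _     = z≤n
        ... | yes _ | no _  | _     = z≤n
        ... | yes _ | yes _ | yes _ = m≤n+m 1 _
        ... | yes p | yes r≤τ | no late = ≤-trans covered (m≤m+n _ _)
          where
          r = rel X j
          b = r + α j
          e = b + proc X j
          r≤ : r ≤ τ
          r≤ = subst (_≤ τ) (+-identityʳ r) r≤τ
          covered : 1 ≤ ∑ (suc (σ + σ)) (λ q → cov j (τ + q ∸ σ))
          -- The job runs at `τ`, starts after it, or has ended by then. The witness is `τ`, the
          -- first slot `b`, or the last slot `e ∸ 1`; it lies within `σ` of `τ` because the release
          -- time is at most `τ` and the latest possible end is after `τ`.
          covered with b ≤? τ | τ <? e
          ... | yes b≤ | yes τ< = near j τ (b≤ , τ<) (m≤m+n τ σ) (m≤m+n τ σ)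
          ... | no b≰  | _      = near j b (≤-refl , m<m+n b p) (+-mono-≤ r≤ (α≤σ j j<n)) (≤-trans (<⇒≤ (≰⇒> b≰)) (m≤m+n b σ))
          ... | yes _  | no τ≮  = near j (e ∸ 1) (b≤e-1 , e-1<e) (≤-trans (m∸n≤m e 1) (≤-trans (≮⇒≥ τ≮) (m≤m+n τ σ))) τ≤
            where
            e>0 : 0 < e
            e>0 = ≤-trans p (m≤n+m (proc X j) b)
            suc-pred-e : suc (e ∸ 1) ≡ e
            suc-pred-e = m+[n∸m]≡n e>0
            e-1<e : e ∸ 1 < e
            e-1<e = ≤-reflexive suc-pred-e
            b≤e-1 : b ≤ e ∸ 1
            b≤e-1 = ≤-pred (subst (suc b ≤_) (sym suc-pred-e) (m<m+n b p))
            τ≤ : τ ≤ e ∸ 1 + σ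
            τ≤ = ≤-pred (≤-trans (≰⇒> late) (begin
              r + σ + proc X j      ≡⟨ +-right-comm r σ (proc X j) ⟩
              r + proc X j + σ      ≤⟨ +-monoˡ-≤ σ (+-monoˡ-≤ (proc X j) (m≤m+n r (α j))) ⟩
              e + σ                 ≡⟨ cong (_+ σ) suc-pred-e ⟨
              suc (e ∸ 1 + σ)       ∎))

      -- With the constant offsets 0 and `σ`, `started` and `ended` count the jobs whose first and
      -- whose last event has passed, so their difference is the number of active jobs, which
      -- `window` bounds.
      active-bound : ∀ {i} → i < N → kind (ev i) ≡ 1 → off (ev i) ≡ 0 →
        started (λ _ → 0) (suc i) ≤ suc (σ + σ) * m + ended (λ _ → σ) i
      active-bound {i} i<N k o with Valid.origin (all-valid i i<N)
      ... | inj₂ (k′ , _) = case trans (sym k) k′ of λ ()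
      ... | inj₁ (_ , κ) = ≤-trans (started-upper (λ _ _ → z≤n) i<N κ)
              (≤-trans (window τ) (+-monoʳ-≤ (suc (σ + σ) * m) (ended-lower (λ _ _ → ≤-refl) i<N κ)))
        where
        τ = rel X (jobOf (ev i)) + off (ev i)

-- Table indices as digit strings

dig : ℕ → ℕ → ℕ → ℕ
dig σ zero    x = x % suc σ
dig σ (suc k) x = dig σ k (x / suc σ)

setDig : ℕ → ℕ → ℕ → ℕ → ℕ
setDig σ zero    o x = o + x / suc σ * suc σ
setDig σ (suc k) o x = x % suc σ + setDig σ k o (x / suc σ) * suc σ

module _ {σ : ℕ} where

  private
    B : ℕ
    B = suc σ

    remainder : ∀ {a} q → a < B → (a + q * B) % B ≡ a
    remainder {a} q a<B = trans ([m+kn]%n≡m%n a q B) (m<n⇒m%n≡m a<B)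

    quotient : ∀ {a} q → a < B → (a + q * B) / B ≡ q
    quotient {a} q a<B = *-cancelʳ-≡ _ q B (+-cancelˡ-≡ a _ _ (trans (cong (_+ (a + q * B) / B * B) (sym (remainder q a<B)))
      (sym (m≡m%n+[m/n]*n (a + q * B) B))))

    divMod : ∀ x → x % B + x / B * B ≡ x
    divMod x = sym (m≡m%n+[m/n]*n x B)

    /< : ∀ {x r} → x < B ^ suc r → x / B < B ^ r
    /< {x} {r} x< = m<n*o⇒m/o<n (subst (x <_) (*-comm B (B ^ r)) x<)

  dig< : ∀ k x → dig σ k x < B
  dig< zero    x = m%n<n x B
  dig< (suc k) x = dig< k (x / B)

  dig-setDig : ∀ k {o} x → o < B → dig σ k (setDig σ k o x) ≡ o
  dig-setDig zero    x o< = remainder (x / B) o<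
  dig-setDig (suc k) x o< = trans (cong (dig σ k) (quotient _ (m%n<n x B))) (dig-setDig k (x / B) o<)

  dig-setDig-other : ∀ k l {o} x → k ≢ l → o < B → dig σ l (setDig σ k o x) ≡ dig σ l x
  dig-setDig-other zero    zero    x k≢l o< = contradiction refl k≢l
  dig-setDig-other zero    (suc l) x k≢l o< = cong (dig σ l) (quotient (x / B) o<)
  dig-setDig-other (suc k) zero    {o} x k≢l o< = remainder (setDig σ k o (x / B)) (m%n<n x B)
  dig-setDig-other (suc k) (suc l) {o} x k≢l o< = trans (cong (dig σ l) (quotient (setDig σ k o (x / B)) (m%n<n x B)))
    (dig-setDig-other k l (x / B) (k≢l ∘ cong suc) o<)

  setDig-dig : ∀ k x → setDig σ k (dig σ k x) x ≡ x
  setDig-dig zero    x = divMod x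
  setDig-dig (suc k) x = trans (cong (λ y → x % B + y * B) (setDig-dig k (x / B))) (divMod x)

  setDig-setDig : ∀ k {o p} x → p < B → setDig σ k o (setDig σ k p x) ≡ setDig σ k o x
  setDig-setDig zero    {o} {p} x p< = cong (λ y → o + y * B) (quotient (x / B) p<)
  setDig-setDig (suc k) {o} {p} x p< = cong₂ (λ a y → a + y * B) (remainder (setDig σ k p (x / B)) (m%n<n x B))
    (trans (cong (setDig σ k o) (quotient _ (m%n<n x B))) (setDig-setDig k (x / B) p<))

  -- Replacing a digit moves the index by a multiple of `B ^ k`. The table scans reach related
  -- entries by this address arithmetic, without division.
  setDig-address : ∀ k o x → setDig σ k o x + dig σ k x * B ^ k ≡ x + o * B ^ k
  setDig-address zero o x = trans (lemma o (x / B * B) (x % B)) (cong (_+ o * 1) (divMod x))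
    where
    lemma : ∀ o q d → o + q + d * 1 ≡ d + q + o * 1
    lemma = solve-∀
  setDig-address (suc k) o x = begin
    x % B + s * B + d * (B * B ^ k)             ≡⟨ lemma₁ (x % B) s B d (B ^ k) ⟩
    x % B + (s + d * B ^ k) * B                 ≡⟨ cong (λ y → x % B + y * B) (setDig-address k o (x / B)) ⟩
    x % B + (x / B + o * B ^ k) * B             ≡⟨ lemma₂ (x % B) (x / B) B o (B ^ k) ⟩
    x % B + x / B * B + o * (B * B ^ k)         ≡⟨ cong (_+ o * (B * B ^ k)) (divMod x) ⟩
    x + o * (B * B ^ k)                         ∎
    where
    open ≡-Reasoning
    s = setDig σ k o (x / B)
    d = dig σ k (x / B)
    lemma₁ : ∀ a s b d p → a + s * b + d * (b * p) ≡ a + (s + d * p) * b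
    lemma₁ = solve-∀
    lemma₂ : ∀ a q b o p → a + (q + o * p) * b ≡ a + q * b + o * (b * p)
    lemma₂ = solve-∀

  setDig< : ∀ {k r o x} → k < r → o < B → x < B ^ r → setDig σ k o x < B ^ r
  setDig< {zero} {suc r} {o} {x} k<r o< x< = begin-strict
    o + x / B * B        <⟨ +-monoˡ-< _ o< ⟩
    suc (x / B) * B      ≤⟨ *-monoˡ-≤ B (/< {x} {r} x<) ⟩
    B ^ r * B            ≡⟨ *-comm (B ^ r) B ⟩
    B * B ^ r            ∎
    where open ≤-Reasoning
  setDig< {suc k} {suc r} {o} {x} k<r o< x< = begin-strict
    x % B + setDig σ k o (x / B) * B   <⟨ +-monoˡ-< _ (m%n<n x B) ⟩
    suc (setDig σ k o (x / B)) * B     ≤⟨ *-monoˡ-≤ B (setDig< {k} (≤-pred k<r) o< (/< {x} {r} x<)) ⟩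
    B ^ r * B                          ≡⟨ *-comm (B ^ r) B ⟩
    B * B ^ r                          ∎
    where open ≤-Reasoning

  -- Identifies the counters of `scan` with true digits: an index presented as high part, digit and
  -- low part has that digit.
  dig-unique : ∀ k h {d l} → d < B → l < B ^ k → dig σ k ((h * B + d) * B ^ k + l) ≡ d
  dig-unique zero h {d} {zero} d< l< = trans (cong (_% B) (lemma h B d)) (remainder h d<)
    where
    lemma : ∀ h b d → (h * b + d) * 1 + 0 ≡ d + h * b
    lemma = solve-∀
  dig-unique zero h {d} {suc l} d< (s≤s ())
  dig-unique (suc k) h {d} {l} d< l< = begin
    dig σ k (((h * B + d) * (B * B ^ k) + l) / B)                   ≡⟨ cong (λ y → dig σ k (y / B)) (begin
       (h * B + d) * (B * B ^ k) + l                                ≡⟨ cong ((h * B + d) * (B * B ^ k) +_) (divMod l) ⟨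
       (h * B + d) * (B * B ^ k) + (l % B + l / B * B)              ≡⟨ lemma (h * B + d) B (B ^ k) (l % B) (l / B) ⟩
       l % B + ((h * B + d) * B ^ k + l / B) * B                    ∎) ⟩
    dig σ k ((l % B + ((h * B + d) * B ^ k + l / B) * B) / B)       ≡⟨ cong (dig σ k) (quotient _ (m%n<n l B)) ⟩
    dig σ k ((h * B + d) * B ^ k + l / B)                           ≡⟨ dig-unique k h d< (/< {l} {k} l<) ⟩
    d                                                               ∎
    where
    open ≡-Reasoning
    lemma : ∀ a b p r q → a * (b * p) + (r + q * b) ≡ r + (a * p + q) * b
    lemma = solve-∀

  -- Forgets all digits from position `r` on; in a table enlarged by one digit, this is the old
  -- entry to be copied.
  wrap : ℕ → ℕ → ℕ
  wrap r x = (x % (B ^ r)) {{m^n≢0 B r}}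

  wrap< : ∀ r x → wrap r x < B ^ r
  wrap< r x = m%n<n x (B ^ r) {{m^n≢0 B r}}

  wrap-small : ∀ r {x} → x < B ^ r → wrap r x ≡ x
  wrap-small r x< = m<n⇒m%n≡m {{m^n≢0 B r}} x<

  wrap-+ : ∀ r x → wrap r (B ^ r + x) ≡ wrap r x
  wrap-+ r x = trans (cong (wrap r) (trans (+-comm (B ^ r) x) (cong (x +_) (sym (*-identityˡ (B ^ r))))))
    ([m+kn]%n≡m%n x 1 (B ^ r) {{m^n≢0 B r}})

  dig-wrap : ∀ {k r} x → k < r → dig σ k (wrap r x) ≡ dig σ k x
  dig-wrap {zero}  {suc r} x k<r = m∣n⇒o%n%m≡o%m B (B ^ suc r) x {{_}} {{m^n≢0 B (suc r)}} (m∣m*n (B ^ r))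
  dig-wrap {suc k} {suc r} x k<r = trans (cong (dig σ k) (trans
    (cong (_/ B) (%-congʳ {o = x} {{m^n≢0 B (suc r)}} {{nz}} (*-comm B (B ^ r))))
    (m%[n*o]/o≡m/o%n x (B ^ r) B {{m^n≢0 B r}} {{_}} {{nz}}))) (dig-wrap {k} (x / B) (≤-pred k<r))
    where
    nz : NonZero (B ^ r * B)
    nz = m*n≢0 (B ^ r) B {{m^n≢0 B r}}

-- The table of partial placements

Bounded : ℕ → (ℕ → ℕ) → Set
Bounded σ α = ∀ j → α j ≤ σ

Consistent : ℕ → ℕ → (ℕ → ℕ) → (ℕ → ℕ) → ℕ → Set
Consistent n σ slot α x = ∀ j k → j < n → slot j ≡ suc k → dig σ k x ≡ α j

-- Slot k holds digit k of the table index; slot j ≡ suc k says that job j owns slot k.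
record Tabulates (n σ : ℕ) (f : (ℕ → ℕ) → ℕ) (r : ℕ) (slot T : ℕ → ℕ) : Set where
  field
    upper    : ∀ x → x < suc σ ^ r → ∀ α → Bounded σ α → Consistent n σ slot α x → f α ≤ T x
    attained : ∀ x → x < suc σ ^ r → ∃[ α ] Bounded σ α × Consistent n σ slot α x × f α ≡ T x

module _ {n σ : ℕ} where

  -- All `α` consistent with `x` give the owner `j` the same offset, namely its digit. So one
  -- monotone map acts on all competitors and commutes with their maximum.
  tabulates-step : ∀ {f f′ r slot T T′} (g : ℕ → ℕ → ℕ) j k → j < n → slot j ≡ suc k →
    (∀ o {c d} → c ≤ d → g o c ≤ g o d) → (∀ α → f′ α ≡ g (α j) (f α)) →
    (∀ x → x < suc σ ^ r → T′ x ≡ g (dig σ k x) (T x)) →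
    Tabulates n σ f r slot T → Tabulates n σ f′ r slot T′
  tabulates-step {f} {f′} {r} {slot} {T} {T′} g j k j<n s mono f′≡ T′≡ t = record
    { upper    = λ x x< α b c → begin
        f′ α             ≡⟨ f′≡ α ⟩
        g (α j) (f α)    ≤⟨ mono (α j) (upper x x< α b c) ⟩
        g (α j) (T x)    ≡⟨ cong (λ o → g o (T x)) (c j k j<n s) ⟨
        g (dig σ k x) (T x) ≡⟨ T′≡ x x< ⟨
        T′ x             ∎
    ; attained = λ x x< → let α , b , c , e = attained x x< in α , b , c ,
        trans (f′≡ α) (trans (cong₂ g (sym (c j k j<n s)) e) (sym (T′≡ x x<))) }
    where
    open Tabulates t
    open ≤-Reasoning

  -- Before the first event of `j` the value `f α` does not depend on `α j`, so that offset may be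
  -- prescribed by any digit without changing an entry.
  tabulates-activate : ∀ {f r slot slot′ T} j k → slot j ≡ 0 → slot′ j ≡ suc k → (∀ i → i ≢ j → slot′ i ≡ slot i) →
    (∀ α o → f (update α j o) ≡ f α) → Tabulates n σ f r slot T → Tabulates n σ f r slot′ T
  tabulates-activate {f} {r} {slot} {slot′} {T} j k unused s same indep t = record
    { upper    = λ x x< α b c → upper x x< α b (weaken x α c)
    ; attained = λ x x< → let α , b , c , e = attained x x< in
        update α j (dig σ k x) , bounded α x b , consistent α x c , trans (indep α _) e }
    where
    open Tabulates t
    weaken : ∀ x α → Consistent n σ slot′ α x → Consistent n σ slot α x
    weaken x α c i l i<n e = c i l i<n (trans (same i (λ { refl → case trans (sym unused) e of λ () })) e)
    bounded : ∀ α x → Bounded σ α → Bounded σ (update α j (dig σ k x))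
    bounded α x b i with i ≟ j
    ... | yes e rewrite update-same α j (dig σ k x) e = ≤-pred (dig< k x)
    ... | no ne rewrite update-other α j (dig σ k x) ne = b i
    consistent : ∀ α x → Consistent n σ slot α x → Consistent n σ slot′ (update α j (dig σ k x)) x
    consistent α x c i l i<n e with i ≟ j
    ... | yes refl rewrite update-same α j (dig σ k x) refl = cong (λ l → dig σ l x) (suc-injective (trans (sym e) s))
    ... | no ne rewrite update-other α j (dig σ k x) ne = c i l i<n (trans (sym (same i ne)) e)

  -- Releasing the digit turns a prescribed offset into a free one, hence the maximum over `o`. It
  -- is stored at every value of the digit, so a later owner of the slot finds a table that need not
  -- be touched. `distinct` ensures that resetting digit `k` disturbs no other job.
  tabulates-retire : ∀ {f r slot slot′ T T′} j k → k < r → slot j ≡ suc k → slot′ j ≡ 0 → (∀ i → i ≢ j → slot′ i ≡ slot i) →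
    (∀ i → i < n → i ≢ j → slot i ≢ suc k) →
    (∀ x → x < suc σ ^ r → (∀ o → o < suc σ → T (setDig σ k o x) ≤ T′ x) × ∃[ o ] o < suc σ × T′ x ≡ T (setDig σ k o x)) →
    Tabulates n σ f r slot T → Tabulates n σ f r slot′ T′
  tabulates-retire {f} {r} {slot} {slot′} {T} {T′} j k k<r s s′ same distinct max t = record
    { upper    = λ x x< α b c → ≤-trans
        (upper (setDig σ k (α j) x) (setDig< k<r (s≤s (b j)) x<) α b (strengthen x α (s≤s (b j)) c))
        (proj₁ (max x x<) (α j) (s≤s (b j)))
    ; attained = λ x x< → let o , o< , e = proj₂ (max x x<)
                              α , b , c , e′ = attained (setDig σ k o x) (setDig< k<r o< x<)
                          in α , b , weaken x o o< α c , trans e′ (sym e) }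
    where
    open Tabulates t
    owned : ∀ i {l} → slot′ i ≡ suc l → i ≢ j
    owned i e refl = case trans (sym s′) e of λ ()
    other : ∀ i {l} → i < n → slot′ i ≡ suc l → k ≢ l
    other i i<n e refl = distinct i i<n (owned i e) (trans (sym (same i (owned i e))) e)
    strengthen : ∀ x α → α j < suc σ → Consistent n σ slot′ α x → Consistent n σ slot α (setDig σ k (α j) x)
    strengthen x α o< c i l i<n e with i ≟ j
    ... | yes refl rewrite suc-injective (trans (sym e) s) = dig-setDig k x o<
    ... | no ne = let e′ = trans (same i ne) e in trans (dig-setDig-other k l x (other i i<n e′) o<) (c i l i<n e′)
    weaken : ∀ x o → o < suc σ → ∀ α → Consistent n σ slot α (setDig σ k o x) → Consistent n σ slot′ α x
    weaken x o o< α c i l i<n e = trans (sym (dig-setDig-other k l x (other i i<n e) o<)) (c i l i<n (trans (sym (same i (owned i e))) e))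

  -- No job owns the new digit, so each block of the larger table is a copy of the old table.
  tabulates-grow : ∀ {f r slot T T′} → (∀ j k → j < n → slot j ≡ suc k → k < r) →
    (∀ x → x < suc σ ^ suc r → T′ x ≡ T (wrap {σ} r x)) → Tabulates n σ f r slot T → Tabulates n σ f (suc r) slot T′
  tabulates-grow {f} {r} {slot} {T} {T′} slot< T′≡ t = record
    { upper    = λ x x< α b c → subst (f α ≤_) (sym (T′≡ x x<)) (upper (wrap {σ} r x) (wrap< r x) α b
                   λ j k j<n e → trans (dig-wrap x (slot< j k j<n e)) (c j k j<n e))
    ; attained = λ x x< → let α , b , c , e = attained (wrap {σ} r x) (wrap< r x) in
                   α , b , (λ j k j<n e → trans (sym (dig-wrap x (slot< j k j<n e))) (c j k j<n e)) , trans e (sym (T′≡ x x<)) }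
    where open Tabulates t

-- One counting identity carries the whole invariant: each `k < r` either has exactly one owner or
-- lies exactly once among the first `F` cells of the stack `spare`, and no `k ≥ r` does either.
-- Every operation moves a single indicator across the sum.
record Slots (n r : ℕ) (slot spare : ℕ → ℕ) (F : ℕ) : Set where
  field
    occupied : ∀ k → ∑ n (λ j → ind (slot j ≟ suc k)) + ∑ F (λ l → ind (spare l ≟ k)) ≡ ind (k <? r)

  slot< : ∀ j k → j < n → slot j ≡ suc k → k < r
  slot< j k j<n e = ind⁻¹ (k <? r) λ z → case ≤-trans (≤-reflexive (sym (ind-yes (slot j ≟ suc k) e)))
    (≤-trans (∑-term (λ j → ind (slot j ≟ suc k)) j<n) (≤-trans (m≤m+n _ _) (≤-reflexive (trans (occupied k) z)))) of λ ()

  private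
    twice : ∀ i j k → i < j → j < n → slot i ≡ suc k → slot j ≡ suc k → ⊥
    twice i j k i<j j<n ei ej = <⇒≱ (≤-trans
      (≤-reflexive (cong₂ _+_ (sym (ind-yes (slot i ≟ suc k) ei)) (sym (ind-yes (slot j ≟ suc k) ej))))
      (∑-two-terms (λ j → ind (slot j ≟ suc k)) i<j j<n))
      (≤-trans (m≤m+n _ _) (≤-trans (≤-reflexive (occupied k)) (ind≤1 (k <? r))))

  distinct : ∀ i j k → i < n → j < n → i ≢ j → slot j ≡ suc k → slot i ≢ suc k
  distinct i j k i<n j<n i≢j ej ei with <-cmp i j
  ... | tri≈ _ e _ = i≢j e
  ... | tri< l _ _ = twice i j k l j<n ei ej
  ... | tri> _ _ l = twice j i k l i<n ej ei

  private
    change : ∀ {slot′ j} → j < n → (∀ i → i ≢ j → slot′ i ≡ slot i) → ∀ k →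
      ∑ n (λ j → ind (slot′ j ≟ suc k)) + ind (slot j ≟ suc k) ≡ ∑ n (λ j → ind (slot j ≟ suc k)) + ind (slot′ j ≟ suc k)
    change j<n same k = ∑-change _ _ j<n λ i i≢j → cong (λ s → ind (s ≟ suc k)) (same i i≢j)

  slots-pop : ∀ {slot′ G j} → F ≡ suc G → j < n → slot j ≡ 0 → slot′ j ≡ suc (spare G) → (∀ i → i ≢ j → slot′ i ≡ slot i) →
    Slots n r slot′ spare G
  slots-pop {slot′} {G} {j} refl j<n z s same = record { occupied = λ k → begin
      ∑ n (λ j → ind (slot′ j ≟ suc k)) + ∑ G (λ l → ind (spare l ≟ k))
        ≡⟨ cong (_+ ∑ G (λ l → ind (spare l ≟ k))) (moved k) ⟩
      ∑ n (λ j → ind (slot j ≟ suc k)) + ind (spare G ≟ k) + ∑ G (λ l → ind (spare l ≟ k))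
        ≡⟨ lemma (∑ n (λ j → ind (slot j ≟ suc k))) _ _ ⟩
      ∑ n (λ j → ind (slot j ≟ suc k)) + ∑ (suc G) (λ l → ind (spare l ≟ k))
        ≡⟨ occupied k ⟩
      ind (k <? r) ∎ }
    where
    open ≡-Reasoning
    lemma : ∀ a b c → a + b + c ≡ a + (c + b)
    lemma = solve-∀
    moved : ∀ k → ∑ n (λ j → ind (slot′ j ≟ suc k)) ≡ ∑ n (λ j → ind (slot j ≟ suc k)) + ind (spare G ≟ k)
    moved k = trans (sym (+-identityʳ _)) (trans (cong (∑ n (λ j → ind (slot′ j ≟ suc k)) +_)
        (sym (ind-no (slot j ≟ suc k) (λ e → case trans (sym z) e of λ ()))))
      (trans (change {slot′} j<n same k) (cong (∑ n (λ j → ind (slot j ≟ suc k)) +_)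
        (ind-cong (slot′ j ≟ suc k) (spare G ≟ k) (λ e → suc-injective (trans (sym s) e)) (λ e → trans s (cong suc e))))))

  slots-grow : ∀ {slot′ j} → F ≡ 0 → j < n → slot j ≡ 0 → slot′ j ≡ suc r → (∀ i → i ≢ j → slot′ i ≡ slot i) →
    Slots n (suc r) slot′ spare F
  slots-grow {slot′} {j} refl j<n z s same = record { occupied = λ k → begin
      ∑ n (λ j → ind (slot′ j ≟ suc k)) + 0        ≡⟨ cong (∑ n (λ j → ind (slot′ j ≟ suc k)) +_) (ind-no (slot j ≟ suc k) (λ e → case trans (sym z) e of λ ())) ⟨
      ∑ n (λ j → ind (slot′ j ≟ suc k)) + ind (slot j ≟ suc k) ≡⟨ change {slot′} j<n same k ⟩
      ∑ n (λ j → ind (slot j ≟ suc k)) + ind (slot′ j ≟ suc k) ≡⟨ cong (_+ ind (slot′ j ≟ suc k)) (trans (sym (+-identityʳ _)) (occupied k)) ⟩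
      ind (k <? r) + ind (slot′ j ≟ suc k)         ≡⟨ cong (ind (k <? r) +_) (ind-cong (slot′ j ≟ suc k) (k ≟ r)
                                                        (λ e → suc-injective (trans (sym e) s)) (λ e → trans s (cong suc (sym e)))) ⟩
      ind (k <? r) + ind (k ≟ r)                   ≡⟨ split k ⟩
      ind (k <? suc r)                             ∎ }
    where
    open ≡-Reasoning
    split : ∀ k → ind (k <? r) + ind (k ≟ r) ≡ ind (k <? suc r)
    split k with <-cmp k r
    ... | tri< l ne _ rewrite ind-yes (k <? r) l | ind-no (k ≟ r) ne = sym (ind-yes (k <? suc r) (m<n⇒m<1+n l))
    ... | tri≈ nl e _ rewrite ind-no (k <? r) nl | ind-yes (k ≟ r) e = sym (ind-yes (k <? suc r) (s≤s (≤-reflexive e)))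
    ... | tri> nl ne g rewrite ind-no (k <? r) nl | ind-no (k ≟ r) ne = sym (ind-no (k <? suc r) (≤⇒≯ g))

  slots-push : ∀ {slot′ spare′ j k} → j < n → slot j ≡ suc k → slot′ j ≡ 0 → (∀ i → i ≢ j → slot′ i ≡ slot i) →
    spare′ F ≡ k → (∀ l → l < F → spare′ l ≡ spare l) → Slots n r slot′ spare′ (suc F)
  slots-push {slot′} {spare′} {j} {k} j<n s z same top rest = record { occupied = λ k′ → begin
      ∑ n (λ j → ind (slot′ j ≟ suc k′)) + (∑ F (λ l → ind (spare′ l ≟ k′)) + ind (spare′ F ≟ k′))
        ≡⟨ cong₂ (λ a b → ∑ n (λ j → ind (slot′ j ≟ suc k′)) + (a + b)) (∑-cong F λ l l<F → cong (λ s → ind (s ≟ k′)) (rest l l<F))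
             (ind-cong (spare′ F ≟ k′) (slot j ≟ suc k′) (λ e → trans s (cong suc (trans (sym top) e))) (λ e → trans top (suc-injective (trans (sym s) e)))) ⟩
      ∑ n (λ j → ind (slot′ j ≟ suc k′)) + (∑ F (λ l → ind (spare l ≟ k′)) + ind (slot j ≟ suc k′))
        ≡⟨ lemma (∑ n (λ j → ind (slot′ j ≟ suc k′))) _ _ ⟩
      ∑ n (λ j → ind (slot′ j ≟ suc k′)) + ind (slot j ≟ suc k′) + ∑ F (λ l → ind (spare l ≟ k′))
        ≡⟨ cong (_+ ∑ F (λ l → ind (spare l ≟ k′))) (trans (change {slot′} j<n same k′)
             (trans (cong (∑ n (λ j → ind (slot j ≟ suc k′)) +_) (ind-no (slot′ j ≟ suc k′) (λ e → case trans (sym z) e of λ ()))) (+-identityʳ _))) ⟩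
      ∑ n (λ j → ind (slot j ≟ suc k′)) + ∑ F (λ l → ind (spare l ≟ k′))
        ≡⟨ occupied k′ ⟩
      ind (k′ <? r) ∎ }
    where
    open ≡-Reasoning
    lemma : ∀ a b c → a + (b + c) ≡ a + c + b
    lemma = solve-∀

slots-cong : ∀ {n r r′ slot slot′ spare spare′ F F′} → r′ ≡ r → (∀ j → slot′ j ≡ slot j) → (∀ l → spare′ l ≡ spare l) → F′ ≡ F →
  Slots n r slot spare F → Slots n r′ slot′ spare′ F′
slots-cong {n} {F = F} refl same same′ refl S = record { occupied = λ k → trans
  (cong₂ _+_ (∑-cong n λ j _ → cong (λ s → ind (s ≟ suc k)) (same j)) (∑-cong F λ l _ → cong (λ s → ind (s ≟ k)) (same′ l)))
  (Slots.occupied S k) }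

tabulates-cong : ∀ {n σ f r r′ slot slot′ T T′} → r′ ≡ r → (∀ j → slot′ j ≡ slot j) → (∀ x → T′ x ≡ T x) →
  Tabulates n σ f r slot T → Tabulates n σ f r′ slot′ T′
tabulates-cong {f = f} refl same same′ t = record
  { upper    = λ x x< α b c → subst (f α ≤_) (sym (same′ x)) (upper x x< α b λ j k j<n e → c j k j<n (trans (same j) e))
  ; attained = λ x x< → let α , b , c , e = attained x x< in
      α , b , (λ j k j<n e′ → c j k j<n (trans (sym (same j)) e′)) , trans e (sym (same′ x)) }
  where open Tabulates t

-- Merge sort

RunSorted : ℕ → ℕ → (ℕ → Event) → Set
RunSorted w N ev = ∀ c x → c * w ≤ x → suc x < suc c * w → suc x < N → key (ev x) ≤ key (ev (suc x))

-- Merging the runs [i , iE) and [j , jE) of src; the first k events of out are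
-- final, and b pairs of runs have been opened.
record Merging (w N : ℕ) (src out : ℕ → Event) (b i iE j jE k : ℕ) : Set where
  field
    i≤iE  : i ≤ iE
    iE≤j  : iE ≤ j
    j≤jE  : j ≤ jE
    jE≤N  : jE ≤ N
    jE≤   : jE ≤ b * (w + w)
    jE≡   : jE < N → jE ≡ b * (w + w)
    k≡    : k + iE ≡ i + j
    k≥    : b * (w + w) ≤ k + (w + w)
    left  : ∀ x → i ≤ x → suc x < iE → key (src x) ≤ key (src (suc x))
    right : ∀ x → j ≤ x → suc x < jE → key (src x) ≤ key (src (suc x))
    done  : RunSorted (w + w) k out
    -- The second premise places `x` in the current output block. Just after a new pair of runs is
    -- opened it fails, since the last emitted event then belongs to the previous block.
    last  : ∀ x → suc x ≡ k → b * (w + w) ≤ x + (w + w) →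
            (i < iE → key (out x) ≤ key (src i)) × (j < jE → key (out x) ≤ key (src j))
    -- Emitted so far are the events of `[0 , i)` and `[iE , j)`; the sum up to `iE` is added on
    -- both sides to avoid a difference.
    sums  : ∀ g → ∑ k (g ∘ out) + ∑ iE (g ∘ src) ≡ ∑ i (g ∘ src) + ∑ j (g ∘ src)

  k<jE : i < iE ⊎ j < jE → k < jE
  k<jE (inj₁ l) = +-cancelʳ-< iE k jE (begin-strict
    k + iE  ≡⟨ k≡ ⟩
    i + j   <⟨ +-mono-<-≤ l j≤jE ⟩
    iE + jE ≡⟨ +-comm iE jE ⟩
    jE + iE ∎)
    where open ≤-Reasoning
  k<jE (inj₂ l) = +-cancelʳ-< iE k jE (begin-strict
    k + iE  ≡⟨ k≡ ⟩
    i + j   <⟨ +-mono-≤-< i≤iE l ⟩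
    iE + jE ≡⟨ +-comm iE jE ⟩
    jE + iE ∎)
    where open ≤-Reasoning

  exhausted⇒k≡jE : i ≡ iE → j ≡ jE → k ≡ jE
  exhausted⇒k≡jE refl refl = +-cancelʳ-≡ i k j (trans k≡ (+-comm i j))

module _ {w N : ℕ} {src : ℕ → Event} where

  merging-start : ∀ {out} → Merging w N src out 0 0 0 0 0 0
  merging-start = record
    { i≤iE = z≤n ; iE≤j = z≤n ; j≤jE = z≤n ; jE≤N = z≤n ; jE≤ = z≤n ; jE≡ = λ _ → refl ; k≡ = refl ; k≥ = z≤n
    ; left = λ _ _ () ; right = λ _ _ () ; done = λ _ _ _ _ () ; last = λ _ () ; sums = λ _ → refl }

  -- The old pair is exhausted, so `k ≡ jE`; as `k < N`, that pair was not cut off by the end of the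
  -- list and the next one starts at a multiple of `w + w`. Both new runs are clipped at `N`, and
  -- the right one is nonempty only if the left one has full width.
  merging-refill : ∀ {out b i iE j jE k} iE′ jE′ → 1 ≤ w → k < N → RunSorted w N src → i ≡ iE → j ≡ jE →
    iE′ ≡ (jE + w) ⊓ N → jE′ ≡ (iE′ + w) ⊓ N →
    Merging w N src out b i iE j jE k → Merging w N src out (suc b) jE iE′ iE′ jE′ k × jE < iE′
  merging-refill {out} {b} {i} {.i} {j} {.j} {k} iE′ jE′ w≥1 k<N runs refl refl iE≡′ jE≡′ M = record
      { i≤iE = <⇒≤ j<iE′ ; iE≤j = ≤-refl
      ; j≤jE = subst (iE′ ≤_) (sym jE≡′) (⊓-glb (m≤m+n iE′ w) iE′≤N)
      ; jE≤N = subst (_≤ N) (sym jE≡′) (m⊓n≤n _ N)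
      ; jE≤  = begin
          jE′               ≡⟨ jE≡′ ⟩
          (iE′ + w) ⊓ N     ≤⟨ m⊓n≤m _ N ⟩
          iE′ + w           ≤⟨ +-monoˡ-≤ w iE′≤ ⟩
          j + w + w         ≡⟨ shift ⟩
          suc b * (w + w)   ∎
      ; jE≡  = λ jE′<N → let iE′+w<N = ⊓<⇒< (subst (_< N) jE≡′ jE′<N) in
          trans jE≡′ (trans (m≤n⇒m⊓n≡m (<⇒≤ iE′+w<N)) (trans (cong (_+ w) (full (≤-<-trans (m≤m+n iE′ w) iE′+w<N))) shift))
      ; k≡   = cong (_+ iE′) k≡j
      ; k≥   = ≤-reflexive (trans (+-comm (w + w) _) (cong (_+ (w + w)) (trans (sym j≡) (sym k≡j))))
      ; left = λ x j≤x sx< → runs (b + b) x (subst (_≤ x) (sym start≡) j≤x)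
          (subst (suc x <_) (trans (+-comm j w) (cong (w +_) (sym start≡))) (<-≤-trans sx< iE′≤)) (<-≤-trans sx< iE′≤N)
      ; right = λ x iE≤x sx< → let sx<N = <-≤-trans sx< (subst (_≤ N) (sym jE≡′) (m⊓n≤n _ N))
                                   iE≡ = full (≤-<-trans iE≤x (<-trans ≤-refl sx<N)) in
          runs (suc (b + b)) x (subst (_≤ x) (trans iE≡ (trans (+-comm j w) (cong (w +_) (sym start≡)))) iE≤x)
            (<-≤-trans sx< (≤-trans (≤-trans (≤-reflexive jE≡′) (m⊓n≤m _ N))
              (≤-reflexive (trans (cong (_+ w) iE≡) (trans (lemma j w) (cong (λ y → w + (w + y)) (sym start≡))))))) sx<N
      ; done = done
      ; last = λ x sx≡k b≤ → contradiction (+-cancelʳ-≤ (w + w) _ _ (≤-trans (≤-reflexive (+-comm (b * (w + w)) (w + w))) b≤))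
          (<⇒≱ (≤-trans (≤-reflexive (trans sx≡k k≡j)) (≤-reflexive j≡)))
      ; sums = λ g → cong (_+ ∑ iE′ (g ∘ src)) (+-cancelʳ-≡ (∑ i (g ∘ src)) _ _ (trans (sums g) (+-comm (∑ i (g ∘ src)) _)))
      } , j<iE′
    where
    open Merging M
    open ≤-Reasoning
    k≡j : k ≡ j
    k≡j = exhausted⇒k≡jE refl refl
    j<N : j < N
    j<N = subst (_< N) k≡j k<N
    j≡ : j ≡ b * (w + w)
    j≡ = jE≡ j<N
    iE′≤N : iE′ ≤ N
    iE′≤N = subst (_≤ N) (sym iE≡′) (m⊓n≤n _ N)
    iE′≤ : iE′ ≤ j + w
    iE′≤ = subst (_≤ j + w) (sym iE≡′) (m⊓n≤m _ N)
    j<iE′ : j < iE′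
    j<iE′ = subst (j <_) (sym iE≡′) (⊓-glb (m<m+n j w≥1) j<N)
    ⊓<⇒< : ∀ {a} → a ⊓ N < N → a < N
    ⊓<⇒< {a} lt with a <? N
    ... | yes a<N = a<N
    ... | no a≮N = contradiction lt (subst (λ y → ¬ (y < N)) (sym (m≥n⇒m⊓n≡n (≮⇒≥ a≮N))) (<-irrefl refl))
    full : iE′ < N → iE′ ≡ j + w
    full lt = trans iE≡′ (m≤n⇒m⊓n≡m (<⇒≤ (⊓<⇒< (subst (_< N) iE≡′ lt))))
    start≡ : (b + b) * w ≡ j
    start≡ = trans (*-distribʳ-+ w b b) (trans (sym (*-distribˡ-+ b w w)) (sym j≡))
    shift : j + w + w ≡ suc b * (w + w)
    shift = trans (cong (λ y → y + w + w) j≡) (lemma′ (b * (w + w)) w)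
      where
      lemma′ : ∀ a w → a + w + w ≡ w + w + a
      lemma′ = solve-∀
    lemma : ∀ j w → j + w + w ≡ w + (w + j)
    lemma = solve-∀

  private
    -- Only the neighbours `k - 1` and `k` are new. If they share the output block `c`, then `jE≤`
    -- and `k≥` force `b ≡ suc c`, so the premise of `next` is met.
    step-done : ∀ {out out′ b i iE j jE k} → Merging w N src out b i iE j jE k → i < iE ⊎ j < jE → (∀ x → x < k → out′ x ≡ out x) →
      (∀ x → suc x ≡ k → b * (w + w) ≤ x + (w + w) → key (out x) ≤ key (out′ k)) → RunSorted (w + w) (suc k) out′
    step-done {out} {out′} {b} {k = k} M rest same next c x c≤x sx< sx<sk with m≤n⇒m<n∨m≡n (≤-pred sx<sk)
    ... | inj₁ sx<k rewrite same x (<-trans ≤-refl sx<k) | same (suc x) sx<k = Merging.done M c x c≤x sx< sx<k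
    ... | inj₂ refl rewrite same x ≤-refl = next x refl (≤-trans (≤-reflexive (cong (_* (w + w)) b≡)) (≤-trans (≤-reflexive (+-comm (w + w) _)) (+-monoˡ-≤ (w + w) c≤x)))
      where
      open Merging M
      c<b : c < b
      c<b = *-cancelʳ-< (w + w) c b (≤-<-trans c≤x (<-trans ≤-refl (<-≤-trans (k<jE rest) jE≤)))
      b≡ : b ≡ suc c
      b≡ = ≤-antisym (≤-pred (*-cancelʳ-< (w + w) b (suc (suc c)) (≤-<-trans k≥ (subst (_< suc (suc c) * (w + w)) (+-comm (w + w) k) (+-monoʳ-< (w + w) sx<))))) c<b

    step-sum : ∀ {out out′ : ℕ → Event} {k e} g → (∀ x → x < k → out′ x ≡ out x) → out′ k ≡ e →
      ∑ (suc k) (g ∘ out′) ≡ ∑ k (g ∘ out) + g e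
    step-sum {k = k} g same new = cong₂ _+_ (∑-cong k λ x x<k → cong g (same x x<k)) (cong g new)

  merging-left : ∀ {out out′ b i iE j jE k} → i < iE → (j < jE → key (src i) ≤ key (src j)) →
    out′ k ≡ src i → (∀ x → x < k → out′ x ≡ out x) →
    Merging w N src out b i iE j jE k → Merging w N src out′ b (suc i) iE j jE (suc k)
  merging-left {out} {out′} {b} {i} {iE} {j} {jE} {k} i<iE i≤j new same M = record
    { i≤iE = i<iE ; iE≤j = iE≤j ; j≤jE = j≤jE ; jE≤N = jE≤N ; jE≤ = jE≤ ; jE≡ = jE≡
    ; k≡ = cong suc k≡ ; k≥ = m≤n⇒m≤1+n k≥
    ; left = λ x i<x → left x (<⇒≤ i<x) ; right = right
    ; done = step-done M (inj₁ i<iE) same λ x sx≡k b≤ → subst (λ e → key (out x) ≤ key e) (sym new) (proj₁ (last x sx≡k b≤) i<iE)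
    ; last = λ x sx≡sk _ → case suc-injective sx≡sk of λ { refl →
        (λ si<iE → subst (λ e → key e ≤ key (src (suc i))) (sym new) (left i ≤-refl si<iE))
        , λ j<jE → subst (λ e → key e ≤ key (src j)) (sym new) (i≤j j<jE) }
    ; sums = λ g → trans (cong (_+ ∑ iE (g ∘ src)) (step-sum {out} {out′} g same new)) (trans (+-right-comm (∑ k (g ∘ out)) (g (src i)) _)
        (trans (cong (_+ g (src i)) (sums g)) (+-right-comm (∑ i (g ∘ src)) _ (g (src i))))) }
    where
    open Merging M

  merging-right : ∀ {out out′ b i iE j jE k} → j < jE → (i < iE → key (src j) ≤ key (src i)) →
    out′ k ≡ src j → (∀ x → x < k → out′ x ≡ out x) →
    Merging w N src out b i iE j jE k → Merging w N src out′ b i iE (suc j) jE (suc k)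
  merging-right {out} {out′} {b} {i} {iE} {j} {jE} {k} j<jE j≤i new same M = record
    { i≤iE = i≤iE ; iE≤j = m≤n⇒m≤1+n iE≤j ; j≤jE = j<jE ; jE≤N = jE≤N ; jE≤ = jE≤ ; jE≡ = jE≡
    ; k≡ = trans (cong suc k≡) (sym (+-suc i j)) ; k≥ = m≤n⇒m≤1+n k≥
    ; left = left ; right = λ x j<x → right x (<⇒≤ j<x)
    ; done = step-done M (inj₂ j<jE) same λ x sx≡k b≤ → subst (λ e → key (out x) ≤ key e) (sym new) (proj₂ (last x sx≡k b≤) j<jE)
    ; last = λ x sx≡sk _ → case suc-injective sx≡sk of λ { refl →
        (λ i<iE → subst (λ e → key e ≤ key (src i)) (sym new) (j≤i i<iE))
        , λ sj<jE → subst (λ e → key e ≤ key (src (suc j))) (sym new) (right j ≤-refl sj<jE) }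
    ; sums = λ g → trans (cong (_+ ∑ iE (g ∘ src)) (step-sum {out} {out′} g same new)) (trans (+-right-comm (∑ k (g ∘ out)) (g (src j)) _)
        (trans (cong (_+ g (src j)) (sums g)) (+-assoc (∑ i (g ∘ src)) _ _))) }
    where
    open Merging M

  merging-end : ∀ {out b i iE j jE} → Merging w N src out b i iE j jE N →
    RunSorted (w + w) N out × ∀ g → ∑ N (g ∘ out) ≡ ∑ N (g ∘ src)
  merging-end {out} {b} {i} {iE} {j} {jE} M = done , λ g → +-cancelʳ-≡ (∑ iE (g ∘ src)) _ _
      (trans (sums g) (trans (cong₂ (λ a c → ∑ a (g ∘ src) + ∑ c (g ∘ src)) i≡ j≡) (+-comm (∑ iE (g ∘ src)) _)))
    where
    open Merging M
    i≡ : i ≡ iE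
    i≡ with m≤n⇒m<n∨m≡n i≤iE
    ... | inj₂ e = e
    ... | inj₁ l = contradiction jE≤N (<⇒≱ (k<jE (inj₁ l)))
    j≡ : j ≡ N
    j≡ = sym (+-cancelʳ-≡ iE N j (trans k≡ (trans (+-comm i j) (cong (j +_) i≡))))

-- The sorting program

pattern keyᵃ   = 0F
pattern jobᵃ   = 1F
pattern offᵃ   = 2F
pattern kindᵃ  = 3F
pattern key′ᵃ  = 4F
pattern job′ᵃ  = 5F
pattern off′ᵃ  = 6F
pattern kind′ᵃ = 7F

pattern nᵛ = 0
pattern mᵛ = 1
pattern σᵛ = 2
pattern Nᵛ = 3
pattern wᵛ = 4
pattern vᵛ = 5
pattern roundsᵛ = 6
pattern iᵛ = 7
pattern iEᵛ = 8
pattern jᵛ = 9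
pattern jEᵛ = 10
pattern kᵛ = 11
pattern cᵛ = 12

events events′ : Store → ℕ → Event
events  h x = event (arr h keyᵃ x) (arr h jobᵃ x) (arr h offᵃ x) (arr h kindᵃ x)
events′ h x = event (arr h key′ᵃ x) (arr h job′ᵃ x) (arr h off′ᵃ x) (arr h kind′ᵃ x)

event-cong : ∀ {a b c d a′ b′ c′ d′} → a ≡ a′ → b ≡ b′ → c ≡ c′ → d ≡ d′ → event a b c d ≡ event a′ b′ c′ d′
event-cong refl refl refl refl = refl

-- The minimum with `Nᵛ`, expressed by truncated subtraction.
clip : Exp → Exp
clip e = e ⊖ (e ⊖ var Nᵛ)

-- Bottom-up merge sort from runs of a given width `wᵛ`: 1 for the events of offset 0, the block
-- length for their shifted copies. Since `repeat` has no exit test, `countRounds` first finds the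
-- number of doublings.
refill choose emit mergePass copyBack mergeRound countRounds sort : Cmd
refill = ifNonzero ((var iEᵛ ⊖ var iᵛ) ⊕ (var jEᵛ ⊖ var jᵛ)) skip
  (iᵛ ≔ var jEᵛ ⨾ iEᵛ ≔ clip (var iᵛ ⊕ var wᵛ) ⨾ jᵛ ≔ var iEᵛ ⨾ jEᵛ ≔ clip (var jᵛ ⊕ var wᵛ))
choose =
  ifNonzero (var iEᵛ ⊖ var iᵛ)
    (ifNonzero (var jEᵛ ⊖ var jᵛ)
      (ifNonzero (keyᵃ ! var iᵛ ⊖ keyᵃ ! var jᵛ) takeRight takeLeft)
      takeLeft)
    takeRight
  where
  takeLeft takeRight : Cmd
  takeLeft  = cᵛ ≔ var iᵛ ⨾ iᵛ ≔ var iᵛ ⊕ lit 1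
  takeRight = cᵛ ≔ var jᵛ ⨾ jᵛ ≔ var jᵛ ⊕ lit 1
emit =
  key′ᵃ [ var kᵛ ]≔ keyᵃ ! var cᵛ ⨾ job′ᵃ [ var kᵛ ]≔ jobᵃ ! var cᵛ ⨾
  off′ᵃ [ var kᵛ ]≔ offᵃ ! var cᵛ ⨾ kind′ᵃ [ var kᵛ ]≔ kindᵃ ! var cᵛ ⨾ kᵛ ≔ var kᵛ ⊕ lit 1
mergePass = iᵛ ≔ lit 0 ⨾ iEᵛ ≔ lit 0 ⨾ jᵛ ≔ lit 0 ⨾ jEᵛ ≔ lit 0 ⨾ kᵛ ≔ lit 0 ⨾ repeat (var Nᵛ) (refill ⨾ choose ⨾ emit)
copyBack = kᵛ ≔ lit 0 ⨾ repeat (var Nᵛ)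
  (keyᵃ [ var kᵛ ]≔ key′ᵃ ! var kᵛ ⨾ jobᵃ [ var kᵛ ]≔ job′ᵃ ! var kᵛ ⨾
   offᵃ [ var kᵛ ]≔ off′ᵃ ! var kᵛ ⨾ kindᵃ [ var kᵛ ]≔ kind′ᵃ ! var kᵛ ⨾ kᵛ ≔ var kᵛ ⊕ lit 1)
mergeRound = mergePass ⨾ copyBack ⨾ wᵛ ≔ var wᵛ ⊕ var wᵛ
countRounds = vᵛ ≔ var wᵛ ⨾ roundsᵛ ≔ lit 0 ⨾ repeat (var Nᵛ)
  (ifNonzero (var Nᵛ ⊖ var vᵛ) (vᵛ ≔ var vᵛ ⊕ var vᵛ ⨾ roundsᵛ ≔ var roundsᵛ ⊕ lit 1) skip)
sort = countRounds ⨾ repeat (var roundsᵛ) mergeRound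

MergingAt : ℕ → ℕ → (ℕ → Event) → Store → ℕ → Set
MergingAt w N src h b = Merging w N src (events′ h) b (val h iᵛ) (val h iEᵛ) (val h jᵛ) (val h jEᵛ) (val h kᵛ)

merging-cong : ∀ {w N src out out′ b i iE j jE k i′ iE′ j′ jE′ k′} → out ≡ out′ →
  i ≡ i′ → iE ≡ iE′ → j ≡ j′ → jE ≡ jE′ → k ≡ k′ → Merging w N src out b i iE j jE k → Merging w N src out′ b i′ iE′ j′ jE′ k′
merging-cong refl refl refl refl refl refl M = M

Pending : Store → Set
Pending h = val h iᵛ < val h iEᵛ ⊎ val h jᵛ < val h jEᵛ

m∸[m∸n]≡m⊓n : ∀ m n → m ∸ (m ∸ n) ≡ m ⊓ n
m∸[m∸n]≡m⊓n m n with ≤-total m n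
... | inj₁ m≤n rewrite m≤n⇒m∸n≡0 m≤n = sym (m≤n⇒m⊓n≡m m≤n)
... | inj₂ n≤m = trans (m∸[m∸n]≡n n≤m) (sym (m≥n⇒m⊓n≡n n≤m))

m+[n∸m]≡m⊔n : ∀ m n → m + (n ∸ m) ≡ m ⊔ n
m+[n∸m]≡m⊔n m n with ≤-total m n
... | inj₁ m≤n = trans (m+[n∸m]≡n m≤n) (sym (m≤n⇒m⊔n≡n m≤n))
... | inj₂ n≤m = trans (cong (m +_) (m≤n⇒m∸n≡0 n≤m)) (trans (+-identityʳ m) (sym (m≥n⇒m⊔n≡m n≤m)))

refill-runs : ∀ {w N src h b} → val h wᵛ ≡ w → val h Nᵛ ≡ N → 1 ≤ w → val h kᵛ < N → RunSorted w N src →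
  MergingAt w N src h b → Runs refill 5 (λ h′ → ∃[ b′ ] MergingAt w N src h′ b′ × Pending h′) h
refill-runs {w} {N} {src} {h} {b} refl refl w≥1 k<N runs M = runs-if
  (λ ne → s≤s z≤n ▹ b , M , pending ne)
  (λ z → let M′ , lt = merging-refill _ _ w≥1 k<N runs
                 (≤-antisym i≤iE (m∸n≡0⇒m≤n (m+n≡0⇒m≡0 _ z)))
                 (≤-antisym j≤jE (m∸n≡0⇒m≤n (m+n≡0⇒n≡0 (val h iEᵛ ∸ val h iᵛ) z)))
                 (m∸[m∸n]≡m⊓n (val h jEᵛ + val h wᵛ) (val h Nᵛ))
                 (m∸[m∸n]≡m⊓n _ (val h Nᵛ)) M
         in ≤-refl ▹ suc b , M′ , inj₁ lt)
  where
  open Merging M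
  pending : (val h iEᵛ ∸ val h iᵛ) + (val h jEᵛ ∸ val h jᵛ) ≢ 0 → Pending h
  pending ne with val h iᵛ <? val h iEᵛ | val h jᵛ <? val h jEᵛ
  ... | yes l | _ = inj₁ l
  ... | no _  | yes l = inj₂ l
  ... | no a  | no c = contradiction (cong₂ _+_ (m≤n⇒m∸n≡0 (≮⇒≥ a)) (m≤n⇒m∸n≡0 (≮⇒≥ c))) ne

data Chosen (h h′ : Store) : Set where
  left  : val h′ cᵛ ≡ val h iᵛ → val h′ iᵛ ≡ suc (val h iᵛ) → val h′ jᵛ ≡ val h jᵛ → val h iᵛ < val h iEᵛ →
    (val h jᵛ < val h jEᵛ → key (events h (val h iᵛ)) ≤ key (events h (val h jᵛ))) → Chosen h h′
  right : val h′ cᵛ ≡ val h jᵛ → val h′ jᵛ ≡ suc (val h jᵛ) → val h′ iᵛ ≡ val h iᵛ → val h jᵛ < val h jEᵛ →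
    (val h iᵛ < val h iEᵛ → key (events h (val h jᵛ)) ≤ key (events h (val h iᵛ))) → Chosen h h′

∸≢0⇒< : ∀ {a b} → a ∸ b ≢ 0 → b < a
∸≢0⇒< {a} {b} ne with b <? a
... | yes l = l
... | no nl = contradiction (m≤n⇒m∸n≡0 (≮⇒≥ nl)) ne

<⇒∸≢0 : ∀ {a b} → b < a → a ∸ b ≢ 0
<⇒∸≢0 b<a z = <⇒≱ b<a (m∸n≡0⇒m≤n z)

choose-runs : ∀ {h} → Pending h → Runs choose 5 (Chosen h) h
choose-runs {h} pending = runs-if
  (λ ni → runs-if
    (λ nj → runs-if
      (λ nk → ≤-refl ▹ right refl (+-comm _ 1) refl (∸≢0⇒< nj) (λ _ → <⇒≤ (∸≢0⇒< nk)))
      (λ zk → ≤-refl ▹ left refl (+-comm _ 1) refl (∸≢0⇒< ni) (λ _ → m∸n≡0⇒m≤n zk)))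
    (λ zj → n≤1+n 2 ▹ left refl (+-comm _ 1) refl (∸≢0⇒< ni) (λ l → contradiction zj (<⇒∸≢0 l))))
  (λ zi → s≤s (s≤s z≤n) ▹ right refl (+-comm _ 1) refl
    ([ (λ l → contradiction zi (<⇒∸≢0 l)) , (λ l → l) ]′ pending) (λ l → contradiction zi (<⇒∸≢0 l)))

emit-runs : ∀ h → Runs emit 5 (λ h′ → val h′ kᵛ ≡ suc (val h kᵛ) × events′ h′ (val h kᵛ) ≡ events h (val h cᵛ) ×
  (∀ x → x < val h kᵛ → events′ h′ x ≡ events′ h x)) h
emit-runs h = ≤-refl ▹ +-comm _ 1 ,
  event-cong (update-same (arr h key′ᵃ) k _ refl) (update-same (arr h job′ᵃ) k _ refl)
             (update-same (arr h off′ᵃ) k _ refl) (update-same (arr h kind′ᵃ) k _ refl) ,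
  λ x x<k → let ne = <⇒≢ x<k in
    event-cong (update-other (arr h key′ᵃ) k _ ne) (update-other (arr h job′ᵃ) k _ ne)
               (update-other (arr h off′ᵃ) k _ ne) (update-other (arr h kind′ᵃ) k _ ne)
  where k = val h kᵛ

events-agree : ∀ {P h h′} → Agree P h h′ → written P keyᵃ ≡ false → written P jobᵃ ≡ false → written P offᵃ ≡ false →
  written P kindᵃ ≡ false → ∀ x → events h′ x ≡ events h x
events-agree ag a b c d x = event-cong (arr≡ ag keyᵃ a x) (arr≡ ag jobᵃ b x) (arr≡ ag offᵃ c x) (arr≡ ag kindᵃ d x)

RunSorted-cong : ∀ {w N ev ev′} → (∀ x → x < N → ev′ x ≡ ev x) → RunSorted w N ev → RunSorted w N ev′
RunSorted-cong same runs c x c≤x sx< sx<N rewrite same x (<-trans ≤-refl sx<N) | same (suc x) sx<N = runs c x c≤x sx< sx<N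

mergePass-runs : ∀ {h} → 1 ≤ val h wᵛ → RunSorted (val h wᵛ) (val h Nᵛ) (events h) →
  Runs mergePass (6 + val h Nᵛ * 16) (λ h′ → RunSorted (val h wᵛ + val h wᵛ) (val h Nᵛ) (events′ h′) ×
    (∀ g → ∑ (val h Nᵛ) (g ∘ events′ h′) ≡ ∑ (val h Nᵛ) (g ∘ events h))) h
mergePass-runs {h} w≥1 runs = runs-exec ≤-refl (runs-exec ≤-refl (runs-exec ≤-refl (runs-exec ≤-refl (runs-exec ≤-refl
  (runs-map ≤-refl (λ { h′ _ ((b , M) , k≡) → merging-end (merging-cong refl refl refl refl refl k≡ M) })
    (runs-repeat Inv {h = h₀} refl ((0 , merging-start) , refl) step))))))
  where
  w = val h wᵛ
  N = val h Nᵛ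
  h₀ : Store
  h₀ = exec (iᵛ ≔ lit 0 ⨾ iEᵛ ≔ lit 0 ⨾ jᵛ ≔ lit 0 ⨾ jEᵛ ≔ lit 0 ⨾ kᵛ ≔ lit 0) h
  Inv : ℕ → Store → Set
  Inv k h′ = (∃[ b ] MergingAt w N (events h) h′ b) × val h′ kᵛ ≡ k
  step : ∀ k h′ → k < N → Agree (refill ⨾ choose ⨾ emit) h₀ h′ → Inv k h′ → Runs (refill ⨾ choose ⨾ emit) 15 (Inv (suc k)) h′
  step k h′ k<N ag ((b , M) , k≡) =
    runs-⨾ (refill-runs {w} {N} {events h} {h′} {b} (val≡ ag wᵛ refl) (val≡ ag Nᵛ refl) w≥1 (subst (_< N) (sym k≡) k<N) runs M)
      λ h₁ ag₁ (b₁ , M₁ , pending) → runs-⨾ (choose-runs pending)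
      λ h₂ ag₂ chosen → runs-map ≤-refl (λ h₃ ag₃ (k₃≡ , new , same) →
        let k₂≡ : val h₂ kᵛ ≡ val h₁ kᵛ
            k₂≡ = val≡ ag₂ kᵛ refl
            src₁ : ∀ x → events h₁ x ≡ events h x
            src₁ x = trans (events-agree ag₁ refl refl refl refl x) (events-agree ag refl refl refl refl x)
            src₂ : ∀ x → events h₂ x ≡ events h x
            src₂ x = trans (events-agree ag₂ refl refl refl refl x) (src₁ x)
            out₂ : ∀ x → events′ h₂ x ≡ events′ h₁ x
            out₂ x = event-cong (arr≡ ag₂ key′ᵃ refl x) (arr≡ ag₂ job′ᵃ refl x) (arr≡ ag₂ off′ᵃ refl x) (arr≡ ag₂ kind′ᵃ refl x)
            same₁ : ∀ x → x < val h₁ kᵛ → events′ h₃ x ≡ events′ h₁ x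
            same₁ x x<k = trans (same x (subst (x <_) (sym k₂≡) x<k)) (out₂ x)
            new₁ : ∀ y → val h₂ cᵛ ≡ y → events′ h₃ (val h₁ kᵛ) ≡ events h y
            new₁ y c≡ = trans (cong (events′ h₃) (sym k₂≡)) (trans new (trans (src₂ _) (cong (events h) c≡)))
            iE₃ = trans (val≡ ag₃ iEᵛ refl) (val≡ ag₂ iEᵛ refl)
            jE₃ = trans (val≡ ag₃ jEᵛ refl) (val≡ ag₂ jEᵛ refl)
            k₁≡ = trans (val≡ ag₁ kᵛ refl) k≡
            key₁ : ∀ {x y} → key (events h₁ x) ≤ key (events h₁ y) → key (events h x) ≤ key (events h y)
            key₁ {x} {y} = subst₂ (λ a c → key a ≤ key c) (src₁ x) (src₁ y)
        in (b₁ , finish h₁ h₂ h₃ {b₁} M₁ chosen key₁ new₁ same₁ (val≡ ag₃ iᵛ refl) iE₃ (val≡ ag₃ jᵛ refl) jE₃ (trans k₃≡ (cong suc k₂≡)))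
           , trans k₃≡ (cong suc (trans k₂≡ k₁≡))) (emit-runs h₂)
    where
    finish : ∀ h₁ h₂ h₃ {b₁} → MergingAt w N (events h) h₁ b₁ → Chosen h₁ h₂ →
      (∀ {x y} → key (events h₁ x) ≤ key (events h₁ y) → key (events h x) ≤ key (events h y)) →
      (∀ y → val h₂ cᵛ ≡ y → events′ h₃ (val h₁ kᵛ) ≡ events h y) → (∀ x → x < val h₁ kᵛ → events′ h₃ x ≡ events′ h₁ x) →
      val h₃ iᵛ ≡ val h₂ iᵛ → val h₃ iEᵛ ≡ val h₁ iEᵛ → val h₃ jᵛ ≡ val h₂ jᵛ → val h₃ jEᵛ ≡ val h₁ jEᵛ → val h₃ kᵛ ≡ suc (val h₁ kᵛ) →
      MergingAt w N (events h) h₃ b₁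
    finish h₁ h₂ h₃ M₁ (left c≡ i≡ j≡ lt cond) key₁ new same i₃ iE₃ j₃ jE₃ k₃ =
      merging-cong refl (sym (trans i₃ i≡)) (sym iE₃) (sym (trans j₃ j≡)) (sym jE₃) (sym k₃)
        (merging-left lt (λ l → key₁ (cond l)) (new _ c≡) same M₁)
    finish h₁ h₂ h₃ M₁ (right c≡ j≡ i≡ lt cond) key₁ new same i₃ iE₃ j₃ jE₃ k₃ =
      merging-cong refl (sym (trans i₃ i≡)) (sym iE₃) (sym (trans j₃ j≡)) (sym jE₃) (sym k₃)
        (merging-right lt (λ l → key₁ (cond l)) (new _ c≡) same M₁)

copyBack-runs : ∀ {h N} → val h Nᵛ ≡ N → Runs copyBack (2 + N * 6) (λ h′ → ∀ x → x < N → events h′ x ≡ events′ h x) h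
copyBack-runs {h} refl = runs-exec ≤-refl (runs-map ≤-refl (λ h′ _ → proj₂) (runs-repeat Inv {h = h₀} refl (refl , λ _ ()) step))
  where
  h₀ : Store
  h₀ = exec (kᵛ ≔ lit 0) h
  Inv : ℕ → Store → Set
  Inv k h′ = val h′ kᵛ ≡ k × ∀ x → x < k → events h′ x ≡ events′ h x
  step : ∀ k h′ → k < val h Nᵛ → Agree _ h₀ h′ → Inv k h′ → Runs _ 5 (Inv (suc k)) h′
  step k h′ k<N ag (refl , copied) = ≤-refl ▹ +-comm _ 1 , λ x x<sk → case m≤n⇒m<n∨m≡n (≤-pred x<sk) of λ
    { (inj₁ x<k) → let ne = <⇒≢ x<k in trans
        (event-cong (update-other (arr h′ keyᵃ) k _ ne) (update-other (arr h′ jobᵃ) k _ ne)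
                    (update-other (arr h′ offᵃ) k _ ne) (update-other (arr h′ kindᵃ) k _ ne)) (copied x x<k)
    ; (inj₂ refl) → trans
        (event-cong (update-same (arr h′ keyᵃ) k _ refl) (update-same (arr h′ jobᵃ) k _ refl)
                    (update-same (arr h′ offᵃ) k _ refl) (update-same (arr h′ kindᵃ) k _ refl))
        (event-cong (arr≡ ag key′ᵃ refl x) (arr≡ ag job′ᵃ refl x) (arr≡ ag off′ᵃ refl x) (arr≡ ag kind′ᵃ refl x)) }

mergeRound-runs : ∀ {h w N} → val h wᵛ ≡ w → val h Nᵛ ≡ N → 1 ≤ w → RunSorted w N (events h) →
  Runs mergeRound (9 + N * 22) (λ h′ → val h′ wᵛ ≡ w + w × RunSorted (w + w) N (events h′) ×
    (∀ g → ∑ N (g ∘ events h′) ≡ ∑ N (g ∘ events h))) h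
mergeRound-runs {h} {w} {N} refl refl w≥1 runs = runs-map (≤-reflexive (lemma N)) (λ h′ _ q → q)
  (runs-⨾ (mergePass-runs {h} w≥1 runs) λ h₁ ag₁ (sorted , sums) →
   runs-⨾ (copyBack-runs {h₁} (val≡ ag₁ Nᵛ refl)) λ h₂ ag₂ copied →
   ≤-refl ▹ cong₂ _+_ (w≡ ag₁ ag₂) (w≡ ag₁ ag₂) , RunSorted-cong copied sorted ,
            λ g → trans (∑-cong N λ x x<N → cong g (copied x x<N)) (sums g))
  where
  w≡ : ∀ {h₁ h₂} → Agree mergePass h h₁ → Agree copyBack h₁ h₂ → val h₂ wᵛ ≡ val h wᵛ
  w≡ ag₁ ag₂ = trans (val≡ ag₂ wᵛ refl) (val≡ ag₁ wᵛ refl)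
  lemma : ∀ N → 6 + N * 16 + (2 + N * 6 + 1) ≡ 9 + N * 22
  lemma = solve-∀

countRounds-runs : ∀ {h w N} → val h wᵛ ≡ w → val h Nᵛ ≡ N → 1 ≤ w →
  Runs countRounds (3 + N * 4) (λ h′ → N ≤ w * 2 ^ val h′ roundsᵛ × ∀ R → N ≤ w * 2 ^ R → val h′ roundsᵛ ≤ R) h
countRounds-runs {h} {w} {N} refl refl w≥1 = runs-exec ≤-refl (runs-exec ≤-refl
  (runs-map ≤-refl (λ { h′ _ (v≡ , big , least) → [ subst (N ≤_) v≡ , (λ N<v → subst (N ≤_) v≡ (<⇒≤ N<v)) ]′ big , least })
    (runs-repeat Inv {h = h₀} refl (sym (*-identityʳ w) , inj₂ w≥1 , λ _ _ → z≤n) step)))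
  where
  h₀ : Store
  h₀ = exec (vᵛ ≔ var wᵛ ⨾ roundsᵛ ≔ lit 0) h
  Inv : ℕ → Store → Set
  -- After `i` iterations `vᵛ` has reached `N` or exceeds `i`, so `N` iterations suffice.
  Inv i h′ = val h′ vᵛ ≡ w * 2 ^ val h′ roundsᵛ × (N ≤ val h′ vᵛ ⊎ i < val h′ vᵛ) × ∀ R → N ≤ w * 2 ^ R → val h′ roundsᵛ ≤ R
  step : ∀ i h′ → i < N → Agree _ h₀ h′ → Inv i h′ → Runs _ 3 (Inv (suc i)) h′
  step i h′ i<N ag (v≡ , big , least) = runs-if
    (λ ne → let v<N = subst (v <_) (val≡ ag Nᵛ refl) (∸≢0⇒< ne) in
      ≤-refl ▹ trans (cong₂ _+_ v≡ v≡) (trans (doubling w (2 ^ r)) (cong (λ r → w * 2 ^ r) (+-comm 1 r)))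
      , inj₂ ([ (λ N≤v → contradiction v<N (≤⇒≯ N≤v)) , (λ i<v → +-mono-≤ (≤-trans (s≤s z≤n) i<v) i<v) ]′ big)
      , λ R N≤ → subst (_≤ R) (+-comm 1 r) (smaller R v<N N≤))
    (λ z → s≤s z≤n ▹ v≡ , inj₁ (subst (_≤ v) (val≡ ag Nᵛ refl) (m∸n≡0⇒m≤n z)) , least)
    where
    v = val h′ vᵛ
    r = val h′ roundsᵛ
    doubling : ∀ w p → w * p + w * p ≡ w * (p + (p + 0))
    doubling = solve-∀
    smaller : ∀ R → v < N → N ≤ w * 2 ^ R → suc r ≤ R
    smaller R v<N N≤ with suc r ≤? R
    ... | yes l = l
    ... | no nl = contradiction (≤-trans N≤ (≤-trans (*-monoʳ-≤ w (^-monoʳ-≤ 2 (≤-pred (≰⇒> nl)))) (≤-reflexive (sym v≡)))) (<⇒≱ v<N)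

-- `countRounds` finds the least number of rounds, so any sufficient `R` bounds the cost: about log
-- `n` for the first sort, only `s` for the second.
sort-runs : ∀ {h w N} R → val h wᵛ ≡ w → val h Nᵛ ≡ N → 1 ≤ w → RunSorted w N (events h) → N ≤ w * 2 ^ R →
  Runs sort (4 + N * 4 + R * (10 + N * 22)) (λ h′ → (∀ x → suc x < N → key (events h′ x) ≤ key (events h′ (suc x))) ×
    (∀ g → ∑ N (g ∘ events h′) ≡ ∑ N (g ∘ events h))) h
sort-runs {h} {w} {N} R refl refl w≥1 runs N≤ = runs-map (≤-reflexive (+-suc (3 + N * 4) _)) (λ h′ _ q → q)
  (runs-⨾ (countRounds-runs {h} refl refl w≥1) λ h₁ ag₁ (enough , least) →
   runs-map (s≤s (*-monoˡ-≤ (10 + N * 22) (least R N≤)))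
     (λ h₂ _ (w≡ , sorted , sums) → (λ x sx<N → sorted 0 x z≤n (subst (suc x <_) (sym (+-identityʳ _)) (<-≤-trans sx<N enough)) sx<N) , sums)
     (runs-repeat Inv {h = h₁} refl
       (trans (val≡ ag₁ wᵛ refl) (sym (*-identityʳ w))
       , subst (λ w → RunSorted w N (events h₁)) (sym (*-identityʳ w)) (RunSorted-cong (λ x _ → events-agree ag₁ refl refl refl refl x) runs)
       , λ g → ∑-cong N λ x _ → cong g (events-agree ag₁ refl refl refl refl x))
       λ i h′ _ ag (w≡ , sorted , sums) → runs-map ≤-refl
         (λ h″ _ (w≡′ , sorted′ , sums′) → trans w≡′ (doubling w (2 ^ i)) , subst (λ w → RunSorted w N (events h″)) (doubling w (2 ^ i)) sorted′
                                          , λ g → trans (sums′ g) (sums g))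
         (mergeRound-runs {h′} w≡ (trans (val≡ ag Nᵛ refl) (val≡ ag₁ Nᵛ refl)) (*-mono-≤ w≥1 (m^n>0 2 i)) sorted)))
  where
  Inv : ℕ → Store → Set
  Inv i h′ = val h′ wᵛ ≡ w * 2 ^ i × RunSorted (w * 2 ^ i) N (events h′) × (∀ g → ∑ N (g ∘ events h′) ≡ ∑ N (g ∘ events h))
  doubling : ∀ w p → w * p + w * p ≡ w * (p + (p + 0))
  doubling = solve-∀

-- Generating the events

pattern badᵛ = 13
pattern aᵛ = 14
pattern tᵛ = 15
pattern dᵛ = 16
pattern pᵛ = 17
pattern qᵛ = 18
pattern countᵛ = 19
pattern slackᵃ = 8F

-- Jobs of processing time 0 occupy no machine and produce no events.
pushEvent : Exp → ℕ → Cmd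
pushEvent e κ = keyᵃ [ var Nᵛ ]≔ e ⨾ jobᵃ [ var Nᵛ ]≔ var qᵛ ⨾ offᵃ [ var Nᵛ ]≔ lit 0 ⨾ kindᵃ [ var Nᵛ ]≔ lit κ ⨾
  Nᵛ ≔ var Nᵛ ⊕ lit 1

-- `replicate` copies cell `k` to cell `k + N` with the key raised by 2 and the offset by 1. It
-- reads its own output, so block `o` yields block `suc o`. The width left for the next sort is the
-- maximum of `N` and 1, as doubling needs a positive start.
readJob checkJob pushJob collectJob collect replicate order : Cmd
readJob = tᵛ ≔input var aᵛ ⨾ dᵛ ≔input (var aᵛ ⊕ lit 1) ⨾ pᵛ ≔input (var aᵛ ⊕ lit 2) ⨾
  slackᵃ [ var qᵛ ]≔ var dᵛ ⊖ (var tᵛ ⊕ var pᵛ) ⨾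
  σᵛ ≔ var σᵛ ⊕ ((var dᵛ ⊖ (var tᵛ ⊕ var pᵛ)) ⊖ var σᵛ) ⨾ aᵛ ≔ lit 3 ⊕ var aᵛ
checkJob = ifNonzero ((var tᵛ ⊕ var pᵛ) ⊖ var dᵛ) (badᵛ ≔ lit 1) skip
pushJob = ifNonzero (var pᵛ)
  (pushEvent (var tᵛ ⊕ var tᵛ ⊕ lit 1) 1 ⨾ pushEvent ((var tᵛ ⊕ var pᵛ) ⊕ (var tᵛ ⊕ var pᵛ)) 0) skip
collectJob = readJob ⨾ checkJob ⨾ pushJob ⨾ qᵛ ≔ var qᵛ ⊕ lit 1
collect = aᵛ ≔ lit 0 ⨾ qᵛ ≔ lit 0 ⨾ Nᵛ ≔ lit 0 ⨾ σᵛ ≔ lit 0 ⨾ badᵛ ≔ lit 0 ⨾ repeat (var nᵛ) collectJob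
replicate = countᵛ ≔ lit 0 ⨾ repeat (var σᵛ) (countᵛ ≔ var countᵛ ⊕ var Nᵛ) ⨾ kᵛ ≔ lit 0 ⨾
  repeat (var countᵛ)
    (keyᵃ [ var kᵛ ⊕ var Nᵛ ]≔ lit 2 ⊕ keyᵃ ! var kᵛ ⨾ jobᵃ [ var kᵛ ⊕ var Nᵛ ]≔ jobᵃ ! var kᵛ ⨾
     offᵃ [ var kᵛ ⊕ var Nᵛ ]≔ lit 1 ⊕ offᵃ ! var kᵛ ⨾ kindᵃ [ var kᵛ ⊕ var Nᵛ ]≔ kindᵃ ! var kᵛ ⨾ kᵛ ≔ var kᵛ ⊕ lit 1) ⨾
  wᵛ ≔ var Nᵛ ⊕ (lit 1 ⊖ var Nᵛ) ⨾ Nᵛ ≔ var countᵛ ⊕ var Nᵛ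
order = wᵛ ≔ lit 1 ⨾ sort ⨾ replicate ⨾ sort

jobsIn : (ℕ → ℕ) → ℕ → Jobs
jobsIn input n = record
  { number = n ; rel = λ j → input (j * 3) ; dead = λ j → input (j * 3 + 1) ; proc = λ j → input (j * 3 + 2) }

baseSum : Jobs → ℕ → (Event → ℕ) → ℕ
baseSum X n g = ∑ n λ j → ind (0 <? proc X j) * (g (startOf X j 0) + g (endOf X j 0))

pushEvent-runs : ∀ {h} e κ → Runs (pushEvent e κ) 5 (λ h′ → val h′ Nᵛ ≡ suc (val h Nᵛ) ×
  ∀ g → ∑ (val h′ Nᵛ) (g ∘ events h′) ≡ ∑ (val h Nᵛ) (g ∘ events h) + g (event (eval e h) (val h qᵛ) 0 κ)) h
pushEvent-runs {h} e κ = ≤-refl ▹ N≡ , λ g → trans (cong (λ N → ∑ N (g ∘ events h′)) N≡)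
    (cong₂ _+_ (∑-cong N λ x x<N → let ne = <⇒≢ x<N in cong g
        (event-cong (update-other (arr h keyᵃ) N _ ne) (update-other (arr h jobᵃ) N _ ne)
                    (update-other (arr h offᵃ) N _ ne) (update-other (arr h kindᵃ) N _ ne)))
      (cong g (event-cong (update-same (arr h keyᵃ) N _ refl) (update-same (arr h jobᵃ) N _ refl)
                          (update-same (arr h offᵃ) N _ refl) (update-same (arr h kindᵃ) N _ refl))))
  where
  N = val h Nᵛ
  h′ = exec (pushEvent e κ) h
  N≡ : N + 1 ≡ suc N
  N≡ = +-comm N 1

-- By `least`, the recorded slack is at most every `σ` for which the instance has slack `σ`. This
-- brings `σ` into the time bound although the program never sees it.
record Collected (X : Jobs) (j : ℕ) (h : Store) : Set where
  field
    q≡       : val h qᵛ ≡ j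
    a≡       : val h aᵛ ≡ j * 3
    bad⇒     : val h badᵛ ≡ 0 → ∀ i → i < j → rel X i + proc X i ≤ dead X i
    ⇒bad     : (∀ i → i < j → rel X i + proc X i ≤ dead X i) → val h badᵛ ≡ 0
    slack≡   : ∀ i → i < j → arr h slackᵃ i ≡ slack X i
    slack≤   : ∀ i → i < j → slack X i ≤ val h σᵛ
    least    : ∀ s → (∀ i → i < j → slack X i ≤ s) → val h σᵛ ≤ s
    N≤       : val h Nᵛ ≤ j + j
    base     : ∀ g → ∑ (val h Nᵛ) (g ∘ events h) ≡ baseSum X j g

collectJob-runs : ∀ {X j h} → rel X j ≡ inp h (j * 3) → dead X j ≡ inp h (j * 3 + 1) → proc X j ≡ inp h (j * 3 + 2) →
  Collected X j h → Runs collectJob 20 (Collected X (suc j)) h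
collectJob-runs {X} {j} {h} rel≡ dead≡ proc≡ C = runs-exec {k = 6} ≤-refl
  (runs-⨾ {Mid = Checked} check λ h₂ ag₂ checked → runs-⨾ {Mid = Pushed h₂} (push h₂ ag₂) λ h₃ ag₃ pushed → ≤-refl ▹ finish h₂ h₃ ag₂ ag₃ checked pushed)
  where
  open Collected C
  h₁ : Store
  h₁ = exec readJob h
  t₁ : val h₁ tᵛ ≡ rel X j
  t₁ = trans (cong (inp h) a≡) (sym rel≡)
  d₁ : val h₁ dᵛ ≡ dead X j
  d₁ = trans (cong (λ a → inp h (a + 1)) a≡) (sym dead≡)
  p₁ : val h₁ pᵛ ≡ proc X j
  p₁ = trans (cong (λ a → inp h (a + 2)) a≡) (sym proc≡)
  slack₁ : val h₁ dᵛ ∸ (val h₁ tᵛ + val h₁ pᵛ) ≡ slack X j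
  slack₁ = cong₂ _∸_ d₁ (cong₂ _+_ t₁ p₁)
  σ₁ : val h₁ σᵛ ≡ val h σᵛ ⊔ slack X j
  σ₁ = trans (m+[n∸m]≡m⊔n (val h σᵛ) _) (cong (val h σᵛ ⊔_) slack₁)

  Checked : Store → Set
  Checked h₂ = (val h₂ badᵛ ≡ 0 → val h badᵛ ≡ 0 × rel X j + proc X j ≤ dead X j) ×
               (val h badᵛ ≡ 0 → rel X j + proc X j ≤ dead X j → val h₂ badᵛ ≡ 0)
  check : Runs checkJob 2 Checked h₁
  check = runs-if
    (λ ne → ≤-refl ▹ (λ ()) , λ _ ok → contradiction (m≤n⇒m∸n≡0 (subst₂ _≤_ (sym (cong₂ _+_ t₁ p₁)) (sym d₁) ok)) ne)
    (λ z → ≤-refl ▹ (λ b → b , subst₂ _≤_ (cong₂ _+_ t₁ p₁) d₁ (m∸n≡0⇒m≤n z)) , λ b _ → b)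

  Pushed : Store → Store → Set
  Pushed h₂ h₃ = val h₃ Nᵛ ≤ suc (suc (val h₂ Nᵛ)) × ∀ g → ∑ (val h₃ Nᵛ) (g ∘ events h₃) ≡
    ∑ (val h₂ Nᵛ) (g ∘ events h₂) + ind (0 <? proc X j) * (g (startOf X j 0) + g (endOf X j 0))
  push : ∀ h₂ → Agree checkJob h₁ h₂ → Runs pushJob 11 (Pushed h₂) h₂
  push h₂ ag = runs-if
    (λ ne → runs-⨾ (pushEvent-runs {h₂} (var tᵛ ⊕ var tᵛ ⊕ lit 1) 1) λ h₃ ag₃ (N₃ , sum₃) →
      runs-map ≤-refl (λ h₄ ag₄ (N₄ , sum₄) → ≤-reflexive (trans N₄ (cong suc N₃)) , λ g → begin
        ∑ (val h₄ Nᵛ) (g ∘ events h₄)   ≡⟨ trans (sum₄ g) (cong₂ _+_ (sum₃ g) refl) ⟩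
        ∑ (val h₂ Nᵛ) (g ∘ events h₂) + g (event (val h₂ tᵛ + val h₂ tᵛ + 1) (val h₂ qᵛ) 0 1)
          + g (event (val h₃ tᵛ + val h₃ pᵛ + (val h₃ tᵛ + val h₃ pᵛ)) (val h₃ qᵛ) 0 0)
          ≡⟨ cong₂ (λ a b → ∑ (val h₂ Nᵛ) (g ∘ events h₂) + g a + g b)
               (event-cong (trans (cong (λ t → t + t + 1) t₂) (startKey (rel X j))) q₂ refl refl)
               (event-cong (trans (cong₂ (λ t p → t + p + (t + p)) (trans (val≡ ag₃ tᵛ refl) t₂) (trans (val≡ ag₃ pᵛ refl) p₂))
                  (endKey (rel X j + proc X j))) (trans (val≡ ag₃ qᵛ refl) q₂) refl refl) ⟩
        ∑ (val h₂ Nᵛ) (g ∘ events h₂) + g (startOf X j 0) + g (endOf X j 0) ≡⟨ +-assoc (∑ (val h₂ Nᵛ) (g ∘ events h₂)) _ _ ⟩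
        ∑ (val h₂ Nᵛ) (g ∘ events h₂) + (g (startOf X j 0) + g (endOf X j 0)) ≡⟨ cong (∑ (val h₂ Nᵛ) (g ∘ events h₂) +_)
               (trans (sym (*-identityˡ _)) (cong (_* (g (startOf X j 0) + g (endOf X j 0))) (sym (ind-yes (0 <? proc X j) (subst (0 <_) p₂ (n≢0⇒n>0 ne)))))) ⟩
        ∑ (val h₂ Nᵛ) (g ∘ events h₂) + ind (0 <? proc X j) * (g (startOf X j 0) + g (endOf X j 0)) ∎)
        (pushEvent-runs {h₃} ((var tᵛ ⊕ var pᵛ) ⊕ (var tᵛ ⊕ var pᵛ)) 0))
    (λ z → s≤s z≤n ▹ m≤n+m _ 2 , λ g → sym (trans (cong (∑ (val h₂ Nᵛ) (g ∘ events h₂) +_)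
        (ind-*-zero (0 <? proc X j) (λ p → contradiction (trans (sym p₂) z) (>⇒≢ p)))) (+-identityʳ _)))
    where
    open ≡-Reasoning
    t₂ : val h₂ tᵛ ≡ rel X j
    t₂ = trans (val≡ ag tᵛ refl) t₁
    p₂ : val h₂ pᵛ ≡ proc X j
    p₂ = trans (val≡ ag pᵛ refl) p₁
    q₂ : val h₂ qᵛ ≡ j
    q₂ = trans (val≡ ag qᵛ refl) q≡
    startKey : ∀ r → r + r + 1 ≡ suc (r + 0 + (r + 0))
    startKey = solve-∀
    endKey : ∀ r → r + r ≡ r + 0 + (r + 0)
    endKey = solve-∀

  extend : ∀ {P : ℕ → Set} → (∀ i → i < j → P i) → P j → ∀ i → i < suc j → P i
  extend old new i i<sj with m≤n⇒m<n∨m≡n (≤-pred i<sj)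
  ... | inj₁ i<j = old i i<j
  ... | inj₂ refl = new

  finish : ∀ h₂ h₃ → Agree checkJob h₁ h₂ → Agree pushJob h₂ h₃ → Checked h₂ → Pushed h₂ h₃ →
    Collected X (suc j) (exec (qᵛ ≔ var qᵛ ⊕ lit 1) h₃)
  finish h₂ h₃ ag₂ ag₃ (bad₂ , good₂) (N₃ , sum₃) = record
    { q≡ = trans (+-comm _ 1) (cong suc (trans (v qᵛ refl refl) q≡))
    ; a≡ = trans (v aᵛ refl refl) (cong (3 +_) a≡)
    ; bad⇒ = λ z → let b , ok = bad₂ (trans (sym b₃) z) in extend (bad⇒ b) ok
    ; ⇒bad = λ ok → trans b₃ (good₂ (⇒bad λ i i<j → ok i (m<n⇒m<1+n i<j)) (ok j ≤-refl))
    ; slack≡ = λ i i<sj → trans (slacks i) (extend {λ i → arr h₁ slackᵃ i ≡ slack X i}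
        (λ i i<j → trans (update-other (arr h slackᵃ) (val h qᵛ) _ (λ e → <⇒≢ i<j (trans e q≡))) (slack≡ i i<j))
        (trans (update-same (arr h slackᵃ) (val h qᵛ) _ (sym q≡)) slack₁) i i<sj)
    ; slack≤ = extend (λ i i<j → ≤-trans (slack≤ i i<j) (≤-trans (m≤m⊔n _ (slack X j)) (≤-reflexive (sym σ₃))))
        (≤-trans (m≤n⊔m (val h σᵛ) (slack X j)) (≤-reflexive (sym σ₃)))
    ; least = λ s all → subst (_≤ s) (sym σ₃) (⊔-lub (least s λ i i<j → all i (m<n⇒m<1+n i<j)) (all j ≤-refl))
    ; N≤ = ≤-trans N₃ (s≤s (≤-trans (s≤s (≤-trans (≤-reflexive (val≡ ag₂ Nᵛ refl)) N≤)) (≤-reflexive (sym (+-suc j j)))))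
    ; base = λ g → trans (sum₃ g) (cong (_+ ind (0 <? proc X j) * (g (startOf X j 0) + g (endOf X j 0)))
        (trans (trans (cong (λ N → ∑ N (g ∘ events h₂)) (val≡ ag₂ Nᵛ refl)) (∑-cong (val h Nᵛ) λ x _ → cong g (events-agree ag₂ refl refl refl refl x))) (base g))) }
    where
    v : ∀ u → assigned checkJob u ≡ false → assigned pushJob u ≡ false → val h₃ u ≡ val h₁ u
    v u a b = trans (val≡ ag₃ u b) (val≡ ag₂ u a)
    b₃ : val h₃ badᵛ ≡ val h₂ badᵛ
    b₃ = val≡ ag₃ badᵛ refl
    σ₃ : val h₃ σᵛ ≡ val h σᵛ ⊔ slack X j
    σ₃ = trans (v σᵛ refl refl) σ₁
    slacks : ∀ i → arr h₃ slackᵃ i ≡ arr h₁ slackᵃ i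
    slacks i = trans (arr≡ ag₃ slackᵃ refl i) (arr≡ ag₂ slackᵃ refl i)

collect-runs : ∀ {h n} → val h nᵛ ≡ n → Runs collect (6 + n * 21) (Collected (jobsIn (inp h) n) n) h
collect-runs {h} {n} refl = runs-exec ≤-refl (runs-exec ≤-refl (runs-exec ≤-refl (runs-exec ≤-refl (runs-exec ≤-refl
  (runs-repeat (Collected X) {h = h₀} refl
    (record { q≡ = refl ; a≡ = refl ; bad⇒ = λ _ _ () ; ⇒bad = λ _ → refl ; slack≡ = λ _ () ; slack≤ = λ _ () ; least = λ _ _ → z≤n
            ; N≤ = z≤n ; base = λ _ → refl })
    λ j h′ _ ag → collectJob-runs {X} {j} {h′} (sym (cong (λ f → f (j * 3)) (inp≡ ag))) (sym (cong (λ f → f (j * 3 + 1)) (inp≡ ag)))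
      (sym (cong (λ f → f (j * 3 + 2)) (inp≡ ag))))))))
  where
  X = jobsIn (inp h) n
  h₀ : Store
  h₀ = exec (aᵛ ≔ lit 0 ⨾ qᵛ ≔ lit 0 ⨾ Nᵛ ≔ lit 0 ⨾ σᵛ ≔ lit 0 ⨾ badᵛ ≔ lit 0) h

-- Shifted copies of the events of offset 0

shift : ℕ → Event → Event
shift o e = event (o + o + key e) (jobOf e) (o + off e) (kind e)

shift-suc : ∀ o e → shift 1 (shift o e) ≡ shift (suc o) e
shift-suc o e = event-cong (lemma o (key e)) refl refl refl
  where
  lemma : ∀ o k → 2 + (o + o + k) ≡ suc o + suc o + k
  lemma = solve-∀

shift-start : ∀ X j o → shift o (startOf X j 0) ≡ startOf X j o
shift-start X j o = event-cong (lemma o (rel X j)) refl (+-identityʳ o) refl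
  where
  lemma : ∀ o r → o + o + suc (r + 0 + (r + 0)) ≡ suc (r + o + (r + o))
  lemma = solve-∀

shift-end : ∀ X j o → shift o (endOf X j 0) ≡ endOf X j o
shift-end X j o = event-cong (lemma o (rel X j + proc X j)) refl (+-identityʳ o) refl
  where
  lemma : ∀ o r → o + o + (r + 0 + (r + 0)) ≡ r + o + (r + o)
  lemma = solve-∀

∑-blocks : ∀ a b f → ∑ (a * b) f ≡ ∑ a λ o → ∑ b λ i → f (o * b + i)
∑-blocks zero    b f = refl
∑-blocks (suc a) b f = trans (cong (λ n → ∑ n f) (+-comm b (a * b))) (trans (∑-append (a * b) b f) (cong (_+ ∑ b (λ i → f (a * b + i))) (∑-blocks a b f)))

replicate-runs : ∀ {h s N} → val h σᵛ ≡ s → val h Nᵛ ≡ N →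
  Runs replicate (6 + s * 2 + s * N * 6) (λ h′ → val h′ Nᵛ ≡ suc s * N × val h′ wᵛ ≡ N + (1 ∸ N) ×
    (∀ y → y < N → events h′ y ≡ events h y) × (∀ y → y < s * N → events h′ (y + N) ≡ shift 1 (events h′ y))) h
replicate-runs {h} {s} {N} refl refl = runs-map (≤-reflexive (lemma (s * 2) (s * N * 6))) (λ _ _ q → q) (runs-exec {k = 1} ≤-refl
  (runs-⨾ (runs-repeat Count {h = h₀} refl refl λ i h′ _ ag count≡ →
      ≤-refl ▹ trans (cong₂ _+_ count≡ (val≡ ag Nᵛ refl)) (+-comm (i * N) N))
    λ h₁ ag₁ count₁ → runs-exec {k = 1} ≤-refl (runs-⨾ (runs-repeat Inv {h = exec (kᵛ ≔ lit 0) h₁} count₁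
      (refl , (λ y _ → events-agree ag₁ refl refl refl refl y) , λ _ ()) (step h₁ ag₁))
    λ h₂ ag₂ (_ , old , new) → ≤-refl {2} ▹
      trans (cong₂ _+_ (trans (val≡ ag₂ countᵛ refl) count₁) (N≡ h₁ h₂ ag₁ ag₂)) (+-comm (s * N) N)
      , cong (λ N → N + (1 ∸ N)) (N≡ h₁ h₂ ag₁ ag₂) , old , new)))
  where
  lemma : ∀ a b → 1 + (suc a + (1 + (suc b + 2))) ≡ 6 + a + b
  lemma = solve-∀
  h₀ : Store
  h₀ = exec (countᵛ ≔ lit 0) h
  Count : ℕ → Store → Set
  Count i h′ = val h′ countᵛ ≡ i * N
  Inv : ℕ → Store → Set
  Inv k h′ = val h′ kᵛ ≡ k × (∀ y → y < N → events h′ y ≡ events h y) × (∀ y → y < k → events h′ (y + N) ≡ shift 1 (events h′ y))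
  N≡ : ∀ h₁ h₂ → Agree (repeat (var σᵛ) (countᵛ ≔ var countᵛ ⊕ var Nᵛ)) h₀ h₁ → Agree (repeat (var countᵛ) _) (exec (kᵛ ≔ lit 0) h₁) h₂ → val h₂ Nᵛ ≡ N
  N≡ h₁ h₂ ag₁ ag₂ = trans (val≡ ag₂ Nᵛ refl) (val≡ ag₁ Nᵛ refl)
  step : ∀ h₁ → Agree _ h₀ h₁ → ∀ k h′ → k < s * N → Agree _ (exec (kᵛ ≔ lit 0) h₁) h′ → Inv k h′ → Runs _ 5 (Inv (suc k)) h′
  step h₁ ag₁ k h′ k<sN ag (refl , old , new) = ≤-refl ▹ +-comm k 1
      , (λ y y<N → trans (same y (<-≤-trans y<N (≤-trans (m≤n+m N k) (≤-reflexive (sym m≡))))) (old y y<N))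
      , λ y y<sk → case m≤n⇒m<n∨m≡n (≤-pred y<sk) of λ
        { (inj₁ y<k) → trans (same (y + N) (subst (y + N <_) (sym m≡) (+-monoˡ-< N y<k)))
            (trans (new y y<k) (cong (shift 1) (sym (same y (<-≤-trans y<k (m≤m+n k _))))))
        ; (inj₂ refl) → trans (cong (events h″) (sym m≡))
            (trans (event-cong (update-same (arr h′ keyᵃ) m _ refl) (update-same (arr h′ jobᵃ) m _ refl)
                               (update-same (arr h′ offᵃ) m _ refl) (update-same (arr h′ kindᵃ) m _ refl))
                   (cong (shift 1) (sym (same y k<m)))) }
    where
    N₁≡ : val h′ Nᵛ ≡ N
    N₁≡ = trans (val≡ ag Nᵛ refl) (val≡ ag₁ Nᵛ refl)
    m = k + val h′ Nᵛ
    m≡ : m ≡ k + N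
    m≡ = cong (k +_) N₁≡
    k<m : k < m
    k<m = subst (k <_) (sym m≡) (m<m+n k (n≢0⇒n>0 λ N≡0 → <⇒≱ k<sN (≤-trans (≤-reflexive (trans (cong (s *_) N≡0) (*-zeroʳ s))) z≤n)))
    h″ : Store
    h″ = exec (keyᵃ [ var kᵛ ⊕ var Nᵛ ]≔ lit 2 ⊕ keyᵃ ! var kᵛ ⨾ jobᵃ [ var kᵛ ⊕ var Nᵛ ]≔ jobᵃ ! var kᵛ ⨾
      offᵃ [ var kᵛ ⊕ var Nᵛ ]≔ lit 1 ⊕ offᵃ ! var kᵛ ⨾ kindᵃ [ var kᵛ ⊕ var Nᵛ ]≔ kindᵃ ! var kᵛ ⨾ kᵛ ≔ var kᵛ ⊕ lit 1) h′
    same : ∀ y → y < m → events h″ y ≡ events h′ y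
    same y y<m = let ne = <⇒≢ y<m in
      event-cong (update-other (arr h′ keyᵃ) m _ ne) (update-other (arr h′ jobᵃ) m _ ne)
                 (update-other (arr h′ offᵃ) m _ ne) (update-other (arr h′ kindᵃ) m _ ne)

module _ {s N : ℕ} {e₀ e : ℕ → Event} (old : ∀ y → y < N → e y ≡ e₀ y) (new : ∀ y → y < s * N → e (y + N) ≡ shift 1 (e y)) where

  blocks : ∀ o i → o < suc s → i < N → e (o * N + i) ≡ shift o (e₀ i)
  blocks zero    i o≤s i<N = old i i<N
  blocks (suc o) i o≤s i<N = trans (cong e (lemma N (o * N) i)) (trans (new (o * N + i) bound)
    (trans (cong (shift 1) (blocks o i (<⇒≤ o≤s) i<N)) (shift-suc o (e₀ i))))
    where
    lemma : ∀ n m i → n + m + i ≡ m + i + n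
    lemma = solve-∀
    bound : o * N + i < s * N
    bound = <-≤-trans (+-monoʳ-< (o * N) i<N) (≤-trans (≤-reflexive (+-comm (o * N) N)) (*-monoˡ-≤ N (≤-pred o≤s)))

  blocks-sum : ∀ g → ∑ (suc s * N) (g ∘ e) ≡ ∑ (suc s) λ o → ∑ N (g ∘ shift o ∘ e₀)
  blocks-sum g = trans (∑-blocks (suc s) N (g ∘ e)) (∑-cong (suc s) λ o o≤ → ∑-cong N λ i i<N → cong g (blocks o i o≤ i<N))

  blocks-sorted : (∀ x → suc x < N → key (e₀ x) ≤ key (e₀ (suc x))) → RunSorted N (suc s * N) e
  blocks-sorted sorted c x c≤x sx< sx<total = subst₂ (λ a b → key a ≤ key b)
      (trans (sym (blocks c i c≤s (<-trans ≤-refl si<N))) (cong e x≡))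
      (trans (sym (blocks c (suc i) c≤s si<N)) (cong e (trans (+-suc (c * N) i) (cong suc x≡))))
      (+-monoʳ-≤ (c + c) (sorted i si<N))
    where
    i = x ∸ c * N
    x≡ : c * N + i ≡ x
    x≡ = m+[n∸m]≡n c≤x
    si<N : suc i < N
    si<N = +-cancelˡ-< (c * N) (suc i) N (subst₂ _<_ (sym (trans (+-suc (c * N) i) (cong suc x≡))) (+-comm N (c * N)) sx<)
    c≤s : c < suc s
    c≤s = *-cancelʳ-< N c (suc s) (≤-<-trans c≤x (<-trans ≤-refl sx<total))

n<2^[1+⌊log₂n⌋] : ∀ n → n < 2 ^ suc ⌊log₂ n ⌋
n<2^[1+⌊log₂n⌋] n with n <? 2 ^ suc ⌊log₂ n ⌋
... | yes l = l
... | no nl = contradiction (subst (_≤ ⌊log₂ n ⌋) (⌊log₂[2^n]⌋≡n (suc ⌊log₂ n ⌋)) (⌊log₂⌋-mono-≤ (≮⇒≥ nl))) (<⇒≱ ≤-refl)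

suc-n≤2^n : ∀ n → suc n ≤ 2 ^ n
suc-n≤2^n zero    = ≤-refl
suc-n≤2^n (suc n) = +-mono-≤ (m^n>0 2 n) (≤-trans (suc-n≤2^n n) (m≤m+n _ 0))

orderTime : ℕ → ℕ → ℕ → ℕ
orderTime n s N = 1 + (4 + N * 4 + suc (suc ⌊log₂ n ⌋) * (10 + N * 22) +
  (6 + s * 2 + s * N * 6 + (4 + suc s * N * 4 + s * (10 + suc s * N * 22))))

order-runs : ∀ {h X s N} → val h σᵛ ≡ s → val h Nᵛ ≡ N → N ≤ number X + number X →
  (∀ g → ∑ N (g ∘ events h) ≡ baseSum X (number X) g) →
  Runs order (orderTime (number X) s N) (λ h′ → val h′ Nᵛ ≡ suc s * N × EventList X s (suc s * N) (events h′)) h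
order-runs {h} {X} {s} {N} σ≡ N≡ N≤ base = runs-exec {k = 1} ≤-refl
  (runs-⨾ (sort-runs {exec (wᵛ ≔ lit 1) h} (suc (suc ⌊log₂ n ⌋)) refl N≡ ≤-refl trivial enough) λ h₁ ag₁ (sorted₁ , sums₁) →
   runs-⨾ (replicate-runs {h₁} (trans (val≡ ag₁ σᵛ refl) σ≡) (trans (val≡ ag₁ Nᵛ refl) N≡)) λ h₂ ag₂ (N₂ , w₂ , old , new) →
   runs-map ≤-refl (λ h₃ ag₃ (sorted₃ , sums₃) → trans (val≡ ag₃ Nᵛ refl) N₂ , record
       { complete = λ g → trans (sums₃ g) (trans (blocks-sum {s} old new g) (∑-cong (suc s) λ o _ →
           trans (sums₁ (g ∘ shift o)) (trans (base (g ∘ shift o)) (∑-cong n λ j _ →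
             cong₂ (λ a b → ind (0 <? proc X j) * (g a + g b)) (shift-start X j o) (shift-end X j o)))))
       ; sorted = sorted₃ })
     (sort-runs {h₂} s w₂ N₂ (positive N) (wide N {events h₂} (blocks-sorted {s} old new sorted₁)) (long N)))
  where
  n = number X
  trivial : RunSorted 1 N (events h)
  trivial c x c≤x sx< _ = contradiction (≤-trans (s≤s (≤-trans (≤-reflexive (sym (*-identityʳ c))) c≤x))
    (≤-pred (≤-trans sx< (≤-reflexive (cong suc (*-identityʳ c)))))) (<⇒≱ ≤-refl)
  enough : N ≤ 1 * 2 ^ suc (suc ⌊log₂ n ⌋)
  enough = ≤-trans N≤ (≤-trans (+-mono-≤ (<⇒≤ (n<2^[1+⌊log₂n⌋] n)) (<⇒≤ (n<2^[1+⌊log₂n⌋] n))) (≤-reflexive (lemma (2 ^ suc ⌊log₂ n ⌋))))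
    where
    lemma : ∀ a → a + a ≡ 1 * (a + (a + 0))
    lemma = solve-∀
  positive : ∀ N → 1 ≤ N + (1 ∸ N)
  positive zero    = ≤-refl
  positive (suc _) = s≤s z≤n
  wide : ∀ N {ev} → RunSorted N (suc s * N) ev → RunSorted (N + (1 ∸ N)) (suc s * N) ev
  wide zero    runs c x _ _ sx< = case subst (suc x <_) (*-zeroʳ s) sx< of λ ()
  wide (suc N) {ev} runs = subst (λ w → RunSorted w (suc s * suc N) ev) (sym (trans (cong (suc N +_) (0∸n≡0 N)) (+-identityʳ _))) runs
  -- Crude, since about log `s` rounds would do, but the extra factor `s` is absorbed by the size of
  -- the table.
  long : ∀ N → suc s * N ≤ (N + (1 ∸ N)) * 2 ^ s
  long N = ≤-trans (≤-reflexive (*-comm (suc s) N)) (*-mono-≤ (m≤m+n N _) (suc-n≤2^n s))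

-- First and last events of a job, and the slots in use

module _ {X : Jobs} {σ N : ℕ} {ev : ℕ → Event} (L : EventList X σ N ev) where

  private
    n : ℕ
    n = number X

  First Last : ℕ → ℕ → Set
  First i j = jobOf (ev i) ≡ j × off (ev i) ≡ 0 × kind (ev i) ≡ 1
  Last  i j = jobOf (ev i) ≡ j × off (ev i) ≡ σ × kind (ev i) ≡ 0

  -- Every other start of the job has a larger offset, hence a larger key, and as the processing
  -- time is positive every end has key at least two more than twice the release time. Equal events
  -- are settled by `occurs-once`; `last-greatest` is the mirror image.
  first-least : ∀ {i l} → i < N → l < N → First i (jobOf (ev l)) → i ≤ l
  first-least {i} {l} i<N l<N (j , o , k) with all-valid L i i<N | all-valid L l l<N
  ... | valid _ _ _ (inj₂ (k′ , _)) | _ = case trans (sym k) k′ of λ ()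
  ... | valid _ _ _ (inj₁ (_ , κᵢ)) | valid _ _ p (inj₂ (_ , κₗ)) = <⇒≤ (key-reflects L i<N
        (subst₂ _<_ (sym (trans κᵢ (cong₂ (λ a b → suc (rel X a + b + (rel X a + b))) j o))) (sym κₗ)
          (lemma (rel X (jobOf (ev l))) (proc X (jobOf (ev l))) (off (ev l)) p)))
    where
    lemma : ∀ r p o → 0 < p → suc (r + 0 + (r + 0)) < r + p + o + (r + p + o)
    lemma r (suc p) o _ = subst (suc (suc (r + 0 + (r + 0))) ≤_) (rhs r p o)
      (s≤s (s≤s (+-mono-≤ (+-monoʳ-≤ r z≤n) (+-monoʳ-≤ r z≤n))))
      where
      rhs : ∀ r p o → 2 + (r + (p + o) + (r + (p + o))) ≡ r + suc p + o + (r + suc p + o)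
      rhs = solve-∀
  ... | valid _ _ _ (inj₁ (_ , κᵢ)) | valid _ _ _ (inj₁ (kₗ , κₗ)) with off (ev l) in oₗ
  ...   | zero  = ≤-reflexive (occurs-once L i<N l<N j (trans o (sym oₗ)) (trans k (sym kₗ)))
  ...   | suc o′ = <⇒≤ (key-reflects L i<N
        (subst₂ _<_ (sym (trans κᵢ (cong₂ (λ a b → suc (rel X a + b + (rel X a + b))) j o))) (sym κₗ)
          (lemma (rel X (jobOf (ev l))) o′)))
    where
    lemma : ∀ r o → suc (r + 0 + (r + 0)) < suc (r + suc o + (r + suc o))
    lemma r o = s≤s (+-mono-<-≤ (+-monoʳ-< r (s≤s z≤n)) (+-monoʳ-≤ r z≤n))

  last-greatest : ∀ {i l} → i < N → l < N → Last i (jobOf (ev l)) → l ≤ i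
  last-greatest {i} {l} i<N l<N (j , o , k) with all-valid L i i<N | all-valid L l l<N
  ... | valid _ _ _ (inj₁ (k′ , _)) | _ = case trans (sym k) k′ of λ ()
  ... | valid _ _ _ (inj₂ (_ , κᵢ)) | valid _ o≤ p (inj₁ (_ , κₗ)) = <⇒≤ (key-reflects L l<N
        (subst₂ _<_ (sym κₗ) (sym (trans κᵢ (cong₂ (λ a b → rel X a + proc X a + b + (rel X a + proc X a + b)) j o)))
          (lemma (rel X (jobOf (ev l))) (proc X (jobOf (ev l))) (off (ev l)) p (≤-pred o≤))))
    where
    lemma : ∀ r p o → 0 < p → o ≤ σ → suc (r + o + (r + o)) < r + p + σ + (r + p + σ)
    lemma r (suc p) o _ o≤ = subst (suc (suc (r + o + (r + o))) ≤_) (rhs r p σ) (s≤s (s≤s (+-mono-≤ le le)))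
      where
      le : r + o ≤ r + (p + σ)
      le = +-monoʳ-≤ r (≤-trans o≤ (m≤n+m σ p))
      rhs : ∀ r p s → 2 + (r + (p + s) + (r + (p + s))) ≡ r + suc p + s + (r + suc p + s)
      rhs = solve-∀
  ... | valid _ _ _ (inj₂ (_ , κᵢ)) | valid _ o≤ _ (inj₂ (kₗ , κₗ)) with m≤n⇒m<n∨m≡n (≤-pred o≤)
  ...   | inj₂ oₗ = ≤-reflexive (sym (occurs-once L i<N l<N j (trans o (sym oₗ)) (trans k (sym kₗ))))
  ...   | inj₁ o< = <⇒≤ (key-reflects L l<N
        (subst₂ _<_ (sym κₗ) (sym (trans κᵢ (cong₂ (λ a b → rel X a + proc X a + b + (rel X a + proc X a + b)) j o)))
          (+-mono-< (+-monoʳ-< r o<) (+-monoʳ-< r o<))))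
    where r = rel X (jobOf (ev l)) + proc X (jobOf (ev l))

  -- Slots and spare slots once the starts among the first a events and the ends
  -- among the first b events have been processed.
  record Progress (a b : ℕ) (slot : ℕ → ℕ) (F r : ℕ) : Set where
    field
      idle  : ∀ j → j < n → (∀ l → l < a → ¬ First l j) → slot j ≡ 0
      busy  : ∀ j l → j < n → l < a → First l j → (∀ l → l < b → ¬ Last l j) → slot j ≢ 0
      over  : ∀ j l → j < n → l < b → Last l j → slot j ≡ 0
      -- The slots in use, `r - F`, are as many as the active jobs.
      tally : r + ended L (λ _ → σ) b ≡ F + started L (λ _ → 0) a

  private
    split : ∀ {l i} → l < suc i → l < i ⊎ l ≡ i
    split l<si = m≤n⇒m<n∨m≡n (≤-pred l<si)

  progress-skip-start : ∀ {i slot F r} → ¬ (off (ev i) ≡ 0 × kind (ev i) ≡ 1) → Progress i i slot F r → Progress (suc i) i slot F r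
  progress-skip-start {i} {slot} {F} {r} miss P = record
    { idle  = λ j j<n none → idle j j<n λ l l<i → none l (m<n⇒m<1+n l<i)
    ; busy  = λ j l j<n l<si first → [ (λ l<i → busy j l j<n l<i first) , (λ { refl → contradiction (proj₂ first) miss }) ]′ (split l<si)
    ; over  = over
    ; tally = trans tally (cong (F +_) (trans (sym (+-identityʳ _)) (cong (started L (λ _ → 0) i +_)
        (sym (ind-*-no (kind (ev i) ≟ 1) (hit? (λ _ → 0) (ev i)) λ (k , o) → miss (sym o , k)))))) }
    where open Progress P

  progress-start : ∀ {i slot slot′ F F′ r r′} → i < N → kind (ev i) ≡ 1 → off (ev i) ≡ 0 → slot′ (jobOf (ev i)) ≢ 0 →
    (∀ j → j ≢ jobOf (ev i) → slot′ j ≡ slot j) → r′ + F ≡ suc (F′ + r) → Progress i i slot F r → Progress (suc i) i slot′ F′ r′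
  progress-start {i} {slot} {slot′} {F} {F′} {r} {r′} i<N k o owned same moved P = record
    { idle  = λ j j<n none → trans (same j λ { refl → none i ≤-refl (refl , o , k) }) (idle j j<n λ l l<i → none l (m<n⇒m<1+n l<i))
    ; busy  = λ j l j<n l<si first not-last → case j ≟ jobOf (ev i) of λ
        { (yes refl) → owned
        ; (no ne) → subst (_≢ 0) (sym (same j ne)) ([ (λ l<i → busy j l j<n l<i first not-last) , (λ { refl → contradiction (sym (proj₁ first)) ne }) ]′ (split l<si)) }
    ; over  = λ j l j<n l<i lst → case j ≟ jobOf (ev i) of λ
        { (yes refl) → contradiction (last-greatest (<-trans l<i i<N) i<N lst) (<⇒≱ l<i)
        ; (no ne) → trans (same j ne) (over j l j<n l<i lst) }
    ; tally = +-cancelʳ-≡ F _ _ (begin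
        r′ + e + F           ≡⟨ +-right-comm r′ e F ⟩
        r′ + F + e           ≡⟨ cong (_+ e) moved ⟩
        suc (F′ + r) + e     ≡⟨ lemma₁ F′ r e ⟩
        F′ + (r + e) + 1     ≡⟨ cong (λ x → F′ + x + 1) tally ⟩
        F′ + (F + s) + 1     ≡⟨ lemma₂ F′ F s ⟩
        F′ + (s + 1) + F     ≡⟨ cong (λ x → F′ + (s + x) + F) (ind-*-yes (kind (ev i) ≟ 1) (hit? (λ _ → 0) (ev i)) k (sym o)) ⟨
        F′ + started L (λ _ → 0) (suc i) + F ∎) }
    where
    open Progress P
    open ≡-Reasoning
    e = ended L (λ _ → σ) i
    s = started L (λ _ → 0) i
    lemma₁ : ∀ f r e → suc (f + r) + e ≡ f + (r + e) + 1
    lemma₁ = solve-∀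
    lemma₂ : ∀ f g s → f + (g + s) + 1 ≡ f + (s + 1) + g
    lemma₂ = solve-∀

  progress-skip-end : ∀ {i slot F r} → ¬ (off (ev i) ≡ σ × kind (ev i) ≡ 0) → Progress (suc i) i slot F r → Progress (suc i) (suc i) slot F r
  progress-skip-end {i} {slot} {F} {r} miss P = record
    { idle  = idle
    ; busy  = λ j l j<n l<si first not-last → busy j l j<n l<si first λ l l<i → not-last l (m<n⇒m<1+n l<i)
    ; over  = λ j l j<n l<si lst → [ (λ l<i → over j l j<n l<i lst) , (λ { refl → contradiction (proj₂ lst) miss }) ]′ (split l<si)
    ; tally = trans (cong (r +_) (trans (cong (ended L (λ _ → σ) i +_)
        (ind-*-no (kind (ev i) ≟ 0) (hit? (λ _ → σ) (ev i)) λ (k , o) → miss (sym o , k))) (+-identityʳ _))) tally }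
    where open Progress P

  progress-end : ∀ {i slot slot′ F r} → kind (ev i) ≡ 0 → off (ev i) ≡ σ → slot′ (jobOf (ev i)) ≡ 0 →
    (∀ j → j ≢ jobOf (ev i) → slot′ j ≡ slot j) → Progress (suc i) i slot F r → Progress (suc i) (suc i) slot′ (suc F) r
  progress-end {i} {slot} {slot′} {F} {r} k o cleared same P = record
    { idle  = λ j j<n none → case j ≟ jobOf (ev i) of λ { (yes refl) → cleared ; (no ne) → trans (same j ne) (idle j j<n none) }
    ; busy  = λ j l j<n l<si first not-last → let ne = λ { refl → not-last i ≤-refl (refl , o , k) } in
        subst (_≢ 0) (sym (same j ne)) (busy j l j<n l<si first λ l l<i → not-last l (m<n⇒m<1+n l<i))
    ; over  = λ j l j<n l<si lst → case j ≟ jobOf (ev i) of λ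
        { (yes refl) → cleared
        ; (no ne) → trans (same j ne) ([ (λ l<i → over j l j<n l<i lst) , (λ { refl → contradiction (sym (proj₁ lst)) ne }) ]′ (split l<si)) }
    ; tally = trans (cong (λ x → r + (ended L (λ _ → σ) i + x)) (ind-*-yes (kind (ev i) ≟ 0) (hit? (λ _ → σ) (ev i)) k (sym o)))
        (trans (lemma r (ended L (λ _ → σ) i)) (cong suc tally)) }
    where
    open Progress P
    lemma : ∀ r e → r + (e + 1) ≡ suc (r + e)
    lemma = solve-∀

  -- Event `i` lies between the first and the last event of its job. The start at `i` has been
  -- processed but not the end, so the slot is already assigned and not yet released.
  owner : ∀ {i slot F r} → i < N → Progress (suc i) i slot F r → slot (jobOf (ev i)) ≢ 0
  owner {i} {slot} {F} {r} i<N P with all-valid L i i<N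
  ... | valid j<n o≤ p origin with occurs L 1 ≤-refl j<n (s≤s (z≤n {σ})) p
  ...   | l , l<N , first = busy _ l j<n (s≤s (first-least l<N i<N first)) first
          λ l′ l′<i last → <⇒≱ l′<i (last-greatest (<-trans l′<i i<N) i<N last)
    where open Progress P

  fresh : ∀ {i slot F r} → i < N → kind (ev i) ≡ 1 → off (ev i) ≡ 0 → Progress i i slot F r → slot (jobOf (ev i)) ≡ 0
  fresh {i} i<N k o P = Progress.idle P _ (Valid.job< (all-valid L i i<N)) λ l l<i (j , _) →
    <⇒≱ l<i (first-least i<N (<-trans l<i i<N) (sym j , o , k))

  free-unstarted : ∀ {i} m → i < N → kind (ev i) ≡ 1 → off (ev i) ≡ 0 → ∀ α o →
    free X m ev (update α (jobOf (ev i)) o) i ≡ free X m ev α i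
  free-unstarted {i} m i<N k o α v = go i ≤-refl
    where
    go : ∀ l → l ≤ i → free X m ev (update α (jobOf (ev i)) v) l ≡ free X m ev α l
    go zero    _   = refl
    go (suc l) l<i rewrite update-other α (jobOf (ev i)) v {jobOf (ev l)} (λ j → <⇒≱ l<i (first-least i<N (<-trans l<i i<N) (sym j , o , k)))
      | go l (<⇒≤ l<i) = refl

  all-over : ∀ {slot F r} → Progress N N slot F r → ∀ j → j < n → slot j ≡ 0
  all-over P j j<n with 0 <? proc X j
  ... | yes p = let l , l<N , lst = occurs L 0 (s≤s z≤n) j<n ≤-refl p in Progress.over P j l j<n l<N lst
  ... | no ¬p = Progress.idle P j j<n λ l l<N (e , _) → ¬p (subst (λ j → 0 < proc X j) e (Valid.long (all-valid L l l<N)))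

  progress-cong : ∀ {a b slot slot′ F F′ r r′} → (∀ j → slot′ j ≡ slot j) → F′ ≡ F → r′ ≡ r →
    Progress a b slot F r → Progress a b slot′ F′ r′
  progress-cong same refl refl P = record
    { idle  = λ j j<n none → trans (same j) (idle j j<n none)
    ; busy  = λ j l j<n l<a first none → subst (_≢ 0) (sym (same j)) (busy j l j<n l<a first none)
    ; over  = λ j l j<n l<b lst → trans (same j) (over j l j<n l<b lst)
    ; tally = tally }
    where open Progress P

-- Dynamic programming

pattern Bᵛ = 20
pattern Aᵛ = 21
pattern rᵛ = 22
pattern Fᵛ = 23
pattern Mᵛ = 24
pattern eᵛ = 25
pattern jobᵛ = 26
pattern offᵛ = 27
pattern kindᵛ = 28
pattern slotᵛ = 29
pattern bkᵛ = 30
pattern xᵛ = 31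
pattern loᵛ = 32
pattern dgᵛ = 33
pattern zᵛ = 34
pattern sizeᵛ = 35
pattern yᵛ = 36
pattern topᵛ = 37
pattern slotᵃ = 9F
pattern spareᵃ = suc 9F
pattern powᵃ = suc (suc 9F)
pattern tableᵃ = suc (suc (suc 9F))

-- An odometer instead of division: `loᵛ` counts modulo `B ^ k`, and its overflow advances the
-- digit.
advance : Cmd
advance = xᵛ ≔ var xᵛ ⊕ lit 1 ⨾ loᵛ ≔ var loᵛ ⊕ lit 1 ⨾
  ifNonzero (var bkᵛ ⊖ var loᵛ) skip
    (loᵛ ≔ lit 0 ⨾ zᵛ ≔ var zᵛ ⊕ var bkᵛ ⨾ dgᵛ ≔ var dgᵛ ⊕ lit 1 ⨾
     ifNonzero (var Bᵛ ⊖ var dgᵛ) skip (dgᵛ ≔ lit 0 ⨾ zᵛ ≔ lit 0))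

-- Visits all table indices x, keeping digit k of x in dgᵛ and its weight dgᵛ * B^k in zᵛ.
scan : Cmd → Cmd
scan body = xᵛ ≔ lit 0 ⨾ loᵛ ≔ lit 0 ⨾ dgᵛ ≔ lit 0 ⨾ zᵛ ≔ lit 0 ⨾ repeat (var Mᵛ) (body ⨾ advance)

record Position (σ k x : ℕ) (h : Store) : Set where
  field
    high : ℕ
    at   : x ≡ (high * suc σ + val h dgᵛ) * suc σ ^ k + val h loᵛ
    lo<  : val h loᵛ < suc σ ^ k
    dg<  : val h dgᵛ < suc σ
    z≡   : val h zᵛ ≡ val h dgᵛ * suc σ ^ k
    x≡   : val h xᵛ ≡ x

  dg≡ : val h dgᵛ ≡ dig σ k x
  dg≡ = sym (trans (cong (dig σ k) at) (dig-unique k high dg< lo<))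

advance-runs : ∀ {σ k x h} → val h bkᵛ ≡ suc σ ^ k → val h Bᵛ ≡ suc σ → Position σ k x h →
  Runs advance 9 (λ h′ → Position σ k (suc x) h′ × arr h′ ≡ arr h) h
advance-runs {σ} {k} {x} {h} bk≡ B≡ P = runs-exec ≤-refl (runs-exec ≤-refl (runs-if
  (λ ne → s≤s z≤n ▹ record
    { high = high ; at = trans (cong suc at) (lemma₀ _ lo) ; lo< = subst (lo + 1 <_) bk≡ (∸≢0⇒< ne) ; dg< = dg< ; z≡ = z≡ ; x≡ = sx≡ } , refl)
  (λ z → let full = trans (+-comm 1 lo) (≤-antisym (≤-trans (≤-reflexive (+-comm lo 1)) lo<) (subst (_≤ lo + 1) bk≡ (m∸n≡0⇒m≤n z))) in
    runs-exec ≤-refl (runs-exec ≤-refl (runs-exec ≤-refl (runs-if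
      (λ ne → s≤s z≤n ▹ record
        { high = high ; at = trans (cong suc at) (trans (carry full) (lemma₁ (high * suc σ) dg p))
        ; lo< = m^n>0 (suc σ) k ; dg< = subst (dg + 1 <_) B≡ (∸≢0⇒< ne)
        ; z≡ = trans (cong₂ _+_ z≡ bk≡) (lemma₂ dg p) ; x≡ = sx≡ } , refl)
      (λ z′ → let wrapped = ≤-antisym (≤-trans (≤-reflexive (+-comm dg 1)) dg<) (subst (_≤ dg + 1) B≡ (m∸n≡0⇒m≤n z′)) in
        ≤-refl ▹ record
        { high = suc high ; at = trans (cong suc at) (trans (carry full) (trans (lemma₁ (high * suc σ) dg p)
            (trans (cong (λ d → (high * suc σ + d) * p + 0) wrapped) (lemma₃ high (suc σ) p))))
        ; lo< = m^n>0 (suc σ) k ; dg< = s≤s z≤n ; z≡ = refl ; x≡ = sx≡ } , refl)))))))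
  where
  open Position P
  lo = val h loᵛ
  dg = val h dgᵛ
  p = suc σ ^ k
  sx≡ : val h xᵛ + 1 ≡ suc x
  sx≡ = trans (+-comm _ 1) (cong suc x≡)
  lemma₀ : ∀ a l → suc (a + l) ≡ a + (l + 1)
  lemma₀ = solve-∀
  carry : suc lo ≡ p → suc ((high * suc σ + dg) * p + lo) ≡ (high * suc σ + dg) * p + p
  carry full = trans (sym (+-suc _ lo)) (cong ((high * suc σ + dg) * p +_) full)
  lemma₁ : ∀ a d p → (a + d) * p + p ≡ (a + (d + 1)) * p + 0
  lemma₁ = solve-∀
  lemma₂ : ∀ d p → d * p + p ≡ (d + 1) * p
  lemma₂ = solve-∀
  lemma₃ : ∀ h b p → (h * b + b) * p + 0 ≡ (b + h * b + 0) * p + 0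
  lemma₃ = solve-∀

disturbs : Cmd → Bool
disturbs body = assigned body xᵛ ∨ (assigned body loᵛ ∨ (assigned body dgᵛ ∨ (assigned body zᵛ ∨ (assigned body bkᵛ ∨ assigned body Bᵛ))))

agree-⨾ : ∀ {P Q h h′ h″} → Agree P h h′ → Agree Q h′ h″ → Agree (P ⨾ Q) h h″
agree-⨾ {P} (agreement v a i) (agreement v′ a′ i′) = agreement
  (λ u f → trans (v′ u (∨-conicalʳ _ _ f)) (v u (∨-conicalˡ _ _ f)))
  (λ b f x → trans (a′ b (∨-conicalʳ (written P b) _ f) x) (a b (∨-conicalˡ _ _ f) x)) (trans i′ i)

scan-runs : ∀ {σ k body c h} (M : ℕ) (Inv : ℕ → (ℕ → ℕ) → Set) → disturbs body ≡ false →
  val h bkᵛ ≡ suc σ ^ k → val h Bᵛ ≡ suc σ → val h Mᵛ ≡ M → Inv 0 (arr h tableᵃ) →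
  (∀ x h′ → x < M → Agree (scan body) h h′ → val h′ xᵛ ≡ x → val h′ dgᵛ ≡ dig σ k x → val h′ zᵛ ≡ dig σ k x * suc σ ^ k →
    Inv x (arr h′ tableᵃ) → Runs body c (λ h″ → Inv (suc x) (arr h″ tableᵃ)) h′) →
  Runs (scan body) (5 + M * (c + 10)) (λ h′ → Inv M (arr h′ tableᵃ)) h
scan-runs {σ} {k} {body} {c} {h} M Inv clean bk≡ B≡ M≡ inv₀ step =
  runs-exec ≤-refl (runs-exec ≤-refl (runs-exec ≤-refl (runs-exec ≤-refl
    (runs-map (s≤s (*-monoʳ-≤ M (≤-reflexive (sym (+-suc c 9))))) (λ _ _ → proj₂)
      (runs-repeat Inv′ {h = h₀} M≡ (start , inv₀) step′)))))
  where
  h₀ : Store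
  h₀ = exec (xᵛ ≔ lit 0 ⨾ loᵛ ≔ lit 0 ⨾ dgᵛ ≔ lit 0 ⨾ zᵛ ≔ lit 0) h
  Inv′ : ℕ → Store → Set
  Inv′ x h′ = Position σ k x h′ × Inv x (arr h′ tableᵃ)
  start : Position σ k 0 h₀
  start = record { high = 0 ; at = refl ; lo< = m^n>0 (suc σ) k ; dg< = s≤s z≤n ; z≡ = refl ; x≡ = refl }
  c₁ = ∨-conicalʳ (assigned body xᵛ) _ clean
  c₂ = ∨-conicalʳ (assigned body loᵛ) _ c₁
  c₃ = ∨-conicalʳ (assigned body dgᵛ) _ c₂
  c₄ = ∨-conicalʳ (assigned body zᵛ) _ c₃
  step′ : ∀ x h′ → x < M → Agree (body ⨾ advance) h₀ h′ → Inv′ x h′ → Runs (body ⨾ advance) (c + 9) (Inv′ (suc x)) h′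
  step′ x h′ x<M ag (P , inv) = runs-⨾
    (step x h′ x<M (agree-⨾ (agree (xᵛ ≔ lit 0) h) (agree-⨾ (agree (loᵛ ≔ lit 0) _) (agree-⨾ (agree (dgᵛ ≔ lit 0) _) (agree-⨾ (agree (zᵛ ≔ lit 0) _)
        (agreement (val≡ ag) (arr≡ ag) (inp≡ ag)))))) (Position.x≡ P) (Position.dg≡ P)
      (trans (Position.z≡ P) (cong (_* suc σ ^ k) (Position.dg≡ P))) inv)
    λ h₁ ag₁ inv₁ → runs-map ≤-refl (λ h₂ _ (P₂ , same) → P₂ , subst (λ a → Inv (suc x) (a tableᵃ)) (sym same) inv₁)
      (advance-runs (trans (val≡ ag₁ bkᵛ (∨-conicalˡ _ _ c₄)) (bk h′ ag)) (trans (val≡ ag₁ Bᵛ (∨-conicalʳ (assigned body bkᵛ) _ c₄)) (Bs h′ ag))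
        (keep h₁ ag₁))
    where
    bk : ∀ h′ → Agree (body ⨾ advance) h₀ h′ → val h′ bkᵛ ≡ suc σ ^ k
    bk h′ ag = trans (val≡ ag bkᵛ (cong (_∨ false) (∨-conicalˡ _ _ c₄))) bk≡
    Bs : ∀ h′ → Agree (body ⨾ advance) h₀ h′ → val h′ Bᵛ ≡ suc σ
    Bs h′ ag = trans (val≡ ag Bᵛ (cong (_∨ false) (∨-conicalʳ (assigned body bkᵛ) _ c₄))) B≡
    keep : ∀ h₁ → Agree body h′ h₁ → Position σ k x h₁
    keep h₁ ag₁ = record
      { high = high ; at = trans at (cong₂ (λ d l → (high * suc σ + d) * suc σ ^ k + l) (sym d≡) (sym l≡))
      ; lo< = subst (_< suc σ ^ k) (sym l≡) lo< ; dg< = subst (_< suc σ) (sym d≡) dg<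
      ; z≡ = trans (val≡ ag₁ zᵛ (∨-conicalˡ _ _ c₃)) (trans z≡ (cong (_* suc σ ^ k) (sym d≡)))
      ; x≡ = trans (val≡ ag₁ xᵛ (∨-conicalˡ _ _ clean)) x≡ }
      where
      open Position P
      d≡ = val≡ ag₁ dgᵛ (∨-conicalˡ _ _ c₂)
      l≡ = val≡ ag₁ loᵛ (∨-conicalˡ _ _ c₁)

Swept : (ℕ → ℕ → ℕ) → (ℕ → ℕ) → ℕ → (ℕ → ℕ) → Set
Swept f T x T′ = (∀ y → y < x → T′ y ≡ f y (T y)) × (∀ y → x ≤ y → T′ y ≡ T y)

swept-step : ∀ {f T x T′} T″ → Swept f T x T′ → T″ x ≡ f x (T x) → (∀ y → y ≢ x → T″ y ≡ T′ y) → Swept f T (suc x) T″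
swept-step {f} {T} {x} {T′} T″ (old , later) new same =
  (λ y y<sx → case m≤n⇒m<n∨m≡n (≤-pred y<sx) of λ { (inj₁ y<x) → trans (same y (<⇒≢ y<x)) (old y y<x) ; (inj₂ refl) → new })
  , λ y x<y → trans (same y (>⇒≢ x<y)) (later y (<⇒≤ x<y))

-- The sum of the two truncated differences is 0 exactly when offset and digit agree, which stands
-- in for an equality test.
applyBody applyEvent : Cmd
applyBody = ifNonzero ((var offᵛ ⊖ var dgᵛ) ⊕ (var dgᵛ ⊖ var offᵛ)) skip
  (ifNonzero (var kindᵛ)
    (ifNonzero (var offᵛ ⊖ slackᵃ ! var jobᵛ) (tableᵃ [ var xᵛ ]≔ lit 0) (tableᵃ [ var xᵛ ]≔ tableᵃ ! var xᵛ ⊖ lit 1))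
    (ifNonzero (tableᵃ ! var xᵛ) (tableᵃ [ var xᵛ ]≔ lit 1 ⊕ tableᵃ ! var xᵛ) skip))
applyEvent = scan applyBody

reactAt : Jobs → Event → ℕ → ℕ → ℕ
reactAt X e o c = when (o ≟ off e) (react X e c) c

reactAt-mono : ∀ X e o {c d} → c ≤ d → reactAt X e o c ≤ reactAt X e o d
reactAt-mono X (event _ j f κ) o {c} {d} c≤d with o ≟ f
... | no _ = c≤d
reactAt-mono X (event _ j f zero)    o {zero}  {d}     c≤d | yes _ = z≤n
reactAt-mono X (event _ j f zero)    o {suc c} {suc d} c≤d | yes _ = s≤s c≤d
reactAt-mono X (event _ j f (suc _)) o {c}     {d}     c≤d | yes _ with f ∸ slack X j
... | zero  = ∸-monoˡ-≤ 1 c≤d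
... | suc _ = z≤n

applyEvent-runs : ∀ {X σ k h e M} → val h bkᵛ ≡ suc σ ^ k → val h Bᵛ ≡ suc σ → val h Mᵛ ≡ M →
  val h offᵛ ≡ off e → val h kindᵛ ≡ kind e → arr h slackᵃ (val h jobᵛ) ≡ slack X (jobOf e) →
  Runs applyEvent (5 + M * 14) (λ h′ → ∀ x → x < M → arr h′ tableᵃ x ≡ reactAt X e (dig σ k x) (arr h tableᵃ x)) h
applyEvent-runs {X} {σ} {k} {h} {event κ j o t} {M} bk≡ B≡ M≡ off≡ kind≡ slack≡ = runs-map ≤-refl (λ _ _ → proj₁)
  (scan-runs {σ} {k} {applyBody} {4} M (Swept f T) refl bk≡ B≡ M≡ ((λ _ ()) , λ _ _ → refl) step)
  where
  e = event κ j o t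
  T = arr h tableᵃ
  f : ℕ → ℕ → ℕ
  f x c = reactAt X e (dig σ k x) c
  step : ∀ x h′ → x < M → Agree applyEvent h h′ → val h′ xᵛ ≡ x → val h′ dgᵛ ≡ dig σ k x → val h′ zᵛ ≡ dig σ k x * suc σ ^ k →
    Swept f T x (arr h′ tableᵃ) → Runs applyBody 4 (λ h″ → Swept f T (suc x) (arr h″ tableᵃ)) h′
  step x h′ x<M ag refl dg≡ _ S = runs-if
    (λ ne → s≤s z≤n ▹ swept-step {f} {T} (arr h′ tableᵃ) S (trans now (sym (missed (T x) λ e → ne (cong₂ _+_ (m≤n⇒m∸n≡0 (≤-reflexive (differ e)))
        (m≤n⇒m∸n≡0 (≤-reflexive (sym (differ e)))))))) (λ _ _ → refl))
    (λ z → let hit = trans (sym dg≡) (trans (≤-antisym (m∸n≡0⇒m≤n (m+n≡0⇒n≡0 (val h′ offᵛ ∸ val h′ dgᵛ) z)) (m∸n≡0⇒m≤n (m+n≡0⇒m≡0 _ z))) off′) in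
      runs-if
        (λ ne → let t≢0 = λ t≡0 → ne (trans kind′ t≡0) in runs-if
          (λ late → ≤-refl ▹ set (sym (trans (hits (T x) hit) (start-late t (T x) t≢0 (λ z → late (trans lateness z))))))
          (λ ok → ≤-refl ▹ set (trans (cong (_∸ 1) now) (sym (trans (hits (T x) hit) (start-ok t (T x) t≢0 (trans (sym lateness) ok)))))))
        (λ z′ → let t≡0 = trans (sym kind′) z′ in runs-if
          (λ alive → ≤-refl ▹ set (trans (cong suc now) (sym (trans (hits (T x) hit) (end-alive t (T x) t≡0 (λ z → alive (trans now z)))))))
          (λ dead → ≤-refl ▹ swept-step {f} {T} (arr h′ tableᵃ) S (trans now (sym (trans (hits (T x) hit) (end-dead t (T x) t≡0 (trans (sym now) dead))))) (λ _ _ → refl))))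
    where
    now : arr h′ tableᵃ x ≡ T x
    now = proj₂ S x ≤-refl
    off′ : val h′ offᵛ ≡ o
    off′ = trans (val≡ ag offᵛ refl) off≡
    kind′ : val h′ kindᵛ ≡ t
    kind′ = trans (val≡ ag kindᵛ refl) kind≡
    lateness : val h′ offᵛ ∸ arr h′ slackᵃ (val h′ jobᵛ) ≡ o ∸ slack X j
    lateness = cong₂ _∸_ off′ (trans (arr≡ ag slackᵃ refl _) (trans (cong (arr h slackᵃ) (val≡ ag jobᵛ refl)) slack≡))
    differ : dig σ k x ≡ o → val h′ offᵛ ≡ val h′ dgᵛ
    differ e = trans off′ (sym (trans dg≡ e))
    missed : ∀ c → dig σ k x ≢ o → f x c ≡ c
    missed c ne with dig σ k x ≟ o
    ... | yes e = contradiction e ne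
    ... | no _  = refl
    hits : ∀ c → dig σ k x ≡ o → f x c ≡ react X e c
    hits c e with dig σ k x ≟ o
    ... | yes _ = refl
    ... | no ne = contradiction e ne
    start-late : ∀ t c → t ≢ 0 → o ∸ slack X j ≢ 0 → react X (event κ j o t) c ≡ 0
    start-late zero    c ne late = contradiction refl ne
    start-late (suc t) c ne late with o ∸ slack X j
    ... | zero  = contradiction refl late
    ... | suc _ = refl
    start-ok : ∀ t c → t ≢ 0 → o ∸ slack X j ≡ 0 → react X (event κ j o t) c ≡ c ∸ 1
    start-ok zero    c ne ok = contradiction refl ne
    start-ok (suc t) c ne ok rewrite ok = refl
    end-alive : ∀ t c → t ≡ 0 → c ≢ 0 → react X (event κ j o t) c ≡ suc c
    end-alive .0 zero    refl ne = contradiction refl ne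
    end-alive .0 (suc c) refl ne = refl
    end-dead : ∀ t c → t ≡ 0 → c ≡ 0 → react X (event κ j o t) c ≡ c
    end-dead .0 .0 refl refl = refl
    set : ∀ {v} → v ≡ f x (T x) → Swept f T (suc x) (update (arr h′ tableᵃ) x v)
    set {v} v≡ = swept-step {f} {T} _ S (trans (update-same (arr h′ tableᵃ) x v refl) v≡) (λ y ne → update-other (arr h′ tableᵃ) x v ne)

-- `retire` maximises over one digit in two scans in place: prefix maxima along the digit, then the
-- value at digit `σ` is spread to all its values. `topᵛ` is `B ^ suc k - B ^ k`, that is
-- `σ * B ^ k`, the weight of digit `σ`. `growTable` obtains `B * M` by adding `M` repeatedly.
prefixMaxBody lastDigitBody retire growTable : Cmd
prefixMaxBody = ifNonzero (var dgᵛ)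
  (tableᵃ [ var xᵛ ]≔ tableᵃ ! (var xᵛ ⊖ var bkᵛ) ⊕ (tableᵃ ! var xᵛ ⊖ tableᵃ ! (var xᵛ ⊖ var bkᵛ))) skip
lastDigitBody = tableᵃ [ var xᵛ ]≔ tableᵃ ! (var xᵛ ⊕ (var topᵛ ⊖ var zᵛ))
retire = scan prefixMaxBody ⨾ topᵛ ≔ powᵃ ! (lit 1 ⊕ var slotᵛ) ⊖ var bkᵛ ⨾ scan lastDigitBody ⨾
  slotᵃ [ var jobᵛ ]≔ lit 0 ⨾ spareᵃ [ var Fᵛ ]≔ var slotᵛ ⨾ Fᵛ ≔ lit 1 ⊕ var Fᵛ
growTable = sizeᵛ ≔ lit 0 ⨾ repeat (var Bᵛ) (sizeᵛ ≔ var Mᵛ ⊕ var sizeᵛ) ⨾ yᵛ ≔ lit 0 ⨾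
  repeat (var sizeᵛ ⊖ var Mᵛ) (tableᵃ [ var Mᵛ ⊕ var yᵛ ]≔ tableᵃ ! var yᵛ ⨾ yᵛ ≔ lit 1 ⊕ var yᵛ) ⨾
  Mᵛ ≔ var sizeᵛ ⨾ rᵛ ≔ lit 1 ⊕ var rᵛ ⨾ powᵃ [ var rᵛ ]≔ var Mᵛ

IsMax : ℕ → ℕ → ℕ → (ℕ → ℕ) → ℕ → ℕ → Set
IsMax σ k d T x v = (∀ o → o ≤ d → T (setDig σ k o x) ≤ v) × ∃[ o ] o ≤ d × v ≡ T (setDig σ k o x)

-- Indices are visited in increasing order, so the entry `B ^ k` cells earlier, whose digit is one
-- less, already holds its prefix maximum while the current entry is still original.
prefixMax-runs : ∀ {σ k h M} → val h bkᵛ ≡ suc σ ^ k → val h Bᵛ ≡ suc σ → val h Mᵛ ≡ M →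
  Runs (scan prefixMaxBody) (5 + M * 12) (λ h′ → ∀ x → x < M → IsMax σ k (dig σ k x) (arr h tableᵃ) x (arr h′ tableᵃ x)) h
prefixMax-runs {σ} {k} {h} {M} bk≡ B≡ M≡ = runs-map ≤-refl (λ _ _ → proj₁)
  (scan-runs {σ} {k} {prefixMaxBody} {2} M Inv refl bk≡ B≡ M≡ ((λ _ ()) , λ _ _ → refl) step)
  where
  T = arr h tableᵃ
  p = suc σ ^ k
  Inv : ℕ → (ℕ → ℕ) → Set
  Inv x T′ = (∀ y → y < x → IsMax σ k (dig σ k y) T y (T′ y)) × (∀ y → x ≤ y → T′ y ≡ T y)
  extend : ∀ {x T′} T″ → Inv x T′ → IsMax σ k (dig σ k x) T x (T″ x) → (∀ y → y ≢ x → T″ y ≡ T′ y) → Inv (suc x) T″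
  extend {x} T″ (old , later) new same =
    (λ y y<sx → case m≤n⇒m<n∨m≡n (≤-pred y<sx) of λ
      { (inj₁ y<x) → subst (IsMax σ k (dig σ k y) T y) (sym (same y (<⇒≢ y<x))) (old y y<x) ; (inj₂ refl) → new })
    , λ y x<y → trans (same y (>⇒≢ x<y)) (later y (<⇒≤ x<y))
  first : ∀ x → dig σ k x ≡ 0 → IsMax σ k (dig σ k x) T x (T x)
  first x d≡0 = (λ o o≤ → ≤-reflexive (cong T (trans (cong (λ o → setDig σ k o x) (trans (n≤0⇒n≡0 (≤-trans o≤ (≤-reflexive d≡0))) (sym d≡0))) (setDig-dig k x))))
    , dig σ k x , ≤-refl , cong T (sym (setDig-dig k x))
  next : ∀ x d {u} → dig σ k x ≡ suc d → IsMax σ k d T (setDig σ k d x) u → IsMax σ k (dig σ k x) T x (u ⊔ T x)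
  next x d {u} d≡ (upper , o , o≤d , u≡) = upper′ , attained
    where
    d<B : d < suc σ
    d<B = <-trans ≤-refl (subst (_< suc σ) d≡ (dig< k x))
    same : ∀ o → T (setDig σ k o (setDig σ k d x)) ≡ T (setDig σ k o x)
    same o = cong T (setDig-setDig k x d<B)
    upper′ : ∀ o → o ≤ dig σ k x → T (setDig σ k o x) ≤ u ⊔ T x
    upper′ o o≤ with m≤n⇒m<n∨m≡n o≤
    ... | inj₁ o< = ≤-trans (≤-trans (≤-reflexive (sym (same o))) (upper o (≤-pred (subst (o <_) d≡ o<)))) (m≤m⊔n u (T x))
    ... | inj₂ refl = ≤-trans (≤-reflexive (cong T (setDig-dig k x))) (m≤n⊔m u (T x))
    attained : ∃[ o ] o ≤ dig σ k x × u ⊔ T x ≡ T (setDig σ k o x)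
    attained with ≤-total u (T x)
    ... | inj₁ u≤ = dig σ k x , ≤-refl , trans (m≤n⇒m⊔n≡n u≤) (cong T (sym (setDig-dig k x)))
    ... | inj₂ u≥ = o , ≤-trans o≤d (≤-trans (n≤1+n d) (≤-reflexive (sym d≡))) , trans (m≥n⇒m⊔n≡m u≥) (trans u≡ (same o))
  step : ∀ x h′ → x < M → Agree (scan prefixMaxBody) h h′ → val h′ xᵛ ≡ x → val h′ dgᵛ ≡ dig σ k x → val h′ zᵛ ≡ dig σ k x * p →
    Inv x (arr h′ tableᵃ) → Runs prefixMaxBody 2 (λ h″ → Inv (suc x) (arr h″ tableᵃ)) h′
  step x h′ x<M ag refl dg≡ _ inv@(old , later) = runs-if
    (λ ne → ≤-refl ▹ extend _ inv (subst (IsMax σ k (dig σ k x) T x) (sym (trans (update-same T′ x _ refl) (value ne))) (maximum ne))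
      (λ y → update-other T′ x _))
    (λ z → ≤-refl ▹ extend T′ inv (subst (IsMax σ k (dig σ k x) T x) (sym (later x ≤-refl)) (first x (trans (sym dg≡) z))) (λ _ _ → refl))
    where
    T′ = arr h′ tableᵃ
    bk′ : val h′ bkᵛ ≡ p
    bk′ = trans (val≡ ag bkᵛ refl) bk≡
    d = dig σ k x ∸ 1
    d≡ : val h′ dgᵛ ≢ 0 → dig σ k x ≡ suc d
    d≡ ne = sym (m+[n∸m]≡n (n≢0⇒n>0 (ne ∘ trans dg≡)))
    y+p : val h′ dgᵛ ≢ 0 → setDig σ k d x + p ≡ x
    y+p ne = +-cancelʳ-≡ (d * p) _ _ (trans (+-assoc (setDig σ k d x) p (d * p)) (trans (cong (λ c → setDig σ k d x + c * p) (sym (d≡ ne))) (setDig-address k d x)))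
    y≡ : val h′ dgᵛ ≢ 0 → x ∸ val h′ bkᵛ ≡ setDig σ k d x
    y≡ ne = trans (cong (x ∸_) bk′) (trans (cong (_∸ p) (sym (y+p ne))) (m+n∸n≡m (setDig σ k d x) p))
    value : val h′ dgᵛ ≢ 0 → T′ (x ∸ val h′ bkᵛ) + (T′ x ∸ T′ (x ∸ val h′ bkᵛ)) ≡ T′ (setDig σ k d x) ⊔ T x
    value ne = trans (m+[n∸m]≡m⊔n (T′ (x ∸ val h′ bkᵛ)) (T′ x)) (cong₂ _⊔_ (cong T′ (y≡ ne)) (later x ≤-refl))
    maximum : val h′ dgᵛ ≢ 0 → IsMax σ k (dig σ k x) T x (T′ (setDig σ k d x) ⊔ T x)
    maximum ne = next x d (d≡ ne) (subst (λ c → IsMax σ k c T (setDig σ k d x) (T′ (setDig σ k d x)))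
      (dig-setDig k x (<-trans ≤-refl (subst (_< suc σ) (d≡ ne) (dig< k x))))
      (old (setDig σ k d x) (subst (setDig σ k d x <_) (y+p ne) (m<m+n _ (m^n>0 (suc σ) k)))))

lastDigit-runs : ∀ {σ k h M} → val h bkᵛ ≡ suc σ ^ k → val h Bᵛ ≡ suc σ → val h Mᵛ ≡ M → val h topᵛ ≡ σ * suc σ ^ k →
  Runs (scan lastDigitBody) (5 + M * 11) (λ h′ → ∀ x → x < M → arr h′ tableᵃ x ≡ arr h tableᵃ (setDig σ k σ x)) h
lastDigit-runs {σ} {k} {h} {M} bk≡ B≡ M≡ top≡ = runs-map ≤-refl (λ _ _ → proj₁)
  (scan-runs {σ} {k} {lastDigitBody} {1} M Inv refl bk≡ B≡ M≡ ((λ _ ()) , λ _ _ → refl) step)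
  where
  T = arr h tableᵃ
  p = suc σ ^ k
  Inv : ℕ → (ℕ → ℕ) → Set
  -- An entry with digit `σ` is overwritten by its own value, so it stays a valid source during the
  -- whole scan.
  Inv x T′ = (∀ y → y < x → T′ y ≡ T (setDig σ k σ y)) × (∀ y → x ≤ y ⊎ dig σ k y ≡ σ → T′ y ≡ T y)
  step : ∀ x h′ → x < M → Agree (scan lastDigitBody) h h′ → val h′ xᵛ ≡ x → val h′ dgᵛ ≡ dig σ k x → val h′ zᵛ ≡ dig σ k x * p →
    Inv x (arr h′ tableᵃ) → Runs lastDigitBody 1 (λ h″ → Inv (suc x) (arr h″ tableᵃ)) h′
  step x h′ x<M ag refl dg≡ z≡ (old , later) = ≤-refl ▹
    (λ y y<sx → case m≤n⇒m<n∨m≡n (≤-pred y<sx) of λ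
      { (inj₁ y<x) → trans (update-other T′ x _ (<⇒≢ y<x)) (old y y<x) ; (inj₂ refl) → new })
    , λ y why → case y ≟ x of λ
      { (yes refl) → [ (λ x<x → contradiction x<x (<-irrefl refl))
                     , (λ d≡ → trans new (cong T (trans (cong (λ o → setDig σ k o x) (sym d≡)) (setDig-dig k x)))) ]′ why
      ; (no ne) → trans (update-other T′ x _ ne) (later y ([ (λ x<y → inj₁ (<⇒≤ x<y)) , inj₂ ]′ why)) }
    where
    T′ = arr h′ tableᵃ
    d = dig σ k x
    address : x + (val h′ topᵛ ∸ val h′ zᵛ) ≡ setDig σ k σ x
    address = trans (cong₂ (λ a b → x + (a ∸ b)) (trans (val≡ ag topᵛ refl) top≡) z≡) (+-cancelʳ-≡ (d * p) _ _
      (trans (+-assoc x _ _) (trans (cong (x +_) (m∸n+n≡m (*-monoˡ-≤ p (≤-pred (dig< k x))))) (sym (setDig-address k σ x)))))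
    new : update T′ x (T′ (x + (val h′ topᵛ ∸ val h′ zᵛ))) x ≡ T (setDig σ k σ x)
    new = trans (update-same T′ x _ refl) (trans (cong T′ address) (later _ (inj₂ (dig-setDig k x ≤-refl))))

record Retired (σ k M : ℕ) (h h′ : Store) : Set where
  field
    maximal    : ∀ x → x < M → IsMax σ k σ (arr h tableᵃ) x (arr h′ tableᵃ x)
    slot-job   : arr h′ slotᵃ (val h jobᵛ) ≡ 0
    slot-other : ∀ j → j ≢ val h jobᵛ → arr h′ slotᵃ j ≡ arr h slotᵃ j
    spare-top  : arr h′ spareᵃ (val h Fᵛ) ≡ k
    spare-rest : ∀ l → l < val h Fᵛ → arr h′ spareᵃ l ≡ arr h spareᵃ l
    F≡         : val h′ Fᵛ ≡ suc (val h Fᵛ)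

retire-runs : ∀ {σ k r h} → k < r → val h slotᵛ ≡ k → val h bkᵛ ≡ suc σ ^ k → val h Bᵛ ≡ suc σ → val h Mᵛ ≡ suc σ ^ r →
  arr h powᵃ (suc k) ≡ suc σ ^ suc k → Runs retire (14 + suc σ ^ r * 23) (Retired σ k (suc σ ^ r) h) h
retire-runs {σ} {k} {r} {h} k<r slot≡ bk≡ B≡ M≡ pow≡ = runs-map (≤-reflexive (lemma M)) (λ _ _ q → q)
  (runs-⨾ (prefixMax-runs {σ} {k} bk≡ B≡ M≡) λ h₁ ag₁ max₁ → runs-exec {k = 1} ≤-refl
  (runs-⨾ (lastDigit-runs {σ} {k} {exec (topᵛ ≔ powᵃ ! (lit 1 ⊕ var slotᵛ) ⊖ var bkᵛ) h₁} (trans (val≡ ag₁ bkᵛ refl) bk≡) (trans (val≡ ag₁ Bᵛ refl) B≡)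
      (trans (val≡ ag₁ Mᵛ refl) M≡) (top h₁ ag₁)) λ h₂ ag₂ last₂ → ≤-refl {3} ▹ record
    { maximal    = λ x x<M → subst (IsMax σ k σ (arr h tableᵃ) x) (sym (last₂ x x<M)) (whole h₁ max₁ x x<M)
    ; slot-job   = update-same (arr h₂ slotᵃ) (val h₂ jobᵛ) 0 (sym (same-job h₁ h₂ ag₁ ag₂))
    ; slot-other = λ j ne → trans (update-other (arr h₂ slotᵃ) (val h₂ jobᵛ) 0 (λ e → ne (trans e (same-job h₁ h₂ ag₁ ag₂))))
        (trans (arr≡ ag₂ slotᵃ refl j) (arr≡ ag₁ slotᵃ refl j))
    ; spare-top  = trans (update-same (arr h₂ spareᵃ) (val h₂ Fᵛ) _ (sym (same-F h₁ h₂ ag₁ ag₂)))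
        (trans (val≡ ag₂ slotᵛ refl) (trans (val≡ ag₁ slotᵛ refl) slot≡))
    ; spare-rest = λ l l<F → trans (update-other (arr h₂ spareᵃ) (val h₂ Fᵛ) _ (λ e → <⇒≢ l<F (trans e (same-F h₁ h₂ ag₁ ag₂))))
        (trans (arr≡ ag₂ spareᵃ refl l) (arr≡ ag₁ spareᵃ refl l))
    ; F≡         = cong suc (same-F h₁ h₂ ag₁ ag₂) }))
  where
  p = suc σ ^ k
  M = suc σ ^ r
  lemma : ∀ M → 5 + M * 12 + (1 + (5 + M * 11 + 3)) ≡ 14 + M * 23
  lemma = solve-∀
  same-job : ∀ h₁ h₂ → Agree (scan prefixMaxBody) h h₁ → Agree (scan lastDigitBody) _ h₂ → val h₂ jobᵛ ≡ val h jobᵛ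
  same-job h₁ h₂ ag₁ ag₂ = trans (val≡ ag₂ jobᵛ refl) (val≡ ag₁ jobᵛ refl)
  same-F : ∀ h₁ h₂ → Agree (scan prefixMaxBody) h h₁ → Agree (scan lastDigitBody) _ h₂ → val h₂ Fᵛ ≡ val h Fᵛ
  same-F h₁ h₂ ag₁ ag₂ = trans (val≡ ag₂ Fᵛ refl) (val≡ ag₁ Fᵛ refl)
  top : ∀ h₁ → Agree (scan prefixMaxBody) h h₁ → arr h₁ powᵃ (suc (val h₁ slotᵛ)) ∸ val h₁ bkᵛ ≡ σ * p
  top h₁ ag₁ = trans (cong₂ _∸_ (trans (arr≡ ag₁ powᵃ refl _) (trans (cong (arr h powᵃ ∘ suc) (trans (val≡ ag₁ slotᵛ refl) slot≡)) pow≡))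
    (trans (val≡ ag₁ bkᵛ refl) bk≡)) (m+n∸m≡n p (σ * p))
  whole : ∀ h₁ → (∀ x → x < M → IsMax σ k (dig σ k x) (arr h tableᵃ) x (arr h₁ tableᵃ x)) →
    ∀ x → x < M → IsMax σ k σ (arr h tableᵃ) x (arr h₁ tableᵃ (setDig σ k σ x))
  whole h₁ max₁ x x<M with max₁ (setDig σ k σ x) (setDig< k<r ≤-refl x<M)
  ... | upper , o , o≤ , v≡ rewrite dig-setDig k x (≤-refl {suc σ}) =
    (λ o o≤ → subst (_≤ arr h₁ tableᵃ (setDig σ k σ x)) (cong (arr h tableᵃ) (setDig-setDig k x ≤-refl)) (upper o o≤))
    , o , o≤ , trans v≡ (cong (arr h tableᵃ) (setDig-setDig k x ≤-refl))

record Grown (σ r : ℕ) (h h′ : Store) : Set where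
  field
    r≡    : val h′ rᵛ ≡ suc r
    M≡    : val h′ Mᵛ ≡ suc σ ^ suc r
    pow≡  : ∀ k → k ≤ r → arr h′ powᵃ k ≡ arr h powᵃ k
    top≡  : arr h′ powᵃ (suc r) ≡ suc σ ^ suc r
    table : ∀ x → x < suc σ ^ suc r → arr h′ tableᵃ x ≡ arr h tableᵃ (wrap {σ} r x)

growTable-runs : ∀ {σ r h} → val h Bᵛ ≡ suc σ → val h rᵛ ≡ r → val h Mᵛ ≡ suc σ ^ r →
  Runs growTable (7 + suc σ * 2 + suc σ ^ suc r * 3) (Grown σ r h) h
growTable-runs {σ} {r} {h} B≡ r≡ M≡ = runs-map (≤-reflexive (lemma (suc σ * 2) (suc σ ^ suc r * 3))) (λ _ _ q → q)
  (runs-exec {k = 1} ≤-refl (runs-⨾ (runs-repeat Size {h = h₀} B≡ refl λ i h′ _ ag size≡ →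
      ≤-refl ▹ cong₂ _+_ (trans (val≡ ag Mᵛ refl) M≡) size≡)
   λ h₁ ag₁ size₁ → runs-exec {k = 1} ≤-refl (runs-⨾
     (runs-map {k = suc ((suc σ ^ suc r ∸ M) * 3)} (s≤s (*-monoˡ-≤ 3 (m∸n≤m (suc σ ^ suc r) M))) (λ _ _ q → q)
       (runs-repeat (Inv h₁) {h = exec (yᵛ ≔ lit 0) h₁} (cong₂ _∸_ size₁ (trans (val≡ ag₁ Mᵛ refl) M≡))
         (refl , λ x x<M → trans (arr≡ ag₁ tableᵃ refl x) (cong T (sym (wrap-small r (subst (x <_) (+-identityʳ M) x<M)))))
         (step h₁ ag₁)))
     λ h₂ ag₂ (_ , table₂) → ≤-refl {3} ▹
       (let r₂ = cong suc (trans (val≡ ag₂ rᵛ refl) (trans (val≡ ag₁ rᵛ refl) r≡))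
            M₂ = trans (val≡ ag₂ sizeᵛ refl) size₁ in record
       { r≡ = r₂ ; M≡ = M₂
       ; pow≡ = λ k k≤r → trans (update-other (arr h₂ powᵃ) (suc (val h₂ rᵛ)) _ (λ e → <⇒≱ (s≤s k≤r) (≤-reflexive (sym (trans e r₂)))))
           (trans (arr≡ ag₂ powᵃ refl k) (arr≡ ag₁ powᵃ refl k))
       ; top≡ = trans (update-same (arr h₂ powᵃ) (suc (val h₂ rᵛ)) _ (sym r₂)) M₂
       ; table = λ x x< → table₂ x (subst (x <_) (sym (m+[n∸m]≡n (m≤m+n M (σ * M)))) x<) }))))
  where
  M = suc σ ^ r
  T = arr h tableᵃ
  h₀ : Store
  h₀ = exec (sizeᵛ ≔ lit 0) h
  lemma : ∀ a b → 1 + (suc a + (1 + (suc b + 3))) ≡ 7 + a + b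
  lemma = solve-∀
  Size : ℕ → Store → Set
  Size i h′ = val h′ sizeᵛ ≡ i * M
  Inv : Store → ℕ → Store → Set
  Inv h₁ y h′ = val h′ yᵛ ≡ y × ∀ x → x < M + y → arr h′ tableᵃ x ≡ T (wrap {σ} r x)
  step : ∀ h₁ → Agree (repeat (var Bᵛ) (sizeᵛ ≔ var Mᵛ ⊕ var sizeᵛ)) h₀ h₁ → ∀ y h′ → y < suc σ ^ suc r ∸ M →
    Agree _ (exec (yᵛ ≔ lit 0) h₁) h′ → Inv h₁ y h′ →
    Runs (tableᵃ [ var Mᵛ ⊕ var yᵛ ]≔ tableᵃ ! var yᵛ ⨾ yᵛ ≔ lit 1 ⊕ var yᵛ) 2 (Inv h₁ (suc y)) h′
  step h₁ ag₁ y h′ _ ag (refl , filled) = ≤-refl ▹ refl , λ x x< →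
    case m≤n⇒m<n∨m≡n (≤-pred (subst (x <_) (+-suc M y) x<)) of λ
      { (inj₁ x<) → trans (update-other (arr h′ tableᵃ) (val h′ Mᵛ + y) _ (λ e → <⇒≢ x< (trans e m≡))) (filled x x<)
      -- The source cell `y` may itself be a copy; the filled part has period `M`, which is
      -- `wrap-+`.
      ; (inj₂ refl) → trans (update-same (arr h′ tableᵃ) (val h′ Mᵛ + y) _ (sym m≡))
          (trans (filled y (m<n+m y (m^n>0 (suc σ) r))) (cong T (sym (wrap-+ r y)))) }
    where
    m≡ : val h′ Mᵛ + y ≡ M + y
    m≡ = cong (_+ y) (trans (val≡ ag Mᵛ refl) (trans (val≡ ag₁ Mᵛ refl) M≡))

-- A job is activated before its first event is applied and retired after its last, so it owns a
-- slot whenever one of its events is applied. `Aᵛ` holds the bound on active jobs; `activate` sets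
-- `badᵛ` instead of exceeding it.
loadEvent activate process handle dpInit dpLoop : Cmd
loadEvent = jobᵛ ≔ jobᵃ ! var eᵛ ⨾ offᵛ ≔ offᵃ ! var eᵛ ⨾ kindᵛ ≔ kindᵃ ! var eᵛ
activate = ifNonzero (var Fᵛ) (Fᵛ ≔ var Fᵛ ⊖ lit 1 ⨾ slotᵃ [ var jobᵛ ]≔ lit 1 ⊕ spareᵃ ! var Fᵛ)
  (ifNonzero (var Aᵛ ⊖ var rᵛ) (growTable ⨾ slotᵃ [ var jobᵛ ]≔ var rᵛ) (badᵛ ≔ lit 1))
process = slotᵛ ≔ slotᵃ ! var jobᵛ ⊖ lit 1 ⨾ bkᵛ ≔ powᵃ ! var slotᵛ ⨾ applyEvent ⨾
  ifNonzero (var kindᵛ) skip (ifNonzero (var σᵛ ⊖ var offᵛ) skip retire)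
handle = loadEvent ⨾ ifNonzero (var kindᵛ) (ifNonzero (var offᵛ) skip activate) skip ⨾ ifNonzero (var badᵛ) skip process
dpInit = Bᵛ ≔ lit 1 ⊕ var σᵛ ⨾ Aᵛ ≔ var mᵛ ⨾ repeat (var σᵛ) (Aᵛ ≔ (var mᵛ ⊕ var mᵛ) ⊕ var Aᵛ) ⨾
  rᵛ ≔ lit 0 ⨾ Fᵛ ≔ lit 0 ⨾ Mᵛ ≔ lit 1 ⨾ powᵃ [ lit 0 ]≔ lit 1 ⨾ tableᵃ [ lit 0 ]≔ lit 1 ⊕ var mᵛ ⨾ eᵛ ≔ lit 0
dpLoop = repeat (var Nᵛ) (ifNonzero (var badᵛ) skip handle ⨾ eᵛ ≔ lit 1 ⊕ var eᵛ)

module _ {X : Jobs} {σ N : ℕ} {ev : ℕ → Event} (L : EventList X σ N ev) (slack≤σ : ∀ j → j < number X → slack X j ≤ σ) (m : ℕ) where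

  private
    n : ℕ
    n = number X
    A : ℕ
    A = suc (σ + σ) * m
    S : ℕ
    S = suc σ ^ A

  Infeasible : Set
  Infeasible = ∀ α → ¬ Placement X m α

  record Sized (h : Store) : Set where
    constructor sized
    field
      r≤ : val h rᵛ ≤ A
      M≡ : val h Mᵛ ≡ suc σ ^ val h rᵛ

    M≤S : suc σ ^ val h rᵛ ≤ S
    M≤S = ^-monoʳ-≤ (suc σ) r≤

  record Good (a b c : ℕ) (h : Store) : Set where
    field
      powers   : ∀ k → k ≤ val h rᵛ → arr h powᵃ k ≡ suc σ ^ k
      slots    : Slots n (val h rᵛ) (arr h slotᵃ) (arr h spareᵃ) (val h Fᵛ)
      table    : Tabulates n σ (λ α → free X m ev α c) (val h rᵛ) (arr h slotᵃ) (arr h tableᵃ)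
      progress : Progress L a b (arr h slotᵃ) (val h Fᵛ) (val h rᵛ)

  -- Once `badᵛ` is set, the table is abandoned, and a proof that no placement exists replaces its
  -- invariant.
  Status : ℕ → ℕ → ℕ → Store → Set
  Status a b c h = (val h badᵛ ≢ 0 × Infeasible) ⊎ (val h badᵛ ≡ 0 × Good a b c h)

  record Loaded (i : ℕ) (h : Store) : Set where
    constructor loaded
    field
      job≡  : val h jobᵛ ≡ jobOf (ev i)
      off≡  : val h offᵛ ≡ off (ev i)
      kind≡ : val h kindᵛ ≡ kind (ev i)

  activate-runs : ∀ {i h} → i < N → kind (ev i) ≡ 1 → off (ev i) ≡ 0 → val h jobᵛ ≡ jobOf (ev i) →
    val h Bᵛ ≡ suc σ → val h Aᵛ ≡ A → val h badᵛ ≡ 0 → Sized h → Good i i i h →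
    Runs activate (10 + S * 5) (λ h′ → Sized h′ × Status (suc i) i i h′) h
  activate-runs {i} {h} i<N k o job≡ B≡ A≡ bad≡ Z G = runs-if pop (λ F≡0 → runs-if (grow F≡0) (overflow F≡0))
    where
    open Sized Z
    open Good G
    j = jobOf (ev i)
    j<n : j < n
    j<n = Valid.job< (all-valid L i i<N)
    unused : arr h slotᵃ j ≡ 0
    unused = fresh L i<N k o progress
    pop : val h Fᵛ ≢ 0 → Runs (Fᵛ ≔ var Fᵛ ⊖ lit 1 ⨾ slotᵃ [ var jobᵛ ]≔ lit 1 ⊕ spareᵃ ! var Fᵛ) (9 + S * 5) (λ h′ → Sized h′ × Status (suc i) i i h′) h
    pop F≢0 = s≤s (s≤s z≤n) ▹ sized r≤ M≡ , inj₂ (bad≡ , record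
      { powers   = powers
      ; slots    = Slots.slots-pop slots F≡ j<n unused new same
      ; table    = tabulates-activate j _ unused new same (free-unstarted L m i<N k o) table
      ; progress = progress-start L i<N k o (λ z → case trans (sym new) z of λ ()) same
                     (trans (cong (val h rᵛ +_) F≡) (trans (+-suc _ _) (cong suc (+-comm (val h rᵛ) _)))) progress })
      where
      G′ = val h Fᵛ ∸ 1
      F≡ : val h Fᵛ ≡ suc G′
      F≡ = sym (m+[n∸m]≡n (n≢0⇒n>0 F≢0))
      new : update (arr h slotᵃ) (val h jobᵛ) (suc (arr h spareᵃ G′)) j ≡ suc (arr h spareᵃ G′)
      new = update-same (arr h slotᵃ) (val h jobᵛ) _ (sym job≡)
      same : ∀ l → l ≢ j → update (arr h slotᵃ) (val h jobᵛ) (suc (arr h spareᵃ G′)) l ≡ arr h slotᵃ l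
      same l ne = update-other (arr h slotᵃ) (val h jobᵛ) _ (λ e → ne (trans e job≡))
    grow : val h Fᵛ ≡ 0 → val h Aᵛ ∸ val h rᵛ ≢ 0 → Runs (growTable ⨾ slotᵃ [ var jobᵛ ]≔ var rᵛ) (8 + S * 5) (λ h′ → Sized h′ × Status (suc i) i i h′) h
    grow F≡0 ne = runs-map time≤S (λ _ _ q → q) (runs-⨾ (growTable-runs {σ} {val h rᵛ} B≡ refl M≡) λ h₁ ag₁ g → ≤-refl {1} ▹ grown h₁ ag₁ g)
      where
      r<A : val h rᵛ < A
      r<A = subst (val h rᵛ <_) A≡ (∸≢0⇒< ne)
      M≤ : suc σ ^ suc (val h rᵛ) ≤ S
      M≤ = ^-monoʳ-≤ (suc σ) r<A
      time≤S : 7 + suc σ * 2 + suc σ ^ suc (val h rᵛ) * 3 + 1 ≤ 8 + S * 5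
      time≤S = ≤-trans (+-monoˡ-≤ 1 (+-mono-≤ (+-monoʳ-≤ 7 (*-monoˡ-≤ 2 (≤-trans (m≤m*n (suc σ) (suc σ ^ val h rᵛ) {{m^n≢0 (suc σ) (val h rᵛ)}}) M≤)))
        (*-monoˡ-≤ 3 M≤))) (≤-reflexive (lemma S))
        where
        lemma : ∀ s → 7 + s * 2 + s * 3 + 1 ≡ 8 + s * 5
        lemma = solve-∀
      grown : ∀ h₁ → Agree growTable h h₁ → Grown σ (val h rᵛ) h h₁ → let h′ = exec (slotᵃ [ var jobᵛ ]≔ var rᵛ) h₁ in Sized h′ × Status (suc i) i i h′
      grown h₁ ag₁ g = sized (subst (_≤ A) (sym r≡) r<A) (trans (Grown.M≡ g) (cong (suc σ ^_) (sym r≡))) , inj₂ (trans (val≡ ag₁ badᵛ refl) bad≡ , record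
        { powers   = λ l l≤ → case m≤n⇒m<n∨m≡n (subst (l ≤_) r≡ l≤) of λ
            { (inj₁ l<) → trans (pow≡ l (≤-pred l<)) (powers l (≤-pred l<)) ; (inj₂ refl) → top≡ }
        ; slots    = slots-cong r≡ (λ _ → refl) (arr≡ ag₁ spareᵃ refl) F≡ (Slots.slots-grow slots F≡0 j<n unused new same)
        ; table    = tabulates-cong r≡ (λ _ → refl) (λ _ → refl) (tabulates-activate j (val h rᵛ) unused new same (free-unstarted L m i<N k o)
                       (tabulates-grow (Slots.slot< slots) (Grown.table g) table))
        ; progress = progress-cong L (λ _ → refl) F≡ r≡ (progress-start L i<N k o (λ z → case trans (sym new) z of λ ()) same
                       (cong suc (+-comm (val h rᵛ) _)) progress) })
        where
        open Grown g using (r≡; pow≡; top≡)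
        F≡ = val≡ ag₁ Fᵛ refl
        new : update (arr h₁ slotᵃ) (val h₁ jobᵛ) (val h₁ rᵛ) j ≡ suc (val h rᵛ)
        new = trans (update-same (arr h₁ slotᵃ) (val h₁ jobᵛ) _ (sym (trans (val≡ ag₁ jobᵛ refl) job≡))) r≡
        same : ∀ l → l ≢ j → update (arr h₁ slotᵃ) (val h₁ jobᵛ) (val h₁ rᵛ) l ≡ arr h slotᵃ l
        same l ne = trans (update-other (arr h₁ slotᵃ) (val h₁ jobᵛ) _ (λ e → ne (trans e (trans (val≡ ag₁ jobᵛ refl) job≡)))) (arr≡ ag₁ slotᵃ refl l)
    overflow : val h Fᵛ ≡ 0 → val h Aᵛ ∸ val h rᵛ ≡ 0 → Runs (badᵛ ≔ lit 1) (8 + S * 5) (λ h′ → Sized h′ × Status (suc i) i i h′) h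
    overflow F≡0 z = s≤s z≤n ▹ sized r≤ M≡ , inj₁ ((λ ()) , λ α P → <⇒≱ crowded (active-bound L m slack≤σ P i<N k o))
      where
      r≡A : val h rᵛ ≡ A
      r≡A = ≤-antisym r≤ (subst (_≤ val h rᵛ) A≡ (m∸n≡0⇒m≤n z))
      -- No spare slot and `r ≡ A` mean by `tally` that `A` jobs are active already; the one now
      -- starting exceeds `active-bound`, whatever the placement.
      crowded : A + ended L (λ _ → σ) i < started L (λ _ → 0) (suc i)
      crowded = ≤-reflexive (trans (cong suc (trans (cong (_+ ended L (λ _ → σ) i) (sym r≡A)) (trans (Progress.tally progress) (cong (_+ started L (λ _ → 0) i) F≡0))))
        (trans (+-comm 1 _) (cong (started L (λ _ → 0) i +_) (sym (ind-*-yes (kind (ev i) ≟ 1) (hit? (λ _ → 0) (ev i)) k (sym o))))))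

  process-runs : ∀ {i h} → i < N → Loaded i h → val h Bᵛ ≡ suc σ → val h σᵛ ≡ σ → (∀ j → j < n → arr h slackᵃ j ≡ slack X j) →
    val h badᵛ ≡ 0 → Sized h → Good (suc i) i i h →
    Runs process (23 + S * 37) (λ h′ → Sized h′ × Status (suc i) (suc i) (suc i) h′) h
  process-runs {i} {h} i<N (loaded job≡ off≡ kind≡) B≡ σ≡ slacks bad≡ Z G = runs-map time≤S (λ _ _ q → q)
    (runs-exec {k = 1} ≤-refl (runs-exec {k = 1} ≤-refl (runs-⨾
      (applyEvent-runs {X} {σ} {k} {h₁} {ev i} bk≡ B≡ M≡ off≡ kind≡ (trans (cong (arr h slackᵃ) job≡) (slacks j j<n)))
      λ h₂ ag₂ applied → runs-if {k = 15 + suc σ ^ r * 23}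
        (λ ne → s≤s z≤n ▹ skipped h₂ ag₂ applied (λ (_ , z) → ne (trans (trans (val≡ ag₂ kindᵛ refl) kind≡) z)))
        (λ z → runs-if
          (λ ne → s≤s z≤n ▹ skipped h₂ ag₂ applied (λ (o , _) → ne (trans (late h₂ ag₂) (m≤n⇒m∸n≡0 (≤-reflexive (sym o))))))
          (λ z′ → runs-map ≤-refl (λ h₃ ag₃ → retired h₂ ag₂ applied (trans (sym (trans (val≡ ag₂ kindᵛ refl) kind≡)) z)
              (≤-antisym (≤-pred (Valid.off< V)) (m∸n≡0⇒m≤n (trans (sym (late h₂ ag₂)) z′))) h₃ ag₃)
            (retire-runs {σ} {k} {r} k<r (val≡ ag₂ slotᵛ refl) (trans (val≡ ag₂ bkᵛ refl) bk≡) (trans (val≡ ag₂ Bᵛ refl) B≡) (trans (val≡ ag₂ Mᵛ refl) M≡)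
              (trans (arr≡ ag₂ powᵃ refl _) (powers (suc k) k<r))))))))
    where
    open Sized Z
    open Good G
    V = all-valid L i i<N
    j = jobOf (ev i)
    j<n : j < n
    j<n = Valid.job< V
    r = val h rᵛ
    k = arr h slotᵃ (val h jobᵛ) ∸ 1
    slot≡ : arr h slotᵃ j ≡ suc k
    slot≡ = trans (cong (arr h slotᵃ) (sym job≡)) (sym (m+[n∸m]≡n (n≢0⇒n>0 (subst (λ j → arr h slotᵃ j ≢ 0) (sym job≡) (owner L i<N progress)))))
    k<r : k < r
    k<r = Slots.slot< slots j k j<n slot≡
    h₁ : Store
    h₁ = exec (slotᵛ ≔ slotᵃ ! var jobᵛ ⊖ lit 1 ⨾ bkᵛ ≔ powᵃ ! var slotᵛ) h
    bk≡ : val h₁ bkᵛ ≡ suc σ ^ k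
    bk≡ = powers k (<⇒≤ k<r)
    time≤S : 1 + (1 + (5 + suc σ ^ r * 14 + (16 + suc σ ^ r * 23))) ≤ 23 + S * 37
    time≤S = ≤-trans (≤-reflexive (lemma (suc σ ^ r))) (+-monoʳ-≤ 23 (*-monoˡ-≤ 37 M≤S))
      where
      lemma : ∀ s → 1 + (1 + (5 + s * 14 + (16 + s * 23))) ≡ 23 + s * 37
      lemma = solve-∀
    late : ∀ h₂ → Agree applyEvent h₁ h₂ → val h₂ σᵛ ∸ val h₂ offᵛ ≡ σ ∸ off (ev i)
    late h₂ ag₂ = cong₂ _∸_ (trans (val≡ ag₂ σᵛ refl) σ≡) (trans (val≡ ag₂ offᵛ refl) off≡)
    Applied : Store → Set
    Applied h₂ = ∀ x → x < suc σ ^ r → arr h₂ tableᵃ x ≡ reactAt X (ev i) (dig σ k x) (arr h tableᵃ x)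
    tabulated : ∀ h₂ → Applied h₂ → Tabulates n σ (λ α → free X m ev α (suc i)) r (arr h slotᵃ) (arr h₂ tableᵃ)
    -- `free` at `suc i` unfolds to `reactAt` at the offset of the owner, hence the `refl`.
    tabulated h₂ applied = tabulates-step (reactAt X (ev i)) j k j<n slot≡ (reactAt-mono X (ev i)) (λ α → refl) applied table
    skipped : ∀ h₂ → Agree applyEvent h₁ h₂ → Applied h₂ → ¬ (off (ev i) ≡ σ × kind (ev i) ≡ 0) →
      Sized h₂ × Status (suc i) (suc i) (suc i) h₂
    skipped h₂ ag₂ applied miss = sized (subst (_≤ A) (sym r≡) r≤) (trans (val≡ ag₂ Mᵛ refl) (trans M≡ (cong (suc σ ^_) (sym r≡))))
      , inj₂ (trans (val≡ ag₂ badᵛ refl) bad≡ , record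
        { powers   = λ l l≤ → trans (arr≡ ag₂ powᵃ refl l) (powers l (subst (l ≤_) r≡ l≤))
        ; slots    = slots-cong r≡ (arr≡ ag₂ slotᵃ refl) (arr≡ ag₂ spareᵃ refl) (val≡ ag₂ Fᵛ refl) slots
        ; table    = tabulates-cong r≡ (arr≡ ag₂ slotᵃ refl) (λ _ → refl) (tabulated h₂ applied)
        ; progress = progress-cong L (arr≡ ag₂ slotᵃ refl) (val≡ ag₂ Fᵛ refl) r≡ (progress-skip-end L miss progress) })
      where r≡ = val≡ ag₂ rᵛ refl
    retired : ∀ h₂ → Agree applyEvent h₁ h₂ → Applied h₂ → kind (ev i) ≡ 0 → off (ev i) ≡ σ →
      ∀ h₃ → Agree retire h₂ h₃ → Retired σ k (suc σ ^ r) h₂ h₃ → Sized h₃ × Status (suc i) (suc i) (suc i) h₃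
    retired h₂ ag₂ applied κ o h₃ ag₃ R = sized (subst (_≤ A) (sym r≡) r≤)
        (trans (val≡ ag₃ Mᵛ refl) (trans (val≡ ag₂ Mᵛ refl) (trans M≡ (cong (suc σ ^_) (sym r≡)))))
      , inj₂ (trans (val≡ ag₃ badᵛ refl) (trans (val≡ ag₂ badᵛ refl) bad≡) , record
        { powers   = λ l l≤ → trans (arr≡ ag₃ powᵃ refl l) (trans (arr≡ ag₂ powᵃ refl l) (powers l (subst (l ≤_) r≡ l≤)))
        ; slots    = slots-cong r≡ (λ _ → refl) (λ _ → refl) F≡′ (Slots.slots-push slots j<n slot≡ cleared same
                       (trans (cong (arr h₃ spareᵃ) (sym F₂)) spare-top)
                       (λ l l<F → trans (spare-rest l (subst (l <_) (sym F₂) l<F)) (arr≡ ag₂ spareᵃ refl l)))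
        ; table    = tabulates-cong r≡ (λ _ → refl) (λ _ → refl) (tabulates-retire j k k<r slot≡ cleared same
                       (λ l l<n ne → Slots.distinct slots l j k l<n j<n ne slot≡)
                       (λ x x< → let upper , o , o≤ , e = maximal x x< in (λ o o< → upper o (≤-pred o<)) , o , s≤s o≤ , e)
                       (tabulated h₂ applied))
        ; progress = progress-cong L (λ _ → refl) F≡′ r≡ (progress-end L κ o cleared same progress) })
      where
      open Retired R
      r≡ = trans (val≡ ag₃ rᵛ refl) (val≡ ag₂ rᵛ refl)
      F₂ = val≡ ag₂ Fᵛ refl
      F≡′ : val h₃ Fᵛ ≡ suc (val h Fᵛ)
      F≡′ = trans F≡ (cong suc F₂)
      j₂ : val h₂ jobᵛ ≡ j
      j₂ = trans (val≡ ag₂ jobᵛ refl) job≡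
      cleared : arr h₃ slotᵃ j ≡ 0
      cleared = trans (cong (arr h₃ slotᵃ) (sym j₂)) slot-job
      same : ∀ l → l ≢ j → arr h₃ slotᵃ l ≡ arr h slotᵃ l
      same l ne = trans (slot-other l (λ e → ne (trans e j₂))) (arr≡ ag₂ slotᵃ refl l)

-- Without machines the load criterion fails: a job of processing time 0 causes no load yet must be
-- assigned to a machine. So `m ≡ 0` is treated apart, and the answer is yes only for `n ≡ 0`.
answer dynamicProgram main : Cmd
answer = ifNonzero (var badᵛ) (nᵛ ≔ lit 0) (nᵛ ≔ tableᵃ ! lit 0)
dynamicProgram = dpInit ⨾ dpLoop ⨾ answer
main = ifNonzero (var mᵛ) (collect ⨾ ifNonzero (var badᵛ) (nᵛ ≔ lit 0) (order ⨾ dynamicProgram)) (nᵛ ≔ lit 1 ⊖ var nᵛ)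

module _ {X : Jobs} {σ N : ℕ} {ev : ℕ → Event} (L : EventList X σ N ev) (slack≤σ : ∀ j → j < number X → slack X j ≤ σ) (m : ℕ) where

  private
    n : ℕ
    n = number X
    A : ℕ
    A = suc (σ + σ) * m
    S : ℕ
    S = suc σ ^ A
    Sized′ : Store → Set
    Sized′ = Sized L slack≤σ m
    Good′ : ℕ → ℕ → ℕ → Store → Set
    Good′ = Good L slack≤σ m
    Status′ : ℕ → ℕ → ℕ → Store → Set
    Status′ = Status L slack≤σ m

  good-transport : ∀ {a b c h h′} → val h′ rᵛ ≡ val h rᵛ → val h′ Fᵛ ≡ val h Fᵛ → arr h′ ≡ arr h → Good′ a b c h → Good′ a b c h′
  good-transport r≡ F≡ refl G = record
    { powers   = λ k k≤ → powers k (subst (k ≤_) r≡ k≤)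
    ; slots    = slots-cong r≡ (λ _ → refl) (λ _ → refl) F≡ slots
    ; table    = tabulates-cong r≡ (λ _ → refl) (λ _ → refl) table
    ; progress = progress-cong L (λ _ → refl) F≡ r≡ progress }
    where open Good G

  sized-transport : ∀ {h h′} → val h′ rᵛ ≡ val h rᵛ → val h′ Mᵛ ≡ val h Mᵛ → Sized′ h → Sized′ h′
  sized-transport r≡ M≡ (sized r≤ M≡r) = sized (subst (_≤ A) (sym r≡) r≤) (trans M≡ (trans M≡r (cong (suc σ ^_) (sym r≡))))

  record Context (h : Store) : Set where
    constructor context
    field
      B≡     : val h Bᵛ ≡ suc σ
      A≡     : val h Aᵛ ≡ A
      σ≡     : val h σᵛ ≡ σ
      slacks : ∀ j → j < n → arr h slackᵃ j ≡ slack X j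
      evs    : ∀ x → events h x ≡ ev x

  handle-runs : ∀ {i h} → i < N → Context h → val h eᵛ ≡ i → val h badᵛ ≡ 0 → Sized′ h → Good′ i i i h →
    Runs handle (39 + S * 42) (λ h′ → Sized′ h′ × Status′ (suc i) (suc i) (suc i) h′) h
  handle-runs {i} {h} i<N (context B≡ A≡ σ≡ slacks evs) e≡ bad≡ Z G = runs-map (≤-reflexive (lemma S)) (λ _ _ q → q)
    (runs-exec {k = 3} ≤-refl (runs-⨾ {h = h₁} {Mid = λ h₂ → Sized′ h₂ × Status′ (suc i) i i h₂} dispatch
     λ h₂ ag₂ (Z₂ , st) → runs-if {k = 23 + S * 37}
       (λ ne → s≤s z≤n ▹ Z₂ , [ inj₁ , (λ (z , _) → contradiction z ne) ]′ st)
       (λ z → [ (λ (ne , _) → contradiction z ne)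
              , (λ (_ , G₂) → process-runs L slack≤σ m {i} i<N
                  (loaded (trans (val≡ ag₂ jobᵛ refl) job≡) (trans (val≡ ag₂ offᵛ refl) off≡) (trans (val≡ ag₂ kindᵛ refl) kind≡))
                  (trans (val≡ ag₂ Bᵛ refl) B≡) (trans (val≡ ag₂ σᵛ refl) σ≡) (λ j j<n → trans (arr≡ ag₂ slackᵃ refl j) (slacks j j<n)) z Z₂ G₂) ]′ st)))
    where
    lemma : ∀ s → 3 + (12 + s * 5 + (1 + (23 + s * 37))) ≡ 39 + s * 42
    lemma = solve-∀
    h₁ : Store
    h₁ = exec loadEvent h
    event≡ : events h (val h eᵛ) ≡ ev i
    event≡ = trans (evs _) (cong ev e≡)
    job≡ : val h₁ jobᵛ ≡ jobOf (ev i)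
    job≡ = cong jobOf event≡
    off≡ : val h₁ offᵛ ≡ off (ev i)
    off≡ = cong off event≡
    kind≡ : val h₁ kindᵛ ≡ kind (ev i)
    kind≡ = cong kind event≡
    Z₁ : Sized′ h₁
    Z₁ = sized-transport {h} refl refl Z
    G₁ : Good′ i i i h₁
    G₁ = good-transport {h = h} refl refl refl G
    skipped : ¬ (off (ev i) ≡ 0 × kind (ev i) ≡ 1) → Good′ (suc i) i i h₁
    skipped miss = record { powers = powers ; slots = slots ; table = table ; progress = progress-skip-start L miss progress }
      where open Good G₁
    isStart : kind (ev i) ≢ 0 → kind (ev i) ≡ 1
    isStart ne = [ proj₁ , (λ (k , _) → contradiction k ne) ]′ (Valid.origin (all-valid L i i<N))
    dispatch : Runs (ifNonzero (var kindᵛ) (ifNonzero (var offᵛ) skip activate) skip) (12 + S * 5)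
      (λ h₂ → Sized′ h₂ × Status′ (suc i) i i h₂) h₁
    dispatch = runs-if
      (λ k≢0 → runs-if
        (λ o≢0 → s≤s z≤n ▹ Z₁ , inj₂ (bad≡ , skipped λ (o , _) → o≢0 (trans off≡ o)))
        (λ o≡0 → activate-runs L slack≤σ m {i} i<N (isStart (k≢0 ∘ trans kind≡)) (trans (sym off≡) o≡0) job≡ B≡ A≡ bad≡ Z₁ G₁))
      (λ k≡0 → s≤s z≤n ▹ Z₁ , inj₂ (bad≡ , skipped λ (_ , k) → case trans (sym k) (trans (sym kind≡) k≡0) of λ ()))

  dpLoop-runs : ∀ {h} → Context h → val h Nᵛ ≡ N → val h eᵛ ≡ 0 → Sized′ h → Status′ 0 0 0 h →
    Runs dpLoop (suc (N * (42 + S * 42))) (λ h′ → Sized′ h′ × Status′ N N N h′) h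
  dpLoop-runs {h} C N≡ e≡ Z st = runs-map ≤-refl (λ _ _ → proj₂) (runs-repeat Inv {h = h} N≡ (e≡ , Z , st) step)
    where
    Inv : ℕ → Store → Set
    Inv i h′ = val h′ eᵛ ≡ i × Sized′ h′ × Status′ i i i h′
    step : ∀ i h′ → i < N → Agree (ifNonzero (var badᵛ) skip handle ⨾ eᵛ ≔ lit 1 ⊕ var eᵛ) h h′ → Inv i h′ →
      Runs (ifNonzero (var badᵛ) skip handle ⨾ eᵛ ≔ lit 1 ⊕ var eᵛ) (41 + S * 42) (Inv (suc i)) h′
    step i h′ i<N ag (e≡ , Z , st) = runs-map (≤-reflexive (+-comm (40 + S * 42) 1)) (λ _ _ q → q)
      (runs-⨾ {h = h′} {Mid = λ h″ → Sized′ h″ × Status′ (suc i) (suc i) (suc i) h″}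
        (runs-if {k = 39 + S * 42}
          (λ ne → s≤s z≤n ▹ Z , [ inj₁ , (λ (z , _) → contradiction z ne) ]′ st)
          (λ z → [ (λ (ne , _) → contradiction z ne) , (λ (_ , G) → handle-runs i<N C′ e≡ z Z G) ]′ st))
        λ h″ ag″ (Z″ , st″) → ≤-refl {1} ▹ cong suc (trans (val≡ ag″ eᵛ refl) e≡) , sized-transport {h″} refl refl Z″
          , [ inj₁ , (λ (z , G) → inj₂ (z , good-transport {h = h″} refl refl refl G)) ]′ st″)
      where
      open Context C
      C′ : Context h′
      C′ = context (trans (val≡ ag Bᵛ refl) B≡) (trans (val≡ ag Aᵛ refl) A≡) (trans (val≡ ag σᵛ refl) σ≡)
        (λ j j<n → trans (arr≡ ag slackᵃ refl j) (slacks j j<n))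
        (λ x → trans (events-agree ag refl refl refl refl x) (evs x))

  good-start : ∀ {h} → val h rᵛ ≡ 0 → val h Fᵛ ≡ 0 → arr h powᵃ 0 ≡ 1 → arr h tableᵃ 0 ≡ suc m → (∀ j → arr h slotᵃ j ≡ 0) → Good′ 0 0 0 h
  good-start {h} r≡ F≡ p≡ t≡ empty = record
    { powers   = λ k k≤ → case n≤0⇒n≡0 (≤-trans k≤ (≤-reflexive r≡)) of λ { refl → p≡ }
    ; slots    = slots-cong {slot = λ _ → 0} {spare = arr h spareᵃ} r≡ empty (λ _ → refl) F≡ record { occupied = λ k →
        trans (+-identityʳ _) (trans (∑-zero n) (sym (ind-no (k <? 0) λ ()))) }
    ; table    = tabulates-cong {slot = λ _ → 0} {T = arr h tableᵃ} r≡ empty (λ _ → refl) record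
        { upper    = λ x x< α b c → ≤-reflexive (trans (sym t≡) (cong (arr h tableᵃ) (sym (n≤0⇒n≡0 (≤-pred x<)))))
        ; attained = λ x x< → (λ _ → 0) , (λ _ → z≤n) , (λ _ _ _ ()) , trans (sym t≡) (cong (arr h tableᵃ) (sym (n≤0⇒n≡0 (≤-pred x<)))) }
    ; progress = progress-cong L {slot = λ _ → 0} empty F≡ r≡ record
        { idle = λ _ _ _ → refl ; busy = λ _ _ _ () ; over = λ _ _ _ () ; tally = refl } }

  -- `Placement` does not restrict `α` beyond the last job, whereas `Bounded` restricts every
  -- argument. On actual jobs nothing changes, as `α j ≤ slack X j ≤ σ`.
  clamp : (ℕ → ℕ) → ℕ → ℕ
  clamp α j = α j ⊓ σ

  clamp-placement : ∀ {α} → Placement X m α → Placement X m (clamp α)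
  clamp-placement {α} (fits , bounded) = (λ j j<n → ≤-trans (m⊓n≤m (α j) σ) (fits j j<n)) , λ τ →
    subst (_≤ m) (∑-cong n λ j j<n → cong (λ a → ind ((rel X j + a ≤? τ) ×-dec (τ <? rel X j + a + proc X j)))
      (sym (m≤n⇒m⊓n≡m (≤-trans (fits j j<n) (slack≤σ j j<n))))) (bounded τ)

  -- After the last event no job owns a slot, so every index is consistent with every `α`. Entry 0
  -- is therefore the maximum of `free` over all bounded offsets, and it is nonzero exactly if some
  -- choice of offsets never fails.
  verdict : ∀ {h} → Good′ N N N h → arr h tableᵃ 0 ≢ 0 ⇔ (∃[ α ] Placement X m α)
  verdict {h} G = mk⇔
    (λ ne → let α , b , c , e = attained 0 0< in free≢0⇒placement L m (λ j _ → b j) (λ z → ne (trans (sym e) z)))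
    (λ (α , P) z → placement⇒free≢0 L m slack≤σ (clamp-placement P) N ≤-refl (n≤0⇒n≡0 (≤-trans
      (upper 0 0< (clamp α) (λ j → m⊓n≤n (α j) σ) (λ j k j<n e → case trans (sym (all-over L progress j j<n)) e of λ ())) (≤-reflexive z))))
    where
    open Good G
    open Tabulates table
    0< : 0 < suc σ ^ val h rᵛ
    0< = m^n>0 (suc σ) (val h rᵛ)

  dynamicProgram-runs : ∀ {h} → val h σᵛ ≡ σ → val h mᵛ ≡ m → val h Nᵛ ≡ N → val h badᵛ ≡ 0 →
    (∀ j → j < n → arr h slackᵃ j ≡ slack X j) → (∀ x → events h x ≡ ev x) → (∀ j → arr h slotᵃ j ≡ 0) →
    Runs dynamicProgram (12 + σ * 2 + N * (42 + S * 42)) (λ h′ → val h′ nᵛ ≢ 0 ⇔ (∃[ α ] Placement X m α)) h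
  dynamicProgram-runs {h} σ≡ m≡ N≡ bad≡ slacks evs empty = runs-map (≤-reflexive (lemma (σ * 2) (N * (42 + S * 42)))) (λ _ _ q → q)
    (runs-⨾ {h = h} {Mid = λ h₁ → Context h₁ × val h₁ eᵛ ≡ 0 × Sized′ h₁ × Good′ 0 0 0 h₁} init
     λ h₁ ag₁ (C , e≡ , Z , G) → runs-⨾ (dpLoop-runs C (trans (val≡ ag₁ Nᵛ refl) N≡) e≡ Z (inj₂ (trans (val≡ ag₁ badᵛ refl) bad≡ , G)))
     λ h₂ ag₂ (_ , st) → runs-if {k = 1}
       (λ ne → ≤-refl ▹ [ (λ (_ , none) → mk⇔ (λ z → contradiction refl z) (λ (α , P) → contradiction P (none α)))
                        , (λ (z , _) → contradiction z ne) ]′ st)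
       (λ z → ≤-refl ▹ [ (λ (ne , _) → contradiction z ne) , (λ (_ , G) → verdict {h₂} G) ]′ st))
    where
    lemma : ∀ a b → 9 + a + (suc b + 2) ≡ 12 + a + b
    lemma = solve-∀
    h₀ : Store
    h₀ = exec (Bᵛ ≔ lit 1 ⊕ var σᵛ ⨾ Aᵛ ≔ var mᵛ) h
    init : Runs dpInit (9 + σ * 2) (λ h₁ → Context h₁ × val h₁ eᵛ ≡ 0 × Sized′ h₁ × Good′ 0 0 0 h₁) h
    init = runs-map (≤-reflexive (lemma′ (σ * 2))) (λ _ _ q → q) (runs-exec {k = 1} ≤-refl (runs-exec {k = 1} ≤-refl
      (runs-⨾ (runs-repeat (λ i h′ → val h′ Aᵛ ≡ i * (m + m) + m) {h = h₀} σ≡ m≡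
          λ i h′ _ ag A≡ → ≤-refl ▹ trans (cong₂ _+_ (cong₂ _+_ (m₁ ag) (m₁ ag)) A≡) (sym (+-assoc (m + m) (i * (m + m)) m)))
       λ h₁ ag₁ A≡ → ≤-refl {6} ▹
         context (trans (val≡ ag₁ Bᵛ refl) (cong suc σ≡)) (trans A≡ (total≡ σ m)) (trans (val≡ ag₁ σᵛ refl) σ≡)
           (λ j j<n → trans (arr≡ ag₁ slackᵃ refl j) (slacks j j<n)) (λ x → trans (events-agree ag₁ refl refl refl refl x) (evs x))
         , refl , sized z≤n refl
         , good-start {exec (rᵛ ≔ lit 0 ⨾ Fᵛ ≔ lit 0 ⨾ Mᵛ ≔ lit 1 ⨾ powᵃ [ lit 0 ]≔ lit 1 ⨾ tableᵃ [ lit 0 ]≔ lit 1 ⊕ var mᵛ ⨾ eᵛ ≔ lit 0) h₁}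
             refl refl refl (cong suc (trans (val≡ ag₁ mᵛ refl) m≡)) (λ j → trans (arr≡ ag₁ slotᵃ refl j) (empty j)))))
      where
      lemma′ : ∀ a → 1 + (1 + (suc a + 6)) ≡ 9 + a
      lemma′ = solve-∀
      total≡ : ∀ σ m → σ * (m + m) + m ≡ suc (σ + σ) * m
      total≡ = solve-∀
      m₁ : ∀ {h′} → Agree (Aᵛ ≔ (var mᵛ ⊕ var mᵛ) ⊕ var Aᵛ) h₀ h′ → val h′ mᵛ ≡ m
      m₁ ag = trans (val≡ ag mᵛ refl) m≡

mainTime : ℕ → ℕ → ℕ → ℕ → ℕ
mainTime n m s N = suc (6 + n * 21 + suc (orderTime n s N + (12 + s * 2 + suc s * N * (42 + suc s ^ (suc (s + s) * m) * 42))))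

main-runs : ∀ {h n m} → val h nᵛ ≡ n → val h mᵛ ≡ m → 0 < m → (∀ j → arr h slotᵃ j ≡ 0) → ∃[ s ] ∃[ N ] N ≤ n + n ×
  (∀ σ → (∀ j → j < n → slack (jobsIn (inp h) n) j ≤ σ) → s ≤ σ) ×
  Runs main (mainTime n m s N) (λ h′ → val h′ nᵛ ≢ 0 ⇔ (Roomy (jobsIn (inp h) n) × ∃[ α ] Placement (jobsIn (inp h) n) m α)) h
main-runs {h} {n} {m} n≡ m≡ m>0 empty = s , N , N≤ , least , runs-if
    -- The middle condition is equality with `h₁` because `s` and `N`, which occur in the time
    -- bound, are read off that store.
    (λ _ → runs-⨾ {h = h} {Mid = λ h′ → h′ ≡ h₁} (time≤ collected ▹ refl) λ { .h₁ ag₁ refl → runs-if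
      (λ bad → s≤s z≤n ▹ mk⇔ (λ z → contradiction refl z) (λ (roomy , _) → contradiction (⇒bad roomy) bad))
      (λ ok → runs-map ≤-refl (λ _ _ q → mk⇔ (λ ne → bad⇒ ok , Equivalence.to q ne) (λ (_ , α) → Equivalence.from q α))
        (runs-⨾ (order-runs {h₁} {X} refl refl N≤ base) λ h₂ ag₂ (N₂ , L) →
          dynamicProgram-runs L slack≤ m {h₂} (val≡ ag₂ σᵛ refl) (trans (val≡ ag₂ mᵛ refl) (trans (val≡ ag₁ mᵛ refl) m≡)) N₂
            (trans (val≡ ag₂ badᵛ refl) ok) (λ j j<n → trans (arr≡ ag₂ slackᵃ refl j) (slack≡ j j<n)) (λ _ → refl)
            (λ j → trans (arr≡ ag₂ slotᵃ refl j) (trans (arr≡ ag₁ slotᵃ refl j) (empty j))))) })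
    (λ z → contradiction (trans (sym m≡) z) (>⇒≢ m>0))
  where
  X = jobsIn (inp h) n
  h₁ : Store
  h₁ = exec collect h
  collected = collect-runs {h} n≡
  open Collected (post collected)
  s = val h₁ σᵛ
  N = val h₁ Nᵛ

-- Running time

-- Every term is charged to `Y` or `q`. The second sort contributes `s * suc s * N`, and `m > 0`
-- pays for it through `suc s ≤ S`. The hypothesis `s ≤ n * s` encodes that `s` is 0 when there are
-- no jobs, and covers the terms in `s` alone.
mainTime-bound : ∀ {n m s N} → 0 < m → N ≤ n + n → s ≤ n * s →
  mainTime n m s N ≤ 55 + 363 * (n * (suc s * suc s ^ (suc (s + s) * m))) + 54 * (n * ⌊log₂ n ⌋)
mainTime-bound {n} {m} {s} {N} m>0 N≤ s≤ns = begin
  mainTime n m s N      ≡⟨ expand n s (suc s) N S ℓ ⟩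
  55 + 21 * n + 48 * N + 10 * ℓ + 22 * (ℓ * N) + 14 * s + 6 * (s * N) + 46 * (suc s * N) + 22 * (s * (suc s * N)) + 42 * (suc s * N * S)
                        ≤⟨ +-mono-≤ (+-mono-≤ (+-mono-≤ (+-mono-≤ (+-mono-≤ (+-mono-≤ (+-mono-≤ (+-mono-≤ (+-monoʳ-≤ 55
                             (*-monoʳ-≤ 21 n≤)) (*-monoʳ-≤ 48 (≤-trans N≤ (+-mono-≤ n≤ n≤)))) (*-monoʳ-≤ 10 (ℓ≤ n)))
                             (*-monoʳ-≤ 22 ℓN≤)) (*-monoʳ-≤ 14 s≤)) (*-monoʳ-≤ 6 (pair s (≤-trans (n≤1+n s) B≤BS))))
                             (*-monoʳ-≤ 46 (pair (suc s) B≤BS))) (*-monoʳ-≤ 22 (≤-trans (≤-reflexive (sym (*-assoc s (suc s) N)))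
                               (pair (s * suc s) (≤-trans (*-monoˡ-≤ (suc s) (n≤1+n s)) (*-monoʳ-≤ (suc s) B≤S))))))
                             (*-monoʳ-≤ 42 (≤-trans (≤-reflexive (reorder (suc s) N S)) (pair (suc s * S) ≤-refl))) ⟩
  55 + 21 * Y + 48 * ((Y + Y)) + 10 * q + 22 * (q + q) + 14 * Y + 6 * (Y + Y) + 46 * (Y + Y) + 22 * (Y + Y) + 42 * (Y + Y)
                        ≡⟨ collected Y q ⟩
  55 + 363 * Y + 54 * q ∎
  where
  open ≤-Reasoning
  ℓ = ⌊log₂ n ⌋
  S = suc s ^ (suc (s + s) * m)
  Y = n * (suc s * S)
  q = n * ℓ
  expand : ∀ n s b N S ℓ → suc (6 + n * 21 + suc (1 + (4 + N * 4 + suc (suc ℓ) * (10 + N * 22) + (6 + s * 2 + s * N * 6 + (4 + b * N * 4 + s * (10 + b * N * 22))))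
      + (12 + s * 2 + b * N * (42 + S * 42)))) ≡
    55 + 21 * n + 48 * N + 10 * ℓ + 22 * (ℓ * N) + 14 * s + 6 * (s * N) + 46 * (b * N) + 22 * (s * (b * N)) + 42 * (b * N * S)
  expand = solve-∀
  collected : ∀ Y q → 55 + 21 * Y + 48 * ((Y + Y)) + 10 * q + 22 * (q + q) + 14 * Y + 6 * (Y + Y) + 46 * (Y + Y) + 22 * (Y + Y) + 42 * (Y + Y) ≡
    55 + 363 * Y + 54 * q
  collected = solve-∀
  reorder : ∀ b N S → b * N * S ≡ b * S * N
  reorder = solve-∀
  B≤S : suc s ≤ S
  B≤S = ≤-trans (≤-reflexive (sym (^-identityʳ (suc s)))) (^-monoʳ-≤ (suc s) (*-mono-≤ (s≤s (z≤n {s + s})) m>0))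
  S≥1 : 1 ≤ S
  S≥1 = m^n>0 (suc s) (suc (s + s) * m)
  B≤BS : suc s ≤ suc s * S
  B≤BS = m≤m*n (suc s) S {{>-nonZero S≥1}}
  n≤ : n ≤ Y
  n≤ = m≤m*n n (suc s * S) {{>-nonZero (≤-trans (s≤s z≤n) B≤BS)}}
  s≤ : s ≤ Y
  s≤ = ≤-trans s≤ns (*-monoʳ-≤ n (≤-trans (n≤1+n s) B≤BS))
  pair : ∀ a → a ≤ suc s * S → a * N ≤ Y + Y
  pair a a≤ = ≤-trans (*-mono-≤ a≤ N≤) (≤-reflexive (lemma (suc s * S) n))
    where
    lemma : ∀ a n → a * (n + n) ≡ n * a + n * a
    lemma = solve-∀
  ℓ≤ : ∀ n → ⌊log₂ n ⌋ ≤ n * ⌊log₂ n ⌋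
  ℓ≤ zero    = z≤n
  ℓ≤ (suc n) = m≤m+n _ _
  ℓN≤ : ℓ * N ≤ q + q
  ℓN≤ = ≤-trans (*-monoʳ-≤ ℓ N≤) (≤-reflexive (lemma ℓ n))
    where
    lemma : ∀ l n → l * (n + n) ≡ n * l + n * l
    lemma = solve-∀

statedBound : ℕ → ℕ → ℕ → ℕ
statedBound σ n m = (σ + 1) ^ ((2 * σ + 1) * m) * n * (σ * m) * ⌊log₂ (σ * m) ⌋ + n * ⌊log₂ n ⌋

1≤⌊log₂⌋ : ∀ {x} → 2 ≤ x → 1 ≤ ⌊log₂ x ⌋
1≤⌊log₂⌋ {x} 2≤x = subst (_≤ ⌊log₂ x ⌋) (⌊log₂[2^n]⌋≡n 1) (⌊log₂⌋-mono-≤ 2≤x)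

n≤1+n*log : ∀ n → n ≤ 1 + n * ⌊log₂ n ⌋
n≤1+n*log 0 = z≤n
n≤1+n*log 1 = s≤s z≤n
n≤1+n*log n@(suc (suc n-2)) = m≤n⇒m≤1+n (m≤m*n n ⌊log₂ n ⌋ {{>-nonZero (1≤⌊log₂⌋ {n} (s≤s (s≤s z≤n)))}})

-- If `σ * m ≥ 2`, then `suc σ ≤ 2 * (σ * m)` and the logarithm is at least 1. Otherwise `σ` is 0 or
-- `σ` and `m` are both 1. The factor beside `n` is then at most `2 * 2 ^ 3 ≡ 16`, and
-- `n ≤ 1 + n * log n` does the rest.
states-bound : ∀ σ n m → 0 < m → n * (suc σ * suc σ ^ (suc (σ + σ) * m)) ≤ 16 * (1 + statedBound σ n m)
states-bound σ n m m>0 with 2 ≤? σ * m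
... | yes 2≤σm = begin
  n * (suc σ * S)                              ≤⟨ *-monoʳ-≤ n (*-monoˡ-≤ S (+-mono-≤ {1} {σ * m} (≤-trans (s≤s z≤n) 2≤σm) (m≤m*n σ m {{>-nonZero m>0}}))) ⟩
  n * ((σ * m + σ * m) * S)                    ≡⟨ lemma n (σ * m) S ⟩
  2 * (S * n * (σ * m))                        ≤⟨ *-monoˡ-≤ (S * n * (σ * m)) (s≤s (s≤s (z≤n {14}))) ⟩
  16 * (S * n * (σ * m))                       ≤⟨ *-monoʳ-≤ 16 (m≤m*n (S * n * (σ * m)) ⌊log₂ (σ * m) ⌋ {{>-nonZero (1≤⌊log₂⌋ 2≤σm)}}) ⟩
  16 * (S * n * (σ * m) * ⌊log₂ (σ * m) ⌋)     ≡⟨ cong (λ s → 16 * (s * n * (σ * m) * ⌊log₂ (σ * m) ⌋)) (cong₂ (λ b e → b ^ (e * m)) (+-comm 1 σ) (twice σ)) ⟩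
  16 * ((σ + 1) ^ ((2 * σ + 1) * m) * n * (σ * m) * ⌊log₂ (σ * m) ⌋) ≤⟨ *-monoʳ-≤ 16 (≤-trans (m≤m+n _ (n * ⌊log₂ n ⌋)) (n≤1+n _)) ⟩
  16 * (1 + statedBound σ n m)                 ∎
  where
  open ≤-Reasoning
  S = suc σ ^ (suc (σ + σ) * m)
  lemma : ∀ n a s → n * ((a + a) * s) ≡ 2 * (s * n * a)
  lemma = solve-∀
  twice : ∀ σ → suc (σ + σ) ≡ 2 * σ + 1
  twice = solve-∀
... | no small = begin
  n * (suc σ * suc σ ^ (suc (σ + σ) * m))      ≤⟨ *-monoʳ-≤ n (constant σ m m>0 small) ⟩
  n * 16                                       ≡⟨ *-comm n 16 ⟩
  16 * n                                       ≤⟨ *-monoʳ-≤ 16 (≤-trans (n≤1+n*log n) (s≤s (m≤n+m _ _))) ⟩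
  16 * (1 + statedBound σ n m)                 ∎
  where
  open ≤-Reasoning
  constant : ∀ σ m → 0 < m → ¬ 2 ≤ σ * m → suc σ * suc σ ^ (suc (σ + σ) * m) ≤ 16
  constant zero m _ _ = ≤-trans (≤-reflexive (trans (*-identityˡ _) (^-zeroˡ (1 * m)))) (s≤s z≤n)
  constant (suc zero) (suc zero) _ _ = ≤-refl
  constant (suc zero) (suc (suc m)) _ small = contradiction (s≤s (s≤s z≤n)) small
  constant (suc (suc σ)) (suc m) _ small = contradiction (s≤s (≤-trans (s≤s z≤n) (m≤n+m (suc (m + σ * suc m)) m))) small

-- The constant is `55 + 363 * 16 + 54`, with the 16 from `states-bound`; the passage from `s` to
-- `σ` is monotonicity.
runningTime-bound : ∀ {n m s N σ} → 0 < m → N ≤ n + n → s ≤ n * s → s ≤ σ → mainTime n m s N ≤ 5917 * (1 + statedBound σ n m)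
runningTime-bound {n} {m} {s} {N} {σ} m>0 N≤ s≤ns s≤σ = begin
  mainTime n m s N                                ≤⟨ mainTime-bound {n} {m} {s} {N} m>0 N≤ s≤ns ⟩
  55 + 363 * (n * (suc s * suc s ^ (suc (s + s) * m))) + 54 * q
                                                  ≤⟨ +-mono-≤ (+-mono-≤ (*-monoʳ-≤ 55 (s≤s (z≤n {g}))) (*-monoʳ-≤ 363 (≤-trans (*-monoʳ-≤ n mono) (states-bound σ n m m>0))))
                                                       (*-monoʳ-≤ 54 (≤-trans (m≤n+m q _) (n≤1+n g))) ⟩
  55 * (1 + g) + 363 * (16 * (1 + g)) + 54 * (1 + g) ≡⟨ lemma (1 + g) ⟩
  5917 * (1 + g)                                  ∎
  where
  open ≤-Reasoning
  g = statedBound σ n m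
  q = n * ⌊log₂ n ⌋
  mono : suc s * suc s ^ (suc (s + s) * m) ≤ suc σ * suc σ ^ (suc (σ + σ) * m)
  mono = *-mono-≤ (s≤s s≤σ) (≤-trans (^-monoˡ-≤ (suc (s + s) * m) (s≤s s≤σ)) (^-monoʳ-≤ (suc σ) (*-monoˡ-≤ m (s≤s (+-mono-≤ s≤σ s≤σ)))))
  lemma : ∀ x → 55 * x + 363 * (16 * x) + 54 * x ≡ 5917 * x
  lemma x = trans (cong (λ y → 55 * x + y + 54 * x) (sym (*-assoc 363 16 x)))
    (trans (cong (_+ 54 * x) (sym (*-distribʳ-+ x 55 (363 * 16)))) (sym (*-distribʳ-+ x (55 + 363 * 16) 54)))

-- The input encoding and the final assembly

module _ (I : JobInstance) where

  private
    n : ℕ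
    n = #jobs I
    m : ℕ
    m = #machines I
    record₃ : ∀ {n} → (Fin n → Job) → ℕ → ℕ
    record₃ f = contents (concat (tabulate λ j → release (f j) ∷ deadline (f j) ∷ processing (f j) ∷ []))

    beyond : ∀ {n} (f : Fin n → Job) y → n * 3 ≤ y → record₃ f y ≡ 0
    beyond {zero}  f y le = refl
    beyond {suc n} f (suc (suc (suc y))) (s≤s (s≤s (s≤s le))) = beyond (f ∘ suc) y le

    release-at : ∀ {n} (f : Fin n → Job) j → record₃ f (toℕ j * 3) ≡ release (f j)
    release-at f zero    = refl
    release-at f (suc j) = release-at (f ∘ suc) j

    deadline-at : ∀ {n} (f : Fin n → Job) j → record₃ f (toℕ j * 3 + 1) ≡ deadline (f j)
    deadline-at f zero    = refl
    deadline-at f (suc j) = deadline-at (f ∘ suc) j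

    processing-at : ∀ {n} (f : Fin n → Job) j → record₃ f (toℕ j * 3 + 2) ≡ processing (f j)
    processing-at f zero    = refl
    processing-at f (suc j) = processing-at (f ∘ suc) j

  -- The state after the two assignments of `onInput`: `m` has moved to register 2, which represents
  -- `mᵛ`, and register 1 holds the input size `3 * n`. Register 0 represents `nᵛ` as it is.
  initial : State
  initial = mkState (update (update (reg (input I)) 2 m) 1 (n + n + n)) (mem (input I))

  initialStore : Store
  initialStore = store (λ v → reg initial (v + v)) (λ _ _ → 0) (mem (input I))

  jobs : Jobs
  jobs = jobsIn (mem (input I)) n

  initial-represents : Represents (n + n + n) initialStore initial
  initial-represents = record
    { base≡ = refl ; vars≡ = λ _ → refl ; input≡ = λ _ _ → refl
    ; input≡0 = λ y le → beyond (job I) y (≤-trans (≤-reflexive (lemma n)) le)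
    ; arrays≡ = λ a x → beyond (job I) _ (≤-trans (≤-reflexive (lemma n)) (≤-trans (m≤m+n _ (toℕ a)) (m≤m+n _ _))) }
    where
    lemma : ∀ n → n * 3 ≡ n + n + n
    lemma = solve-∀

  yes⇔placement : 0 < m → (Roomy jobs × ∃[ α ] Placement jobs m α) ⇔ Σ (Schedule I) (Feasible I)
  yes⇔placement m>0 = mk⇔
    (λ (roomy , α , P) → placement⇒schedule I jobs refl (release-at (job I)) (deadline-at (job I)) (processing-at (job I)) m>0 roomy P)
    (λ (S , F) → schedule⇒placement I jobs refl (release-at (job I)) (deadline-at (job I)) (processing-at (job I)) S F)

  slack-bound : ∀ {σ} → HasSlack I σ → ∀ j → j < n → slack jobs j ≤ σ
  slack-bound {σ} within j j<n = subst (λ j → slack jobs j ≤ σ) (toℕ-fromℕ< j<n) (bounded (fromℕ< j<n))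
    where
    bounded : ∀ (j : Fin n) → slack jobs (toℕ j) ≤ σ
    bounded j rewrite release-at (job I) j | deadline-at (job I) j | processing-at (job I) j =
      m≤n+o⇒m∸n≤o d (r + p) (≤-trans (m≤n+∣m-n∣ d r) (≤-trans (+-monoʳ-≤ r (within j)) (≤-reflexive (sym (+-assoc r p σ)))))
      where
      r = release (job I j)
      d = deadline (job I j)
      p = processing (job I j)

  no-machines : m ≡ 0 → Runs main 2 (λ h → val h nᵛ ≢ 0 ⇔ Σ (Schedule I) (Feasible I)) initialStore
  no-machines m≡0 = runs-if {k = 1} (λ m≢0 → contradiction m≡0 m≢0) (λ _ → ≤-refl ▹ mk⇔ (to n refl) (from n refl))
    where
    none : ∀ {A : Fin n → Set} → n ≡ 0 → ∀ j → A j
    none n≡0 j = ⊥-elim (¬Fin0 (subst Fin n≡0 j))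
    to : ∀ k → n ≡ k → 1 ∸ k ≢ 0 → Σ (Schedule I) (Feasible I)
    to zero n≡0 _ = record { machine = none n≡0 ; start = none n≡0 }
      , record { oneAtATime = none n≡0 ; released = none n≡0 ; inTime = none n≡0 }
    to (suc k) _ ne = contradiction (0∸n≡0 k) ne
    from : ∀ k → n ≡ k → Σ (Schedule I) (Feasible I) → 1 ∸ k ≢ 0
    from zero _ _ = λ ()
    from (suc k) n≡ (S , _) = ⊥-elim (¬Fin0 (subst Fin m≡0 (Schedule.machine S (subst Fin (sym n≡) zero))))

  main-decides : ∀ {σ} → HasSlack I σ →
    ∃[ t ] t ≤ 5917 * (1 + statedBound σ n m) × Runs main t (λ h → val h nᵛ ≢ 0 ⇔ Σ (Schedule I) (Feasible I)) initialStore
  main-decides {σ} within = decide (0 <? m)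
    where
    decide : Dec (0 < m) →
      ∃[ t ] t ≤ 5917 * (1 + statedBound σ n m) × Runs main t (λ h → val h nᵛ ≢ 0 ⇔ Σ (Schedule I) (Feasible I)) initialStore
    decide (no m≯0) = 2 , *-mono-≤ {2} {5917} {1} {1 + statedBound σ n m} (s≤s (s≤s z≤n)) (s≤s z≤n) , no-machines (n≤0⇒n≡0 (≮⇒≥ m≯0))
    decide (yes m>0) =
      let s , N , N≤ , least , run = main-runs {initialStore} {n} {m} refl refl m>0 (λ _ → refl)
          small : ∀ k → n ≡ k → s ≤ k * s
          -- Without jobs, 0 bounds all slacks, so minimality gives `s ≤ 0`.
          small = λ { zero n≡0 → least 0 λ j j<n → case subst (j <_) n≡0 j<n of λ () ; (suc k) _ → m≤m+n s (k * s) }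
      in mainTime n m s N
       , runningTime-bound {n} {m} {s} {N} {σ} m>0 N≤ (small n refl) (least σ (slack-bound within))
       , runs-map ≤-refl (λ _ _ q → yes⇔placement m>0 ⇔-∘ q) run

onInput : Cmd → Program
onInput P = reg[ 2 ]≔ reg[ 1 ] ⨾ reg[ 1 ]≔ reg[ 0 ] ⊕ reg[ 0 ] ⊕ reg[ 0 ] ⨾ compile 0 P

Solved : JobInstance → ℕ → Set
Solved I a = a ≢ 0 ⇔ Σ (Schedule I) (Feasible I)

-- The 8 is the cost of the two preliminary assignments, 2 and 6 steps.
onInput-runs : ∀ P → ∃[ κ ] ∀ I {t} → Runs P t (λ h → Solved I (val h nᵛ)) (initialStore I) →
  ∃[ k ] ∃[ s ] ⟨ onInput P , input I ⟩⇓[ k ] s × k ≤ 8 + κ * t × Solved I (reg s 0)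
onInput-runs P = let κ , simulates = simulate P in κ , λ I {t} run →
  let n = #jobs I
      simulated low steps≤ repr _ = simulates (n + n + n) 0 (initialStore I) (initial I) (initial-represents I)
  in _ , _ , ⇓-seq ⇓-reg (⇓-seq ⇓-reg low) , +-monoʳ-≤ 8 (≤-trans steps≤ (*-monoʳ-≤ κ (time≤ run)))
   , subst (Solved I) (sym (vars≡ repr 0)) (post run)

linear-in : ∀ κ c {t} g → t ≤ c * (1 + g) → 8 + κ * t ≤ (8 + κ * c) * (1 + g)
linear-in κ c {t} g t≤ = begin
  8 + κ * t                            ≤⟨ +-mono-≤ (m≤m*n 8 (1 + g)) (*-monoʳ-≤ κ t≤) ⟩
  8 * (1 + g) + κ * (c * (1 + g))      ≡⟨ cong (8 * (1 + g) +_) (*-assoc κ c (1 + g)) ⟨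
  8 * (1 + g) + κ * c * (1 + g)        ≡⟨ *-distribʳ-+ (1 + g) 8 (κ * c) ⟨
  (8 + κ * c) * (1 + g)                ∎
  where open ≤-Reasoning

theorem5p1 : ∃[ P ] P SolvesAll _-SlackIntervalConstrainedScheduling InTimeO λ σ I →
  let n = #jobs (proj₁ I)
      m = #machines (proj₁ I)
  in (σ + 1) ^ ((2 * σ + 1) * m) * n * (σ * m) * ⌊log₂ (σ * m) ⌋ + n * ⌊log₂ n ⌋
theorem5p1 = onInput main , bounded main 5917 (onInput-runs main) main-decides
  where
  -- Stated for arbitrary `P` and `c`, so that `main` and the constant stay opaque here.
  bounded : ∀ P c → (∃[ κ ] ∀ I {t} → Runs P t (λ h → Solved I (val h nᵛ)) (initialStore I) →
      ∃[ k ] ∃[ s ] ⟨ onInput P , input I ⟩⇓[ k ] s × k ≤ 8 + κ * t × Solved I (reg s 0)) →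
    (∀ I {σ} → HasSlack I σ →
      ∃[ t ] t ≤ c * (1 + statedBound σ (#jobs I) (#machines I)) × Runs P t (λ h → Solved I (val h nᵛ)) (initialStore I)) →
    ∃[ c′ ] ∀ σ → onInput P Solves (σ -SlackIntervalConstrainedScheduling) InTime
      λ (I , _) → c′ * (1 + statedBound σ (#jobs I) (#machines I))
  bounded P c (κ , low) decides = 8 + κ * c , λ σ (I , within) →
    let t , t≤ , run = decides I within
        k , s , steps , k≤ , correct = low I run
    in k , s , steps , ≤-trans k≤ (linear-in κ c (statedBound σ (#jobs I) (#machines I)) t≤) , correct
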